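{- Let $k \geq 5$ and $G$ a $k$-dicritical digraph. Then \[\lvert A(G)\rvert \ge (k-\frac 1 2 - \frac 1 {k-1}) \lvert V(G)\rvert - k(\frac 1 2 - \frac 1 {k-1}).\]
   Context: A digraph $G$ is $k$-dicritical if its dichromatic number (minimum number of parts in a partition of $V(G)$ into sets inducing acyclic subdigraphs) is $k$ and every proper subdigraph has dichromatic number at most $k-1$. -}

module Defs where

open import Data.Nat using (ℕ; zero; suc; _+_; _*_)
open import Data.Bool using (Bool; true; false; if_then_else_)
open import Data.Fin using (Fin)
open import Data.List using (List; []; _∷_; _++_; [_]; map; allFin)
open import Data.Nat.ListAction using (sum)
open import Data.List.Relation.Unary.All using (All)
open import Data.List.Relation.Unary.Unique.Propositional using (Unique)
open import Data.Product using (Σ; ∃; _×_; _,_)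
open import Data.Sum using (_⊎_)
open import Data.Unit using (⊤)
open import Relation.Binary.PropositionalEquality using (_≡_)
open import Relation.Nullary using (¬_)

-- A digraph on vertex set Fin n: arc relation given by a Boolean matrix.
-- (No parallel arcs by construction; digons u→v, v→u are allowed.)
Rel : ℕ → Set
Rel n = Fin n → Fin n → Bool

Loopless : ∀ {n} → Rel n → Set
Loopless {n} A = (v : Fin n) → A v v ≡ false

arcCount : ∀ {n} → Rel n → ℕ
arcCount {n} A = sum (map (λ u → sum (map (λ v → if A u v then 1 else 0) (allFin n))) (allFin n))

Chain : ∀ {n} → Rel n → List (Fin n) → Set
Chain B [] = ⊤
Chain B (x ∷ []) = ⊤
Chain B (x ∷ y ∷ xs) = (B x y ≡ true) × Chain B (y ∷ xs)

data DirCycle {n} (B : Rel n) : List (Fin n) → Set where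
  cyc : (x : Fin n) (xs : List (Fin n)) →
        Unique (x ∷ xs) → Chain B ((x ∷ xs) ++ [ x ]) → DirCycle B (x ∷ xs)

record Subdigraph {n} (A : Rel n) : Set where
  field
    S : Fin n → Bool
    B : Rel n
    B⊆A : ∀ u v → B u v ≡ true → A u v ≡ true
    B-ends : ∀ u v → B u v ≡ true → (S u ≡ true) × (S v ≡ true)

Proper : ∀ {n} {A : Rel n} → Subdigraph A → Set
Proper {n} {A} H = (∃ λ v → Subdigraph.S H v ≡ false)
                 ⊎ (∃ λ u → ∃ λ v → (A u v ≡ true) × (Subdigraph.B H u v ≡ false))

-- (S, B) admits a partition of S into k sets each inducing an acyclic
-- subdigraph: a colouring with k colours with no monochromatic directed
-- cycle (using arcs of B, whose ends all lie in S).
DiColourable : ∀ {n} → ℕ → (Fin n → Bool) → Rel n → Set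
DiColourable {n} k S B =
  Σ (Fin n → Fin k) λ c → (xs : List (Fin n)) → DirCycle B xs →
     ¬ (∃ λ (i : Fin k) → All (λ v → c v ≡ i) xs)

DichromaticNumberIs : ∀ {n} → (Fin n → Bool) → Rel n → ℕ → Set
DichromaticNumberIs S B zero = DiColourable zero S B
DichromaticNumberIs S B (suc k) = DiColourable (suc k) S B × ¬ DiColourable k S B

Dicritical : ∀ {n} → ℕ → Rel n → Set
Dicritical {n} k A =
  DichromaticNumberIs (λ _ → true) A k ×
  ((H : Subdigraph A) → Proper H →
     DiColourable (Data.Nat.pred k) (Subdigraph.S H) (Subdigraph.B H))

{-# OPTIONS --safe #-}
module Submission where

-- Potential method. Write K = k − 1 and ε = 1/2 − 1/K, give a vertex set R the potential (K + ε)|R| − |A(R)|, and take a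
-- counterexample D with as few vertices as possible. Collapsing the colour classes of a coloured proper subset R to a complete
-- digraph gives a smaller non-colourable digraph, so the potential of R is at least that of a vertex; forcing a boundary vertex
-- of R to differ in colour from other boundary vertices raises this to the potential of the complete digraph on K vertices
-- whenever an arc leaves R towards a vertex of indegree K. Replacing a vertex z by a vertex joined by digons to the closed
-- out-neighbourhood of a tail a of outdegree K keeps the digraph non-colourable; together with the potential bounds and a
-- tie-break on arcs, digons and triangles of digons this shows that an arc from a vertex of outdegree K to a vertex of indegree K
-- exists only inside a cluster of twins of degree 2K, or next to a complete digraph on K vertices, and that the other neighbours
-- of a cluster of size t have indegree and outdegree at least K + t − 1. Discharging indegrees along arcs from vertices of
-- outdegree K, and dually in the reversed digraph, then yields the bound.

open import Defs
open import Data.Nat using (ℕ; zero; suc; _+_; _*_; _∸_; _≤_; _<_; z≤n; s≤s; _⊔_; _≤?_; _<?_)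
open import Data.Nat.Properties hiding (_≟_)
open import Data.Nat.ListAction using (sum)
open import Data.Nat.Tactic.RingSolver using (solve-∀)
open import Data.Bool using (Bool; true; false; if_then_else_; not; _∧_)
import Data.Bool as Bool
open import Data.Fin using (Fin)
import Data.Fin as Fin
open import Data.Fin.Properties using (toℕ-inject≤; toℕ<n; inject≤-injective; toℕ-injective; toℕ-fromℕ<)
open import Data.List using (List; []; _∷_; _++_; [_]; map; filter; length; allFin; cartesianProduct; take; foldr)
open import Data.List.Properties using (length-++; length-take; filter-++; filter-accept; filter-reject; length-tabulate; filter-all)
open import Data.List.Membership.Propositional using (_∈_; _∉_; lose; find)
open import Data.List.Membership.Propositional.Properties
open import Data.List.Relation.Unary.Any using (here; there; any?)
open import Data.List.Relation.Unary.All using ([]; _∷_)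
import Data.List.Relation.Unary.All as All
open import Data.List.Relation.Unary.AllPairs using ([]; _∷_)
open import Data.List.Relation.Unary.Unique.Propositional using (Unique)
import Data.List.Relation.Unary.Unique.Propositional.Properties as Unique
open import Data.Product using (Σ; ∃; _×_; _,_; proj₁; proj₂)
open import Data.Product.Properties using (≡-dec)
open import Data.Sum using (_⊎_; inj₁; inj₂; [_,_]′)
import Data.Sum.Properties as Sum
open import Data.Empty using (⊥; ⊥-elim)
open import Data.Unit using (⊤; tt)
open import Function using (_∘_; id; case_of_)
open import Relation.Nullary using (¬_; Dec; yes; no)
open import Relation.Nullary.Decidable using (decidable-stable; _×-dec_; _⊎-dec_; ¬?; map′; ⌊_⌋)
open import Relation.Binary.Definitions using (DecidableEquality)
open import Relation.Binary.PropositionalEquality using (_≡_; _≢_; refl; sym; trans; cong; cong₂; subst; subst₂)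

-- Counting in finite types

-- Let M = `weight`, C = `bound` and N = `cliqueBound`: the potentials of one vertex and of the
-- complete digraphs on K + 1 and on K vertices. A vertex joined by digons to K others changes the
-- potential by M - 4K², and N + M - 4K² = C. A proper critical piece of a copied digraph is thus
-- refuted by induction as soon as the piece without the new vertex has potential above N; the bound
-- M would not do. The obstacle is a collapse from which a single class survives, which yields only
-- M. But each boundary vertex outside the surviving class loses an arc there, worth 2K, so about
-- κ/2 vertices forced away from that class lift M to N. The forcing adds digons, which the
-- induction tolerates since M - C = K(κ + 4). The discharging has room to spare: ε equals κ/(2K),
-- while the charges amount to κ/(2K - 1) per vertex. Colourability is never decided. Critical sets
-- are found under double negation, and the conclusions drawn from them are contradictions or
-- decidable statements, mostly inequalities between numbers.

record Finite (A : Set) : Set where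
  field
    _≟_ : DecidableEquality A
    enum : List A
    complete : ∀ x → x ∈ enum
    unique : Unique enum

open Finite {{...}} public

instance
  finFinite : ∀ {n} → Finite (Fin n)
  finFinite {n} = record { _≟_ = Fin._≟_ ; enum = allFin n ; complete = ∈-allFin ; unique = Unique.allFin⁺ n }

  sumFinite : ∀ {A B : Set} {{_ : Finite A}} {{_ : Finite B}} → Finite (A ⊎ B)
  sumFinite = record
    { _≟_ = Sum.≡-dec _≟_ _≟_
    ; enum = map inj₁ enum ++ map inj₂ enum
    ; complete = λ { (inj₁ x) → ∈-++⁺ˡ (∈-map⁺ inj₁ (complete x))
                   ; (inj₂ y) → ∈-++⁺ʳ (map inj₁ enum) (∈-map⁺ inj₂ (complete y)) }
    ; unique = Unique.++⁺ (Unique.map⁺ Sum.inj₁-injective unique) (Unique.map⁺ Sum.inj₂-injective unique)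
        λ { (p , q) → case (∈-map⁻ inj₁ p , ∈-map⁻ inj₂ q) of λ { ((_ , _ , refl) , (_ , _ , ())) } }
    }

  prodFinite : ∀ {A B : Set} {{_ : Finite A}} {{_ : Finite B}} → Finite (A × B)
  prodFinite = record
    { _≟_ = ≡-dec _≟_ _≟_
    ; enum = cartesianProduct enum enum
    ; complete = λ { (x , y) → ∈-cartesianProduct⁺ (complete x) (complete y) }
    ; unique = Unique.cartesianProduct⁺ unique unique
    }

-- Membership is a type and not a Boolean so that its proofs can carry witnesses, such as the arc of
-- `D` behind an arc of a collapsed digraph; decidability serves counting and case analysis.
record DSet (A : Set) : Set₁ where
  constructor dset
  field
    mem : A → Set
    mem? : ∀ x → Dec (mem x)

open DSet public

infix 4 _∈ˢ_ _∉ˢ_ _⊆ˢ_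

_∈ˢ_ _∉ˢ_ : {A : Set} → A → DSet A → Set
x ∈ˢ P = mem P x
x ∉ˢ P = ¬ (x ∈ˢ P)

_⊆ˢ_ : {A : Set} → DSet A → DSet A → Set
P ⊆ˢ Q = ∀ x → x ∈ˢ P → x ∈ˢ Q

module _ {A : Set} {{_ : Finite A}} where

  ∃? : {P : A → Set} → (∀ x → Dec (P x)) → Dec (∃ P)
  ∃? P? = map′ (λ p → proj₁ (find p) , proj₂ (proj₂ (find p))) (λ (x , p) → lose (complete x) p) (any? P? enum)

  elements : DSet A → List A
  elements P = filter (mem? P) enum

  ∣_∣ : DSet A → ℕ
  ∣ P ∣ = length (elements P)

  ∈-elements : (P : DSet A) {x : A} → x ∈ˢ P → x ∈ elements P
  ∈-elements P {x} p = ∈-filter⁺ (mem? P) (complete x) p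

  elements-∈ : (P : DSet A) {x : A} → x ∈ elements P → x ∈ˢ P
  elements-∈ P m = proj₂ (∈-filter⁻ (mem? P) {xs = enum} m)

  elements-unique : (P : DSet A) → Unique (elements P)
  elements-unique P = Unique.filter⁺ (mem? P) unique

  ∅ˢ : DSet A
  ∅ˢ = dset (λ _ → ⊥) (λ _ → no id)

  ⟨_⟩ : A → DSet A
  ⟨ x ⟩ = dset (_≡ x) (_≟ x)

  infixl 7 _∩_ _∖_
  infixl 6 _∪_
  infixl 7 _-_

  _∩_ _∖_ _∪_ : DSet A → DSet A → DSet A
  P ∩ Q = dset (λ x → x ∈ˢ P × x ∈ˢ Q) (λ x → mem? P x ×-dec mem? Q x)
  P ∖ Q = dset (λ x → x ∈ˢ P × x ∉ˢ Q) (λ x → mem? P x ×-dec ¬? (mem? Q x))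
  P ∪ Q = dset (λ x → x ∈ˢ P ⊎ x ∈ˢ Q) (λ x → mem? P x ⊎-dec mem? Q x)

  _-_ : DSet A → A → DSet A
  P - v = dset (λ x → x ∈ˢ P × x ≢ v) (λ x → mem? P x ×-dec ¬? (x ≟ v))

module _ {A B : Set} where

  infixr 6 _⊕_
  infixr 7 _⊗_

  _⊕_ : DSet A → DSet B → DSet (A ⊎ B)
  P ⊕ Q = dset [ mem P , mem Q ]′ λ { (inj₁ x) → mem? P x ; (inj₂ y) → mem? Q y }

  _⊗_ : DSet A → DSet B → DSet (A × B)
  P ⊗ Q = dset (λ (x , y) → x ∈ˢ P × y ∈ˢ Q) (λ (x , y) → mem? P x ×-dec mem? Q y)

unique-⊆-length : {A : Set} {xs ys : List A} → Unique xs → (∀ {x} → x ∈ xs → x ∈ ys) → length xs ≤ length ys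
unique-⊆-length {xs = []} _ _ = z≤n
unique-⊆-length {A} {x ∷ xs} (x∉ ∷ u) sub with ∈-∃++ (sub (here refl))
... | ys , zs , refl = begin
    suc (length xs)            ≤⟨ s≤s (unique-⊆-length u sub′) ⟩
    suc (length (ys ++ zs))    ≡⟨ cong suc (length-++ ys) ⟩
    suc (length ys + length zs) ≡⟨ sym (+-suc (length ys) (length zs)) ⟩
    length ys + suc (length zs) ≡⟨ sym (length-++ ys) ⟩
    length (ys ++ x ∷ zs)      ∎
  where
  open ≤-Reasoning
  sub′ : ∀ {y} → y ∈ xs → y ∈ ys ++ zs
  sub′ y∈ with ∈-++⁻ ys (sub (there y∈))
  ... | inj₁ m = ∈-++⁺ˡ m
  ... | inj₂ (here refl) = ⊥-elim (All.lookup x∉ y∈ refl)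
  ... | inj₂ (there m) = ∈-++⁺ʳ ys m

infix 4 _↪_

-- The image may depend on the membership proof and injectivity ranges over all proofs, so an
-- element can be sent to whatever witness its proof supplies.
record _↪_ {A B : Set} (P : DSet A) (Q : DSet B) : Set where
  constructor inject
  field
    to : ∀ x → x ∈ˢ P → Σ B (mem Q)
    injective : ∀ x y p q → proj₁ (to x p) ≡ proj₁ (to y q) → x ≡ y

open _↪_ public

module _ {A : Set} {{_ : Finite A}} where

  Σˢ : DSet A → (A → ℕ) → ℕ
  Σˢ P f = sum (map f (elements P))

  Σˢ-const : (P : DSet A) (c : ℕ) → Σˢ P (λ _ → c) ≡ ∣ P ∣ * c
  Σˢ-const P c = go (elements P)
    where
    go : ∀ xs → sum (map (λ _ → c) xs) ≡ length xs * c
    go [] = refl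
    go (_ ∷ xs) = cong (c +_) (go xs)

  Σˢ-mono : (P : DSet A) {f g : A → ℕ} → (∀ x → x ∈ˢ P → f x ≤ g x) → Σˢ P f ≤ Σˢ P g
  Σˢ-mono P {f} {g} le = go (elements P) (λ _ → elements-∈ P)
    where
    go : ∀ xs → (∀ x → x ∈ xs → x ∈ˢ P) → sum (map f xs) ≤ sum (map g xs)
    go [] _ = z≤n
    go (x ∷ xs) s = +-mono-≤ (le x (s x (here refl))) (go xs λ y → s y ∘ there)

  Σˢ-+ : (P : DSet A) (f g : A → ℕ) → Σˢ P (λ x → f x + g x) ≡ Σˢ P f + Σˢ P g
  Σˢ-+ P f g = go (elements P)
    where
    go : ∀ xs → sum (map (λ x → f x + g x) xs) ≡ sum (map f xs) + sum (map g xs)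
    go [] = refl
    go (x ∷ xs) = trans (cong (f x + g x +_) (go xs)) (interchange (f x) (g x) (sum (map f xs)) (sum (map g xs)))
      where
      interchange : ∀ a b c d → a + b + (c + d) ≡ a + c + (b + d)
      interchange = solve-∀

  Σˢ-* : (P : DSet A) (c : ℕ) (f : A → ℕ) → Σˢ P (λ x → c * f x) ≡ c * Σˢ P f
  Σˢ-* P c f = go (elements P)
    where
    go : ∀ xs → sum (map (λ x → c * f x) xs) ≡ c * sum (map f xs)
    go [] = sym (*-zeroʳ c)
    go (x ∷ xs) = trans (cong (c * f x +_) (go xs)) (sym (*-distribˡ-+ c (f x) _))

length-filter-++ : {A : Set} (P : DSet A) (xs ys : List A) →
  length (filter (mem? P) (xs ++ ys)) ≡ length (filter (mem? P) xs) + length (filter (mem? P) ys)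
length-filter-++ P xs ys = trans (cong length (filter-++ (mem? P) xs ys)) (length-++ (filter (mem? P) xs))

module _ {A B : Set} {{_ : Finite A}} {{_ : Finite B}} where

  ∣∣-mono : {P : DSet A} {Q : DSet B} → P ↪ Q → ∣ P ∣ ≤ ∣ Q ∣
  ∣∣-mono {P} {Q} f = ≤-trans (≤-reflexive (sym (image-length (elements P) sub)))
      (unique-⊆-length (image-unique (elements P) sub (elements-unique P)) image⊆)
    where
    sub : ∀ x → x ∈ elements P → x ∈ˢ P
    sub _ = elements-∈ P
    image : (xs : List A) → (∀ x → x ∈ xs → x ∈ˢ P) → List B
    image [] _ = []
    image (x ∷ xs) s = proj₁ (to f x (s x (here refl))) ∷ image xs (λ y → s y ∘ there)
    image-length : ∀ xs s → length (image xs s) ≡ length xs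
    image-length [] _ = refl
    image-length (x ∷ xs) s = cong suc (image-length xs (λ y → s y ∘ there))
    image-∈ : ∀ xs s {y} → y ∈ image xs s → ∃ λ x → ∃ λ (m : x ∈ xs) → y ≡ proj₁ (to f x (s x m))
    image-∈ (x ∷ xs) s (here refl) = x , here refl , refl
    image-∈ (x ∷ xs) s (there m) = let (x′ , m′ , e) = image-∈ xs (λ y → s y ∘ there) m in x′ , there m′ , e
    image-unique : ∀ xs s → Unique xs → Unique (image xs s)
    image-unique [] _ _ = []
    image-unique (x ∷ xs) s (x∉ ∷ u) =
      All.tabulate (λ {y} m e → let (x′ , m′ , e′) = image-∈ xs (λ y → s y ∘ there) m in
        All.lookup x∉ m′ (injective f x x′ _ _ (trans e e′)))
      ∷ image-unique xs (λ y → s y ∘ there) u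
    image⊆ : ∀ {y} → y ∈ image (elements P) sub → y ∈ elements Q
    image⊆ m = let (x , m′ , e) = image-∈ (elements P) sub m in
      subst (_∈ elements Q) (sym e) (∈-elements Q (proj₂ (to f x (sub x m′))))

  ∣⊕∣ : (P : DSet A) (Q : DSet B) → ∣ P ⊕ Q ∣ ≡ ∣ P ∣ + ∣ Q ∣
  ∣⊕∣ P Q = trans (cong length (filter-++ (mem? (P ⊕ Q)) (map inj₁ enum) (map inj₂ enum)))
    (trans (length-++ (filter (mem? (P ⊕ Q)) (map inj₁ enum))) (cong₂ _+_ (l enum) (r enum)))
    where
    l : ∀ xs → length (filter (mem? (P ⊕ Q)) (map inj₁ xs)) ≡ length (filter (mem? P) xs)
    l [] = refl
    l (x ∷ xs) with mem? P x
    ... | yes p = cong suc (l xs)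
    ... | no _ = l xs
    r : ∀ xs → length (filter (mem? (P ⊕ Q)) (map inj₂ xs)) ≡ length (filter (mem? Q) xs)
    r [] = refl
    r (x ∷ xs) with mem? Q x
    ... | yes p = cong suc (r xs)
    ... | no _ = r xs

  fibre : DSet (A × B) → A → DSet B
  fibre Q x = dset (λ y → (x , y) ∈ˢ Q) (λ y → mem? Q (x , y))

  pairs : DSet A → DSet (A × B) → DSet (A × B)
  pairs P Q = dset (λ (x , y) → x ∈ˢ P × (x , y) ∈ˢ Q) (λ (x , y) → mem? P x ×-dec mem? Q (x , y))

  ∣pairs∣ : (P : DSet A) (Q : DSet (A × B)) → ∣ pairs P Q ∣ ≡ Σˢ P (λ x → ∣ fibre Q x ∣)
  ∣pairs∣ P Q = go enum
    where
    row : ∀ x (ys : List B) → x ∈ˢ P → length (filter (mem? (pairs P Q)) (map (x ,_) ys)) ≡ length (filter (mem? (fibre Q x)) ys)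
    row x [] p = refl
    row x (y ∷ ys) p with mem? P x | mem? Q (x , y)
    ... | yes _ | yes _ = cong suc (row x ys p)
    ... | yes _ | no _ = row x ys p
    ... | no ¬p | _ = ⊥-elim (¬p p)
    row₀ : ∀ x (ys : List B) → x ∉ˢ P → length (filter (mem? (pairs P Q)) (map (x ,_) ys)) ≡ 0
    row₀ x [] p = refl
    row₀ x (y ∷ ys) p with mem? P x
    ... | yes p′ = ⊥-elim (p p′)
    ... | no _ = row₀ x ys p
    weigh : List A → ℕ
    weigh xs = sum (map (λ x → ∣ fibre Q x ∣) (filter (mem? P) xs))
    go : ∀ xs → length (filter (mem? (pairs P Q)) (cartesianProduct xs enum)) ≡ weigh xs
    step : ∀ x xs → Dec (x ∈ˢ P) →
      length (filter (mem? (pairs P Q)) (map (x ,_) enum)) + length (filter (mem? (pairs P Q)) (cartesianProduct xs enum)) ≡ weigh (x ∷ xs)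
    go [] = refl
    go (x ∷ xs) = trans (length-filter-++ (pairs P Q) (map (x ,_) enum) _) (step x xs (mem? P x))
    step x xs (yes p) = trans (cong₂ _+_ (row x enum p) (go xs)) (cong (λ ys → sum (map (λ x → ∣ fibre Q x ∣) ys)) (sym (filter-accept (mem? P) p)))
    step x xs (no ¬p) = trans (cong₂ _+_ (row₀ x enum ¬p) (go xs)) (cong (λ ys → sum (map (λ x → ∣ fibre Q x ∣) ys)) (sym (filter-reject (mem? P) ¬p)))

  ∣⊗∣ : (P : DSet A) (Q : DSet B) → ∣ P ⊗ Q ∣ ≡ ∣ P ∣ * ∣ Q ∣
  ∣⊗∣ P Q = trans (∣pairs∣ P (dset (λ (_ , y) → y ∈ˢ Q) (λ (_ , y) → mem? Q y))) (Σˢ-const P (∣ Q ∣))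

  fibres : (P : DSet A) (Q : DSet (A × B)) (c : ℕ) → (∀ x → x ∈ˢ P → c ≤ ∣ fibre Q x ∣) → ∣ P ∣ * c ≤ ∣ pairs P Q ∣
  fibres P Q c big = ≤-trans (≤-reflexive (sym (Σˢ-const P c))) (≤-trans (Σˢ-mono P big) (≤-reflexive (sym (∣pairs∣ P Q))))

⊕↪ : {A B C : Set} {P : DSet A} {Q : DSet B} {T : DSet C} (f : P ↪ T) (g : Q ↪ T) →
  (∀ x y p q → proj₁ (to f x p) ≢ proj₁ (to g y q)) → P ⊕ Q ↪ T
⊕↪ f g d = inject (λ { (inj₁ x) p → to f x p ; (inj₂ y) q → to g y q })
  λ { (inj₁ x) (inj₁ y) p q e → cong inj₁ (injective f x y p q e)
    ; (inj₁ x) (inj₂ y) p q e → ⊥-elim (d x y p q e)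
    ; (inj₂ x) (inj₁ y) p q e → ⊥-elim (d y x q p (sym e))
    ; (inj₂ x) (inj₂ y) p q e → cong inj₂ (injective g x y p q e) }

⊆↪ : {A : Set} {P Q : DSet A} → P ⊆ˢ Q → P ↪ Q
⊆↪ s = inject (λ x p → x , s x p) (λ _ _ _ _ e → e)

module _ {A : Set} {{_ : Finite A}} where

  ∣∣-⊆ : {P Q : DSet A} → P ⊆ˢ Q → ∣ P ∣ ≤ ∣ Q ∣
  ∣∣-⊆ {P} {Q} s = ∣∣-mono {P = P} {Q} (⊆↪ {P = P} {Q} s)

  ∣∅ˢ∣ : ∣ ∅ˢ {A} ∣ ≡ 0
  ∣∅ˢ∣ = n≤0⇒n≡0 (unique-⊆-length {xs = elements (∅ˢ {A})} {[]} (elements-unique (∅ˢ {A})) (λ m → ⊥-elim (elements-∈ (∅ˢ {A}) m)))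

  ∣⟨⟩∣ : (v : A) → ∣ ⟨ v ⟩ ∣ ≡ 1
  ∣⟨⟩∣ v = ≤-antisym (unique-⊆-length {ys = v ∷ []} (elements-unique ⟨ v ⟩) (λ m → here (elements-∈ ⟨ v ⟩ m)))
    (unique-⊆-length {xs = v ∷ []} ([] ∷ []) λ { (here refl) → ∈-elements ⟨ v ⟩ refl })

  ∣∣-disjoint : {P Q T : DSet A} → P ⊆ˢ T → Q ⊆ˢ T → (∀ x → x ∈ˢ P → x ∉ˢ Q) → ∣ P ∣ + ∣ Q ∣ ≤ ∣ T ∣
  ∣∣-disjoint {P} {Q} {T} s t d = subst (_≤ ∣ T ∣) (∣⊕∣ P Q)
    (∣∣-mono (⊕↪ {P = P} {Q} {T} (⊆↪ s) (⊆↪ t) λ { x .x p q refl → d x p q }))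

  ∣∣-cover : {P Q T : DSet A} → (∀ x → x ∈ˢ T → x ∈ˢ P ⊎ x ∈ˢ Q) → ∣ T ∣ ≤ ∣ P ∣ + ∣ Q ∣
  ∣∣-cover {P} {Q} {T} s = subst (∣ T ∣ ≤_) (∣⊕∣ P Q) (∣∣-mono {P = T} {P ⊕ Q}
      (inject (λ x t → tag x (s x t)) λ x y p q e → trans (sym (untag x (s x p))) (trans (cong [ id , id ]′ e) (untag y (s y q)))))
    where
    tag : ∀ x → x ∈ˢ P ⊎ x ∈ˢ Q → Σ (A ⊎ A) (mem (P ⊕ Q))
    tag x (inj₁ p) = inj₁ x , p
    tag x (inj₂ q) = inj₂ x , q
    untag : ∀ x m → [ id , id ]′ (proj₁ (tag x m)) ≡ x
    untag x (inj₁ p) = refl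
    untag x (inj₂ q) = refl

  ∣-∣ : (P : DSet A) {v : A} → v ∈ˢ P → suc ∣ P - v ∣ ≡ ∣ P ∣
  ∣-∣ P {v} v∈ = ≤-antisym
    (subst (λ n → n + ∣ P - v ∣ ≤ ∣ P ∣) (∣⟨⟩∣ v)
      (∣∣-disjoint {⟨ v ⟩} {P - v} {P} (λ { _ refl → v∈ }) (λ _ → proj₁) λ { x refl (_ , n) → n refl }))
    (subst (λ n → ∣ P ∣ ≤ n + ∣ P - v ∣) (∣⟨⟩∣ v)
      (∣∣-cover {⟨ v ⟩} {P - v} {P} split))
    where
    split : ∀ x → x ∈ˢ P → x ≡ v ⊎ (x ∈ˢ P × x ≢ v)
    split x p with x ≟ v
    ... | yes e = inj₁ e
    ... | no n = inj₂ (p , n)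

  ∣∣-strict : {P Q : DSet A} → P ⊆ˢ Q → ∀ {v} → v ∈ˢ Q → v ∉ˢ P → ∣ P ∣ < ∣ Q ∣
  ∣∣-strict {P} {Q} s {v} q n = ≤-trans (s≤s (∣∣-⊆ {P} {Q - v} λ x p → s x p , λ { refl → n p })) (≤-reflexive (∣-∣ Q q))

  ∣∣-split : (P Q : DSet A) → ∣ P ∣ ≡ ∣ P ∩ Q ∣ + ∣ P ∖ Q ∣
  ∣∣-split P Q = ≤-antisym (∣∣-cover {P ∩ Q} {P ∖ Q} {P} split)
    (∣∣-disjoint {P ∩ Q} {P ∖ Q} {P} (λ _ → proj₁) (λ _ → proj₁) (λ { x (_ , q) (_ , n) → n q }))
    where
    split : ∀ x → x ∈ˢ P → (x ∈ˢ P × x ∈ˢ Q) ⊎ (x ∈ˢ P × x ∉ˢ Q)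
    split x p with mem? Q x
    ... | yes q = inj₁ (p , q)
    ... | no n = inj₂ (p , n)

  1≤size : (P : DSet A) {v : A} → v ∈ˢ P → 1 ≤ ∣ P ∣
  1≤size P p = ≤-trans (s≤s z≤n) (≤-reflexive (∣-∣ P p))

  nonempty : (P : DSet A) → 1 ≤ ∣ P ∣ → ∃ λ x → x ∈ˢ P
  nonempty P h with elements P | elements-∈ P
  ... | x ∷ _ | f = x , f (here refl)

  -- When `P` has too few elements, the last alternative records that all of them were taken.
  subset-of-size : (P : DSet A) (h : ℕ) → ∃ λ (xs : List A) → Unique xs × (∀ x → x ∈ xs → x ∈ˢ P) ×
    length xs ≤ h × (length xs ≡ h ⊎ (∀ x → x ∈ˢ P → x ∈ xs))
  subset-of-size P h with length (elements P) ≤? h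
  ... | yes l = elements P , elements-unique P , (λ _ → elements-∈ P) , l , inj₂ (λ _ → ∈-elements P)
  ... | no l = take h (elements P) , Unique.take⁺ h (elements-unique P) ,
      (λ x m → elements-∈ P (take-⊆ h (elements P) m)) ,
      ≤-reflexive len , inj₁ len
    where
    take-⊆ : ∀ h xs {x : A} → x ∈ take h xs → x ∈ xs
    take-⊆ (suc h) (x ∷ xs) (here e) = here e
    take-⊆ (suc h) (x ∷ xs) (there m) = there (take-⊆ h xs m)
    len : length (take h (elements P)) ≡ h
    len = trans (length-take h (elements P)) (m≤n⇒m⊓n≡m (<⇒≤ (≰⇒> l)))

  fromList : List A → DSet A
  fromList xs = dset (_∈ xs) (λ x → any? (x ≟_) xs)

  ∣fromList∣ : {xs : List A} → Unique xs → ∣ fromList xs ∣ ≡ length xs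
  ∣fromList∣ {xs} u = ≤-antisym (unique-⊆-length (elements-unique (fromList xs)) (elements-∈ (fromList xs)))
    (unique-⊆-length u (∈-elements (fromList xs)))

-- Dicolourings and critical sets

fullˢ : {A : Set} → DSet A
fullˢ = dset (λ _ → ⊤) (λ _ → yes tt)

∣fullˢ∣ : ∀ n → ∣ fullˢ {Fin n} ∣ ≡ n
∣fullˢ∣ n = trans (cong length (filter-all (mem? fullˢ) (All.tabulate {xs = allFin n} λ _ → tt))) (length-tabulate id)

-- Otherwise a choice of one vertex of `N` for each colour would inject the K colours into `N`.
missing-colour : {V : Set} {{_ : Finite V}} {K : ℕ} (c : V → Fin K) (N : DSet V) → ∣ N ∣ < K →
  ∃ λ i → ∀ w → w ∈ˢ N → c w ≢ i
missing-colour {V} {K} c N small with ∃? (λ i → ¬? (∃? (λ w → mem? N w ×-dec (c w ≟ i))))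
... | yes (i , none) = i , λ w n e → none (w , n , e)
... | no all = ⊥-elim (<⇒≱ small (subst (_≤ ∣ N ∣) (∣fullˢ∣ K)
    (∣∣-mono {P = fullˢ} {N} (inject (λ i _ → proj₁ (used i) , proj₁ (proj₂ (used i)))
      λ i j _ _ e → trans (sym (proj₂ (proj₂ (used i)))) (trans (cong c e) (proj₂ (proj₂ (used j))))))))
  where
  used : ∀ i → ∃ λ w → w ∈ˢ N × c w ≡ i
  used i with ∃? (λ w → mem? N w ×-dec (c w ≟ i))
  ... | yes u = u
  ... | no n = ⊥-elim (all (i , n))

Dig : Set → Set₁
Dig V = DSet (V × V)

Irreflexive : {V : Set} → Dig V → Set
Irreflexive D = ∀ v → (v , v) ∉ˢ D

module _ {V : Set} {{_ : Finite V}} where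

  infixl 8 _[_≔_]

  _[_≔_] : {X : Set} → (V → X) → V → X → V → X
  (f [ v ≔ x ]) w with w ≟ v
  ... | yes _ = x
  ... | no _ = f w

  ≔-same : {X : Set} (f : V → X) (v : V) (x : X) → (f [ v ≔ x ]) v ≡ x
  ≔-same f v x with v ≟ v
  ... | yes _ = refl
  ... | no n = ⊥-elim (n refl)

  ≔-other : {X : Set} (f : V → X) (v : V) (x : X) {w : V} → w ≢ v → (f [ v ≔ x ]) w ≡ f w
  ≔-other f v x {w} n with w ≟ v
  ... | yes e = ⊥-elim (n e)
  ... | no _ = refl

  maximum : (V → ℕ) → ℕ
  maximum r = foldr (λ v m → r v ⊔ m) 0 enum

  ≤maximum : ∀ r v → r v ≤ maximum r
  ≤maximum r v = go (complete v)
    where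
    go : ∀ {xs} → v ∈ xs → r v ≤ foldr (λ v m → r v ⊔ m) 0 xs
    go (here refl) = m≤m⊔n _ _
    go (there m) = ≤-trans (go m) (m≤n⊔m _ _)

  -- A colour class is acyclic iff it carries a rank function that increases along arcs.
  Ranks : {K : ℕ} → Dig V → DSet V → (V → Fin K) → (V → ℕ) → Set
  Ranks D S c r = ∀ u v → u ∈ˢ S → v ∈ˢ S → (u , v) ∈ˢ D → c u ≡ c v → r u < r v

  record IsCol {K : ℕ} (D : Dig V) (S : DSet V) (c : V → Fin K) : Set where
    constructor ranked
    field
      rank : V → ℕ
      ranks : Ranks D S c rank

  Col : ℕ → Dig V → DSet V → Set
  Col K D S = ∃ λ (c : V → Fin K) → IsCol D S c

  arcs : Dig V → DSet V → DSet (V × V)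
  arcs D S = dset (λ (u , v) → u ∈ˢ S × v ∈ˢ S × (u , v) ∈ˢ D)
    (λ (u , v) → mem? S u ×-dec mem? S v ×-dec mem? D (u , v))

  out in′ : Dig V → DSet V → V → DSet V
  out D S v = dset (λ w → w ∈ˢ S × (v , w) ∈ˢ D) (λ w → mem? S w ×-dec mem? D (v , w))
  in′ D S v = dset (λ w → w ∈ˢ S × (w , v) ∈ˢ D) (λ w → mem? S w ×-dec mem? D (w , v))

  -- The index is the number of colours that do not suffice, so (K + 1)-dicritical digraphs give
  -- `Crit K`. The double negation lets `extract` reach such a set without deciding colourability.
  record Crit (K : ℕ) (D : Dig V) (S : DSet V) : Set where
    constructor critical
    field
      uncolourable : ¬ Col K D S
      removable : ∀ v → v ∈ˢ S → ¬ ¬ Col K D (S - v)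

  open Crit public

  Col-mono : ∀ {K D D′ S S′} → S′ ⊆ˢ S → arcs D′ S′ ⊆ˢ D → Col K D S → Col K D′ S′
  Col-mono s d (c , ranked r ok) = c , ranked r λ u v p q a → ok u v (s u p) (s v q) (d (u , v) (p , q , a))

  module _ {K : ℕ} {D : Dig V} {S : DSet V} (irr : Irreflexive D) {v : V} {c : V → Fin K} (i : Fin K) where

    -- Doubling makes all old ranks odd, so the even number 2t fits between the old ranks t - 1 and
    -- t.
    insert-vertex : ∀ {r} → Ranks D (S - v) c r → (t : ℕ) →
      (∀ w → w ∈ˢ out D S v → c w ≡ i → t ≤ r w) →
      (∀ w → w ∈ˢ in′ D S v → c w ≡ i → r w < t) →
      IsCol D S (c [ v ≔ i ])
    insert-vertex {r} ok t above below = ranked ((λ w → suc (2 * r w)) [ v ≔ 2 * t ]) go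
      where
      go : Ranks D S (c [ v ≔ i ]) ((λ w → suc (2 * r w)) [ v ≔ 2 * t ])
      go u w p q a with u ≟ v | w ≟ v
      ... | yes refl | yes refl = λ _ → ⊥-elim (irr u a)
      ... | yes refl | no n = λ e → s≤s (*-monoʳ-≤ 2 (above w (q , a) (sym e)))
      ... | no n | yes refl = λ e → ≤-trans (≤-reflexive (sym (*-suc 2 (r u)))) (*-monoʳ-≤ 2 (below u (p , a) e))
      ... | no n | no m = λ e → s≤s (*-monoʳ-< 2 (ok u w (p , n) (q , m) a e))

    -- No cycle of colour `i` can leave `v`, so its rank may lie above all others.
    insert-sink : IsCol D (S - v) c → (∀ w → w ∈ˢ out D S v → c w ≢ i) → IsCol D S (c [ v ≔ i ])
    insert-sink (ranked r ok) none = insert-vertex ok (suc (maximum r))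
      (λ w o e → ⊥-elim (none w o e)) (λ w _ _ → s≤s (≤maximum r w))

    insert-source : IsCol D (S - v) c → (∀ w → w ∈ˢ in′ D S v → c w ≢ i) → IsCol D S (c [ v ≔ i ])
    insert-source (ranked r ok) none = insert-vertex ok 0 (λ _ _ _ → z≤n) (λ w o e → ⊥-elim (none w o e))

  module _ {K : ℕ} {D : Dig V} (irr : Irreflexive D) {S : DSet V} (crit : Crit K D S) where

    outdegree : ∀ {v} → v ∈ˢ S → K ≤ ∣ out D S v ∣
    outdegree {v} v∈ with K ≤? ∣ out D S v ∣
    ... | yes l = l
    ... | no l = ⊥-elim (removable crit v v∈ λ (c , ok) → let (i , miss) = missing-colour c (out D S v) (≰⇒> l) in
        uncolourable crit (_ , insert-sink irr i ok miss))

    indegree : ∀ {v} → v ∈ˢ S → K ≤ ∣ in′ D S v ∣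
    indegree {v} v∈ with K ≤? ∣ in′ D S v ∣
    ... | yes l = l
    ... | no l = ⊥-elim (removable crit v v∈ λ (c , ok) → let (i , miss) = missing-colour c (in′ D S v) (≰⇒> l) in
        uncolourable crit (_ , insert-source irr i ok miss))

    Crit-nonempty : Fin K → ∃ λ v → v ∈ˢ S
    Crit-nonempty i with ∃? (mem? S)
    ... | yes x = x
    ... | no n = ⊥-elim (uncolourable crit ((λ _ → i) , ranked (λ _ → 0) λ u _ u∈ → ⊥-elim (n (u , u∈))))

    Crit-size : Fin K → suc K ≤ ∣ S ∣
    Crit-size i = let (v , v∈) = Crit-nonempty i in
      ≤-trans (s≤s (≤-trans (outdegree v∈)
        (∣∣-⊆ {P = out D S v} {S - v} λ w (w∈ , a) → w∈ , λ { refl → irr w a })))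
        (≤-reflexive (∣-∣ S v∈))

  Crit-arcs : ∀ {K D S} → Irreflexive D → Crit K D S → ∣ S ∣ * K ≤ ∣ arcs D S ∣
  Crit-arcs {K} {D} {S} irr crit = ≤-trans
    (fibres S (arcs D S) K λ v v∈ → ≤-trans (outdegree irr crit v∈)
      (∣∣-⊆ {P = out D S v} λ w (w∈ , a) → v∈ , w∈ , a))
    (∣∣-⊆ {Q = arcs D S} λ _ → proj₂)

  -- Vertices are deleted while non-colourability persists, and `m` bounds the number of deletions.
  -- The conclusion is in continuation form because the vertex to delete is found only under double
  -- negation.
  extract : ∀ {K D} m (S : DSet V) → ∣ S ∣ ≤ m → ¬ Col K D S →
    (∀ W → W ⊆ˢ S → Crit K D W → ⊥) → ⊥
  extract {K} {D} m S l ¬col found = found S (λ _ → id) (critical ¬col (smaller m l))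
    where
    smaller : ∀ m → ∣ S ∣ ≤ m → ∀ v → v ∈ˢ S → ¬ Col K D (S - v) → ⊥
    smaller zero l v v∈ ¬col′ = n≮0 (≤-trans (≤-reflexive (∣-∣ S v∈)) l)
    smaller (suc m) l v v∈ ¬col′ = extract m (S - v) (≤-pred (≤-trans (≤-reflexive (∣-∣ S v∈)) l)) ¬col′
      λ W s → found W (λ x w → proj₁ (s x w))

-- Collapsing a coloured set

module Collapse {V : Set} {{_ : Finite V}} {K : ℕ} (D : Dig V) (irr : Irreflexive D) (S R : DSet V)
  (c : V → Fin K) (colouring : IsCol D R c) where

  open IsCol colouring

  Lift : Fin K ⊎ V → V → Set
  Lift (inj₁ i) z = z ∈ˢ R × c z ≡ i
  Lift (inj₂ u) z = z ≡ u × u ∈ˢ S × u ∉ˢ R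

  Lift? : ∀ x z → Dec (Lift x z)
  Lift? (inj₁ i) z = mem? R z ×-dec (c z ≟ i)
  Lift? (inj₂ u) z = (z ≟ u) ×-dec mem? S u ×-dec ¬? (mem? R u)

  lift-unique : ∀ x y {z} → Lift x z → Lift y z → x ≡ y
  lift-unique (inj₁ i) (inj₁ j) (_ , refl) (_ , refl) = refl
  lift-unique (inj₁ i) (inj₂ u) (z∈R , _) (refl , _ , u∉R) = ⊥-elim (u∉R z∈R)
  lift-unique (inj₂ u) (inj₁ i) (refl , _ , u∉R) (z∈R , _) = ⊥-elim (u∉R z∈R)
  lift-unique (inj₂ u) (inj₂ v) (refl , _) (refl , _) = refl

  Clique Mixed : Fin K ⊎ V → Fin K ⊎ V → Set
  Clique (inj₁ i) (inj₁ j) = i ≢ j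
  Clique _ _ = ⊥
  Mixed (inj₁ _) (inj₁ _) = ⊥
  Mixed _ _ = ⊤

  Clique? : ∀ x y → Dec (Clique x y)
  Clique? (inj₁ i) (inj₁ j) = ¬? (i ≟ j)
  Clique? (inj₁ _) (inj₂ _) = no id
  Clique? (inj₂ _) _ = no id

  Mixed? : ∀ x y → Dec (Mixed x y)
  Mixed? (inj₁ _) (inj₁ _) = no id
  Mixed? (inj₁ _) (inj₂ _) = yes tt
  Mixed? (inj₂ _) (inj₁ _) = yes tt
  Mixed? (inj₂ _) (inj₂ _) = yes tt

  -- The colour classes of R become the vertices of a complete digraph.
  Y : Dig (Fin K ⊎ V)
  Y = dset (λ (x , y) → Clique x y ⊎ (Mixed x y × ∃ λ z → ∃ λ w → Lift x z × Lift y w × (z , w) ∈ˢ D))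
    (λ (x , y) → Clique? x y ⊎-dec (Mixed? x y ×-dec
      ∃? λ z → ∃? λ w → Lift? x z ×-dec Lift? y w ×-dec mem? D (z , w)))

  YS : DSet (Fin K ⊎ V)
  YS = fullˢ ⊕ (S ∖ R)

  Y-irreflexive : Irreflexive Y
  Y-irreflexive (inj₁ i) (inj₁ n) = n refl
  Y-irreflexive (inj₂ u) (inj₂ (_ , z , w , (refl , _) , (refl , _) , a)) = irr z a

  project : V → Fin K ⊎ V
  project w with mem? R w
  ... | yes _ = inj₁ (c w)
  ... | no _ = inj₂ w

  project-lift : ∀ {w} → w ∈ˢ S → Lift (project w) w
  project-lift {w} w∈S with mem? R w
  ... | yes w∈R = w∈R , refl
  ... | no w∉R = refl , w∈S , w∉R

  project-YS : ∀ {w} → w ∈ˢ S → project w ∈ˢ YS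
  project-YS {w} w∈S with mem? R w
  ... | yes _ = tt
  ... | no w∉R = w∈S , w∉R

  -- The vertices of the complete digraph get distinct colours, so inside `R` equal new colours mean
  -- equal old classes, where `rank` increases along arcs; every other monochromatic arc raises
  -- `r′`. The factor `suc m` combines both ranks lexicographically.
  collapse-colourable : Col K Y YS → Col K D S
  collapse-colourable (c′ , ranked r′ ok′) = c′ ∘ project , ranked (λ w → r′ (project w) * suc m + rank w) go
    where
    m = maximum rank
    clique-colours : ∀ i j → c′ (inj₁ i) ≡ c′ (inj₁ j) → i ≡ j
    clique-colours i j e with i ≟ j
    ... | yes i≡j = i≡j
    ... | no n = ⊥-elim (<-asym (ok′ (inj₁ i) (inj₁ j) tt tt (inj₁ n) e) (ok′ (inj₁ j) (inj₁ i) tt tt (inj₁ (n ∘ sym)) (sym e)))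
    lexicographic : ∀ {a b} u v → a < b → a * suc m + rank u < b * suc m + rank v
    lexicographic {a} {b} u v a<b = ≤-trans (≤-trans (≤-reflexive (sym (+-suc (a * suc m) (rank u))))
      (≤-trans (+-monoʳ-≤ (a * suc m) (s≤s (≤maximum rank u))) (≤-reflexive (+-comm (a * suc m) (suc m)))))
      (≤-trans (*-monoˡ-≤ (suc m) a<b) (m≤m+n _ _))
    compare : ∀ x y {u v} → Lift x u → Lift y v → x ∈ˢ YS → y ∈ˢ YS → (u , v) ∈ˢ D → c′ x ≡ c′ y →
      r′ x * suc m + rank u < r′ y * suc m + rank v
    compare (inj₁ i) (inj₁ j) {u} {v} (u∈R , refl) (v∈R , refl) _ _ a e
      rewrite clique-colours (c u) (c v) e =
      +-monoʳ-< (r′ (inj₁ (c v)) * suc m) (ranks u v u∈R v∈R a (clique-colours (c u) (c v) e))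
    compare (inj₁ i) (inj₂ y) {u} {v} p q x∈ y∈ a e = lexicographic u v (ok′ _ _ x∈ y∈ (inj₂ (tt , u , v , p , q , a)) e)
    compare (inj₂ x) (inj₁ y) {u} {v} p q x∈ y∈ a e = lexicographic u v (ok′ _ _ x∈ y∈ (inj₂ (tt , u , v , p , q , a)) e)
    compare (inj₂ x) (inj₂ y) {u} {v} p q x∈ y∈ a e = lexicographic u v (ok′ _ _ x∈ y∈ (inj₂ (tt , u , v , p , q , a)) e)
    go : Ranks D S (c′ ∘ project) (λ w → r′ (project w) * suc m + rank w)
    go u v u∈ v∈ a e = compare (project u) (project v) (project-lift u∈) (project-lift v∈) (project-YS u∈) (project-YS v∈) a e

  module Expand (W : DSet (Fin K ⊎ V)) (W⊆ : W ⊆ˢ YS) where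

    classes : DSet (Fin K)
    classes = dset (λ i → inj₁ i ∈ˢ W) (λ i → mem? W (inj₁ i))

    outside : DSet V
    outside = dset (λ u → inj₂ u ∈ˢ W) (λ u → mem? W (inj₂ u))

    R′ : DSet V
    R′ = R ∪ outside

    ∣W∣ : ∣ classes ∣ + ∣ outside ∣ ≤ ∣ W ∣
    ∣W∣ = ≤-trans (≤-reflexive (sym (∣⊕∣ classes outside)))
      (∣∣-⊆ {P = classes ⊕ outside} {W} λ { (inj₁ _) m → m ; (inj₂ _) m → m })

    ∣R′∣ : ∣ R′ ∣ ≤ ∣ R ∣ + ∣ outside ∣
    ∣R′∣ = ∣∣-cover {P = R} {outside} {R′} λ _ → id

    lift-R′ : ∀ x {z} → x ∈ˢ W → Lift x z → z ∈ˢ R′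
    lift-R′ (inj₁ i) _ (z∈R , _) = inj₁ z∈R
    lift-R′ (inj₂ u) x∈ (refl , _) = inj₂ x∈

    private
      T = arcs D R′ ⊕ (classes ⊗ classes)

    expand-arcs : arcs Y W ↪ T
    expand-arcs = inject f inj
      where
      cliquePair : ∀ x y → x ∈ˢ W → y ∈ˢ W → Clique x y → Σ ((V × V) ⊎ (Fin K × Fin K)) (mem T)
      cliquePair (inj₁ i) (inj₁ j) x∈ y∈ _ = inj₂ (i , j) , x∈ , y∈
      f : ∀ a → a ∈ˢ arcs Y W → Σ ((V × V) ⊎ (Fin K × Fin K)) (mem T)
      f (x , y) (x∈ , y∈ , inj₁ n) = cliquePair x y x∈ y∈ n
      f (x , y) (x∈ , y∈ , inj₂ (_ , z , w , p , q , a)) = inj₁ (z , w) , lift-R′ x x∈ p , lift-R′ y y∈ q , a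
      inj : ∀ a b p q → proj₁ (f a p) ≡ proj₁ (f b q) → a ≡ b
      inj (inj₁ i , inj₁ j) (inj₁ i′ , inj₁ j′) (_ , _ , inj₁ _) (_ , _ , inj₁ _) refl = refl
      inj (inj₁ i , inj₁ j) (x , y) (_ , _ , inj₁ _) (_ , _ , inj₂ _) ()
      inj (x , y) (inj₁ i , inj₁ j) (_ , _ , inj₂ _) (_ , _ , inj₁ _) ()
      inj (x , y) (x′ , y′) (_ , _ , inj₂ (_ , z , w , p , q , a)) (_ , _ , inj₂ (_ , z′ , w′ , p′ , q′ , a′)) refl =
        cong₂ _,_ (lift-unique x x′ p p′) (lift-unique y y′ q q′)

    -- Each class in W pays for one diagonal pair; vertices whose class is not in W contribute arcs lost in the collapse.
    ∣arcs∣ : (Z : DSet V) →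
      (∀ z → z ∈ˢ Z → z ∈ˢ R × inj₁ (c z) ∉ˢ W × ∃ λ u → u ∈ˢ outside × ((z , u) ∈ˢ D ⊎ (u , z) ∈ˢ D)) →
      ∣ arcs Y W ∣ + (∣ arcs D R ∣ + (∣ classes ∣ + ∣ Z ∣)) ≤ ∣ arcs D R′ ∣ + ∣ classes ∣ * ∣ classes ∣
    ∣arcs∣ Z lost = subst₂ _≤_
        (trans (∣⊕∣ (arcs Y W) (arcs D R ⊕ (classes ⊕ Z))) (cong (∣ arcs Y W ∣ +_)
          (trans (∣⊕∣ (arcs D R) (classes ⊕ Z)) (cong (∣ arcs D R ∣ +_) (∣⊕∣ classes Z)))))
        (trans (∣⊕∣ (arcs D R′) (classes ⊗ classes)) (cong (∣ arcs D R′ ∣ +_) (∣⊗∣ classes classes)))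
        (∣∣-mono {Q = T} (⊕↪ expand-arcs (⊕↪ inner (⊕↪ diagonal lost-arcs
          (λ _ z _ m → diag≢ z m))
          (λ { a (inj₁ i) p q () ; a (inj₂ z) p q e → inner≢lost a p z q e }))
          (λ { a (inj₁ b) p q e → expand≢inner a b p q e
             ; a (inj₂ (inj₁ i)) p q e → expand≢diagonal a i p q e
             ; a (inj₂ (inj₂ z)) p q e → expand≢lost a z p q e })))
      where
      inner : arcs D R ↪ T
      inner = inject (λ { (u , v) (p , q , a) → inj₁ (u , v) , inj₁ p , inj₁ q , a }) λ { _ _ _ _ refl → refl }
      diagonal : classes ↪ T
      diagonal = inject (λ i p → inj₂ (i , i) , p , p) λ { _ _ _ _ refl → refl }
      outside∉R : ∀ {u} → u ∈ˢ outside → u ∉ˢ R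
      outside∉R {u} m = proj₂ (W⊆ (inj₂ u) m)
      lost-arcs : Z ↪ T
      lost-arcs = inject to′ inj
        where
        to′ : ∀ z → z ∈ˢ Z → Σ ((V × V) ⊎ (Fin K × Fin K)) (mem T)
        to′ z m with lost z m
        ... | z∈R , _ , u , u∈ , inj₁ a = inj₁ (z , u) , inj₁ z∈R , inj₂ u∈ , a
        ... | z∈R , _ , u , u∈ , inj₂ a = inj₁ (u , z) , inj₂ u∈ , inj₁ z∈R , a
        inj : ∀ x y p q → proj₁ (to′ x p) ≡ proj₁ (to′ y q) → x ≡ y
        inj x y p q e with lost x p | lost y q
        inj x y p q refl | x∈R , _ , u , u∈ , inj₁ a | y∈R , _ , v , v∈ , inj₁ b = refl
        inj x y p q refl | x∈R , _ , u , u∈ , inj₁ a | y∈R , _ , v , v∈ , inj₂ b = ⊥-elim (outside∉R v∈ x∈R)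
        inj x y p q refl | x∈R , _ , u , u∈ , inj₂ a | y∈R , _ , v , v∈ , inj₁ b = ⊥-elim (outside∉R u∈ y∈R)
        inj x y p q refl | x∈R , _ , u , u∈ , inj₂ a | y∈R , _ , v , v∈ , inj₂ b = refl
      diag≢ : ∀ z m {i} → inj₂ i ≢ proj₁ (to lost-arcs z m)
      diag≢ z m e with lost z m
      diag≢ z m () | _ , _ , u , u∈ , inj₁ a
      diag≢ z m () | _ , _ , u , u∈ , inj₂ a
      inner≢lost : ∀ a p z m → proj₁ (to inner a p) ≢ proj₁ (to lost-arcs z m)
      inner≢lost (u , v) (p , q , a) z m e with lost z m
      inner≢lost (u , v) (p , q , a) z m refl | _ , _ , _ , u∈ , inj₁ _ = outside∉R u∈ q
      inner≢lost (u , v) (p , q , a) z m refl | _ , _ , _ , u∈ , inj₂ _ = outside∉R u∈ p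
      mixed-outside : ∀ x y {z w} → Mixed x y → Lift x z → Lift y w → z ∈ˢ R → w ∉ˢ R
      mixed-outside (inj₁ _) (inj₂ u) _ _ (refl , _ , n) _ = n
      mixed-outside (inj₂ u) _ _ (refl , _ , n) _ z∈R = ⊥-elim (n z∈R)
      class-of : ∀ x {z} → x ∈ˢ W → Lift x z → z ∈ˢ R → inj₁ (c z) ∈ˢ W
      class-of (inj₁ i) x∈ (_ , refl) _ = x∈
      class-of (inj₂ u) x∈ (refl , _ , n) z∈R = ⊥-elim (n z∈R)
      expand≢inner : ∀ a b p q → proj₁ (to expand-arcs a p) ≢ proj₁ (to inner b q)
      expand≢inner (inj₁ _ , inj₁ _) b (_ , _ , inj₁ _) q ()
      expand≢inner (x , y) (u , v) (_ , _ , inj₂ (m , z , w , l , l′ , a)) (p , q , _) refl = mixed-outside x y m l l′ p q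
      expand≢diagonal : ∀ a i p q → proj₁ (to expand-arcs a p) ≢ proj₁ (to diagonal i q)
      expand≢diagonal (inj₁ i , inj₁ j) _ (_ , _ , inj₁ n) q refl = n refl
      expand≢diagonal (x , y) _ (_ , _ , inj₂ _) q ()
      expand≢lost : ∀ a z p q → proj₁ (to expand-arcs a p) ≢ proj₁ (to lost-arcs z q)
      expand≢lost a z p q e with lost z q
      expand≢lost (inj₁ i , inj₁ j) z (_ , _ , inj₁ n) q () | _ , _ , _ , _ , inj₁ _
      expand≢lost (inj₁ i , inj₁ j) z (_ , _ , inj₁ n) q () | _ , _ , _ , _ , inj₂ _
      expand≢lost (x , y) z (x∈ , y∈ , inj₂ (_ , _ , _ , l , l′ , _)) q refl | z∈R , n , _ , _ , inj₁ _ = n (class-of x x∈ l z∈R)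
      expand≢lost (x , y) z (x∈ , y∈ , inj₂ (_ , _ , _ , l , l′ , _)) q refl | z∈R , n , _ , _ , inj₂ _ = n (class-of y y∈ l′ z∈R)

-- The potential of proper subsets

-- A certificate for linear arithmetic: `a ≤ b` is a positive combination of hypotheses, `s` the
-- slack that is left over, and the equation a ring identity. The polynomials passed as first
-- argument below are such slacks.
linear : ∀ {a b x y} s → a ≤ b → x + b + s ≡ y + a → x ≤ y
linear {a} {b} {x} {y} s a≤b e = +-cancelʳ-≤ b x y (≤-trans (m≤m+n (x + b) s) (≤-trans (≤-reflexive e) (+-monoʳ-≤ y a≤b)))

-- With K = k − 1 = κ + 2, everything is scaled by 2K: the potential of a set R is weight · |R| − 2K · |A(R)|,
-- and a dicritical digraph should have potential at most bound = potential of the complete digraph on K + 1 vertices.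
-- cliqueBound is the potential of the complete digraph on K vertices.
weight bound cliqueBound : ℕ → ℕ → ℕ
weight K κ = 2 * K * K + κ
bound K κ = (1 + K) * κ
cliqueBound K κ = 2 * K * K + K * κ

-- The potential of the complete digraph on i vertices is concave in i, hence smallest at an end of
-- the range, here at i = 1.
clique-potential₁ : ∀ {i K} κ → 1 ≤ i → i ≤ K → weight K κ + 2 * K * (i * i) ≤ weight K κ * i + 2 * K * i
clique-potential₁ {suc x} {K} κ _ i≤K with m≤n⇒∃[o]m+o≡n i≤K
... | y , refl = m+n≤o⇒m≤o _ (≤-reflexive (identity κ x y))
  where
  identity : ∀ κ x y → 2 * (suc x + y) * (suc x + y) + κ + 2 * (suc x + y) * (suc x * suc x) + x * (2 * (suc x + y) * y + κ)
    ≡ (2 * (suc x + y) * (suc x + y) + κ) * suc x + 2 * (suc x + y) * suc x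
  identity = solve-∀

-- By the same concavity; without i = 1 the minimum moves to i = K.
clique-potential₂ : ∀ {i} κ → 2 ≤ i → i ≤ 2 + κ →
  cliqueBound (2 + κ) κ + 2 * (2 + κ) * (i * i) ≤ weight (2 + κ) κ * i + 2 * (2 + κ) * i
clique-potential₂ {suc (suc x)} κ (s≤s (s≤s _)) (s≤s (s≤s i≤K)) with m≤n⇒∃[o]m+o≡n i≤K
... | y , refl = m+n≤o⇒m≤o _ (≤-reflexive (identity x y))
  where
  identity : ∀ x y → let K = 2 + (x + y) ; κ = x + y ; i = 2 + x in
    2 * K * K + K * κ + 2 * K * (i * i) + y * (K + 2 * K * x + 2) ≡ (2 * K * K + κ) * i + 2 * K * i
  identity = solve-∀

-- In terms of potentials: R has at least that of R′, plus that of the complete digraph on the i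
-- surviving classes, plus J for each of the h lost arcs, minus that of W. Here `T` and `Q` bound
-- the first two from below and `C` bounds the last from above.
collapse-arithmetic : ∀ {J M C T Q h} i r r′ w u aR aR′ aW → i + u ≤ w → r′ ≤ r + u →
  aW + (aR + (i + h)) ≤ aR′ + i * i → M * w ≤ J * aW + C → T + J * aR′ ≤ M * r′ → Q + J * (i * i) ≤ M * i + J * i →
  T + Q + J * h + J * aR ≤ M * r + C
collapse-arithmetic {J} {M} {C} {T} {Q} {h} i r r′ w u aR aR′ aW pw pr pa pW pR′ pQ =
  linear 0 (+-mono-≤ (≤-trans (*-monoʳ-≤ M pw) pW) (+-mono-≤ (≤-trans pR′ (*-monoʳ-≤ M pr)) (+-mono-≤ pQ (*-monoʳ-≤ J pa))))
    (identity J M C T Q h i r u aR aR′ aW)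
  where
  identity : ∀ J M C T Q h i r u aR aR′ aW →
    T + Q + J * h + J * aR + (J * aW + C + (M * (r + u) + (M * i + J * i + J * (aR′ + i * i)))) + 0
      ≡ M * r + C + (M * (i + u) + (T + J * aR′ + (Q + J * (i * i) + J * (aW + (aR + (i + h))))))
  identity = solve-∀

∣arcs∣≤ : {V : Set} {{_ : Finite V}} {D : Dig V} → Irreflexive D → (R : DSet V) → ∣ arcs D R ∣ + ∣ R ∣ ≤ ∣ R ∣ * ∣ R ∣
∣arcs∣≤ {D = D} irr R = subst₂ _≤_ (∣⊕∣ (arcs D R) R) (∣⊗∣ R R)
  (∣∣-mono {Q = R ⊗ R} (⊕↪
    (⊆↪ λ { (u , v) (p , q , _) → p , q })
    (inject (λ v p → (v , v) , p , p) λ { _ _ _ _ refl → refl })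
    λ { (u , v) w (_ , _ , a) _ refl → irr u a }))

InductionHypothesis : ℕ → ℕ → Set₁
InductionHypothesis κ n = ∀ {V : Set} {{_ : Finite V}} {D : Dig V} → Irreflexive D → (S : DSet V) → ∣ S ∣ < n →
  Crit (2 + κ) D S → weight (2 + κ) κ * ∣ S ∣ ≤ 2 * (2 + κ) * ∣ arcs D S ∣ + bound (2 + κ) κ

module Counterexample {κ : ℕ} {V : Set} {{_ : Finite V}} {D : Dig V} (irr : Irreflexive D) {S : DSet V}
  (crit : Crit (2 + κ) D S) (ih : InductionHypothesis κ ∣ S ∣)
  (counter : 2 * (2 + κ) * ∣ arcs D S ∣ + bound (2 + κ) κ < weight (2 + κ) κ * ∣ S ∣) where

  K M C N : ℕ
  K = 2 + κ
  M = weight K κ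
  C = bound K κ
  N = cliqueBound K κ

  infix 4 _≼_

  _≼_ : ℕ → DSet V → Set
  x ≼ R = x + 2 * K * ∣ arcs D R ∣ ≤ M * ∣ R ∣

  arcs-mono : ∀ {P Q : DSet V} → P ⊆ˢ Q → ∣ arcs D P ∣ ≤ ∣ arcs D Q ∣
  arcs-mono {P} {Q} s = ∣∣-⊆ {P = arcs D P} {arcs D Q} λ (u , v) (p , q , a) → s u p , s v q , a

  ≼-weaken : ∀ {x y R} → y ≤ x → x ≼ R → y ≼ R
  ≼-weaken {R = R} l p = ≤-trans (+-monoˡ-≤ (2 * K * ∣ arcs D R ∣) l) p

  small-potential : ∀ {x} R → x + 2 * K * (∣ R ∣ * ∣ R ∣) ≤ M * ∣ R ∣ + 2 * K * ∣ R ∣ → x ≼ R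
  small-potential {x} R p = linear 0 (+-mono-≤ p (*-monoʳ-≤ (2 * K) (∣arcs∣≤ irr R)))
    (identity x (2 * K) M (∣ arcs D R ∣) (∣ R ∣))
    where
    identity : ∀ x J M a r → x + J * a + (M * r + J * r + J * (r * r)) + 0 ≡ M * r + (x + J * (r * r) + J * (a + r))
    identity = solve-∀

  whole-potential : ∀ {R} → R ⊆ˢ S → S ⊆ˢ R → suc C ≼ R
  whole-potential {R} s t = ≤-trans (s≤s (≤-trans (+-monoʳ-≤ C (*-monoʳ-≤ (2 * K) (arcs-mono {R} {S} s)))
    (≤-reflexive (+-comm C (2 * K * ∣ arcs D S ∣))))) (≤-trans counter (*-monoʳ-≤ M (∣∣-⊆ {P = S} {R} t)))

  covers? : ∀ R → (∃ λ v → v ∈ˢ S × v ∉ˢ R) ⊎ (S ⊆ˢ R)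
  covers? R with ∃? (λ v → mem? S v ×-dec ¬? (mem? R v))
  ... | yes x = inj₁ x
  ... | no n = inj₂ λ v v∈ → case mem? R v of λ { (yes p) → p ; (no q) → ⊥-elim (n (v , v∈ , q)) }

  -- Since `R` has more than K vertices the collapsed digraph is smaller, and induction applies to
  -- its critical piece W. That piece meets the complete part, as otherwise it would be a subdigraph
  -- of `D` without `x`.
  collapse : ∀ {R c x} → R ⊆ˢ S → x ∈ˢ R → suc K ≤ ∣ R ∣ → (col : IsCol D R c) →
    let open Collapse {K = K} D irr S R c col in
    (∀ W → (W⊆ : W ⊆ˢ YS) → Crit K Y W → (∃ λ i → inj₁ i ∈ˢ W) → M * ∣ W ∣ ≤ 2 * K * ∣ arcs Y W ∣ + C → ⊥) → ⊥
  collapse {R} {c} {x} R⊆ x∈R large col found =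
    extract (∣ YS ∣) YS ≤-refl (uncolourable crit ∘ collapse-colourable) λ W W⊆ critW →
      found W W⊆ critW (class W W⊆ critW) (ih Y-irreflexive W (≤-trans (s≤s (∣∣-⊆ {P = W} {YS} W⊆)) YS-small) critW)
    where
    open Collapse {K = K} D irr S R c col
    YS-small : ∣ YS ∣ < ∣ S ∣
    YS-small = begin-strict
      ∣ YS ∣                    ≡⟨ ∣⊕∣ (fullˢ {Fin K}) (S ∖ R) ⟩
      ∣ fullˢ {Fin K} ∣ + ∣ S ∖ R ∣  ≡⟨ cong (_+ ∣ S ∖ R ∣) (∣fullˢ∣ K) ⟩
      K + ∣ S ∖ R ∣             <⟨ +-monoˡ-< (∣ S ∖ R ∣) large ⟩
      ∣ R ∣ + ∣ S ∖ R ∣         ≤⟨ ∣∣-disjoint {P = R} {S ∖ R} {S} R⊆ (λ _ → proj₁) (λ { _ r (_ , n) → n r }) ⟩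
      ∣ S ∣                     ∎
      where open ≤-Reasoning
    class : ∀ W → W ⊆ˢ YS → Crit K Y W → ∃ λ i → inj₁ i ∈ˢ W
    class W W⊆ critW with ∃? (λ i → mem? W (inj₁ i))
    ... | yes i = i
    ... | no none = ⊥-elim (removable crit x (R⊆ x x∈R) λ (c′ , ranked r ok) →
        uncolourable critW ([ (λ _ → Fin.zero) , c′ ]′ , ranked [ (λ _ → 0) , r ]′
          λ { (inj₁ i) _ p _ _ _ → ⊥-elim (none (i , p))
            ; (inj₂ _) (inj₁ i) _ p _ _ → ⊥-elim (none (i , p))
            ; (inj₂ u) (inj₂ v) p q (inj₂ (_ , _ , _ , (refl , u∈S , u∉R) , (refl , v∈S , v∉R) , a)) e →
                ok u v (u∈S , (λ { refl → u∉R x∈R })) (v∈S , (λ { refl → v∉R x∈R })) a e }))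

  ∣classes∣≤K : (P : DSet (Fin K)) → ∣ P ∣ ≤ K
  ∣classes∣≤K P = ≤-trans (∣∣-⊆ {P = P} {fullˢ} (λ _ _ → tt)) (≤-reflexive (∣fullˢ∣ K))

  C<M : suc C ≤ M
  C<M = m+n≤o⇒m≤o _ (≤-reflexive (identity κ))
    where
    identity : ∀ κ → suc ((1 + (2 + κ)) * κ) + ((2 + κ) * (2 + κ) + 2 * κ + 3) ≡ 2 * (2 + κ) * (2 + κ) + κ
    identity = solve-∀

  -- The set `R′` produced by a collapse has potential above C: by induction on the size of the
  -- complement if it is proper, because `S` is a counterexample if not. The surviving classes add
  -- at least M and W takes away at most C, so more than M remains.
  gap : ∀ m R → ∣ S ∖ R ∣ ≤ m → R ⊆ˢ S → (∃ λ x → x ∈ˢ R) → (∃ λ v → v ∈ˢ S × v ∉ˢ R) → M ≼ R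
  gap m R fuel R⊆ (x , x∈R) (v , v∈S , v∉R) with ∣ R ∣ ≤? K
  ... | yes small = small-potential {M} R (clique-potential₁ κ (1≤size R x∈R) small)
  ... | no large = decidable-stable (_ ≤? _) λ ¬goal →
      removable crit v v∈S λ (c , ranked r ok) →
        let col = ranked r (λ u w p q → ok u w (R⊆ u p , λ { refl → v∉R p }) (R⊆ w q , λ { refl → v∉R q })) in
        collapse R⊆ x∈R (≰⇒> large) col λ W W⊆ critW (i , i∈) small →
          let open Collapse.Expand D irr S R c col W W⊆ in
          ¬goal (finish W W⊆ critW (i , i∈) small)
    where
    finish : ∀ {c : V → Fin K} {col : IsCol D R c} → let open Collapse D irr S R c col in
      ∀ W → (W⊆ : W ⊆ˢ YS) → Crit K Y W → (∃ λ i → inj₁ i ∈ˢ W) → M * ∣ W ∣ ≤ 2 * K * ∣ arcs Y W ∣ + C → M ≼ R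
    finish {c} {col} W W⊆ critW (i , i∈) small = 
      linear (suc 0) (+-mono-≤ conclusion (≤-refl {0})) (identity M C (2 * K * ∣ arcs D R ∣) (∣ R ∣) (2 * K))
      where
      open Collapse D irr S R c col
      open Expand W W⊆
      outside⊆ : ∀ u → u ∈ˢ outside → u ∈ˢ S × u ∉ˢ R
      outside⊆ u p = W⊆ (inj₂ u) p
      R′⊆ : R′ ⊆ˢ S
      R′⊆ u (inj₁ p) = R⊆ u p
      R′⊆ u (inj₂ p) = proj₁ (outside⊆ u p)
      -- A critical set has at least K + 1 vertices, one more than there are classes.
      new : ∃ λ u → u ∈ˢ outside
      new with ∃? (mem? outside)
      ... | yes u = u
      ... | no none = ⊥-elim (<⇒≱ (Crit-size Y-irreflexive critW Fin.zero) (≤-trans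
        (∣∣-mono {P = W} {fullˢ {Fin K}} (inject (λ { (inj₁ i) _ → i , tt ; (inj₂ u) p → ⊥-elim (none (u , p)) })
          λ { (inj₁ _) (inj₁ _) _ _ refl → refl ; (inj₁ _) (inj₂ u) _ p → ⊥-elim (none (u , p)) ; (inj₂ u) _ p _ → ⊥-elim (none (u , p)) }))
        (≤-reflexive (∣fullˢ∣ K))))
      larger : ∀ m → ∣ S ∖ R ∣ ≤ m → (∃ λ v → v ∈ˢ S × v ∉ˢ R′) → M ≼ R′
      larger zero l _ = ⊥-elim (<⇒≱ (1≤size (S ∖ R) (outside⊆ (proj₁ new) (proj₂ new))) l)
      larger (suc m) l w = gap m R′ (≤-pred (≤-trans (∣∣-strict {P = S ∖ R′} {S ∖ R}
          (λ u (p , q) → p , q ∘ inj₁) (outside⊆ (proj₁ new) (proj₂ new)) λ (_ , q) → q (inj₂ (proj₂ new))) l))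
        R′⊆ (x , inj₁ x∈R) w
      potential-R′ : suc C ≼ R′
      potential-R′ with covers? R′
      ... | inj₂ all = whole-potential R′⊆ all
      ... | inj₁ w = ≼-weaken {R = R′} C<M (larger m fuel w)
      conclusion : suc C + M + 2 * K * 0 + 2 * K * ∣ arcs D R ∣ ≤ M * ∣ R ∣ + C
      conclusion = collapse-arithmetic {2 * K} {M} {C} {suc C} {M} {0} (∣ classes ∣) (∣ R ∣) (∣ R′ ∣) (∣ W ∣) (∣ outside ∣)
        (∣ arcs D R ∣) (∣ arcs D R′ ∣) (∣ arcs Y W ∣) ∣W∣ ∣R′∣
        (subst (λ z → ∣ arcs Y W ∣ + (∣ arcs D R ∣ + (∣ classes ∣ + z)) ≤ ∣ arcs D R′ ∣ + ∣ classes ∣ * ∣ classes ∣)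
          (∣∅ˢ∣ {V}) (∣arcs∣ ∅ˢ λ _ ()))
        small potential-R′ (clique-potential₁ κ (1≤size classes i∈) (∣classes∣≤K classes))
      identity : ∀ M C x r J → M + x + (M * r + C + 0) + 1 ≡ M * r + (suc C + M + J * 0 + x + 0)
      identity = solve-∀

  -- The j + 1 added digons cost 4K(j + 1), against the reserve M - C = K(κ + 4) and the 2Kj gained
  -- in earlier rounds; the balance is positive exactly if 2j < κ.
  star-arithmetic₁ : ∀ j a → 2 * j < κ → ¬ (M + 2 * K * j + 2 * K * a ≤ 2 * K * (a + (suc j + suc j)) + C)
  star-arithmetic₁ j a l p with m≤n⇒∃[o]m+o≡n l
  ... | y , refl = n≮0 (linear {x = 1} {0} (1 + suc (2 * j + y) + (2 + suc (2 * j + y)) * y) p (identity j a y))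
    where
    identity : ∀ j a y → let κ = suc (2 * j + y) ; K = 2 + κ in
      1 + (2 * K * (a + (suc j + suc j)) + (1 + K) * κ) + (1 + κ + K * y) ≡ 2 * K * K + κ + 2 * K * j + 2 * K * a
    identity = solve-∀

  star-arithmetic₂ : ∀ j a → 2 * j < κ → ¬ (N + 2 * K * a ≤ 2 * K * (a + (suc j + suc j)) + C)
  star-arithmetic₂ j a l p with m≤n⇒∃[o]m+o≡n l
  ... | y , refl = n≮0 (linear {x = 1} {0} (2 * (2 + suc (2 * j + y)) * y + 3 + suc (2 * j + y)) p (identity j a y))
    where
    identity : ∀ j a y → let κ = suc (2 * j + y) ; K = 2 + κ in
      1 + (2 * K * (a + (suc j + suc j)) + (1 + K) * κ) + (2 * K * y + 3 + κ) ≡ 2 * K * K + K * κ + 2 * K * a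
    identity = solve-∀

  -- 2M - C exceeds N by 4K + κ.
  proper-arithmetic : ∀ {a r} → M + M + 2 * K * 0 + 2 * K * a ≤ M * r + C → suc N + 2 * K * a ≤ M * r
  proper-arithmetic {a} {r} p = linear (7 + 4 * κ + κ) p (identity κ (2 * K * a) (M * r))
    where
    identity : ∀ κ a r → let K = 2 + κ in
      suc (2 * K * K + K * κ) + a + (r + (1 + K) * κ) + (7 + 4 * κ + κ)
        ≡ r + (2 * K * K + κ + (2 * K * K + κ) + 2 * K * 0 + a)
    identity = solve-∀

  whole-arithmetic : ∀ {Q J h a r} → suc C + Q + J * h + J * a ≤ M * r + C → suc (Q + J * h) + J * a ≤ M * r
  whole-arithmetic {Q} {J} {h} {a} {r} p = linear 0 p (identity C Q (J * h) (J * a) (M * r))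
    where
    identity : ∀ C Q h a r → suc (Q + h) + a + (r + C) + 0 ≡ r + (suc C + Q + h + a)
    identity = solve-∀

  module Collapsed {R : DSet V} (R⊆ : R ⊆ˢ S) {a : V} (a∈R : a ∈ˢ R) {c : V → Fin K} (col : IsCol D R c)
    (W : DSet (Fin K ⊎ V)) (W⊆ : W ⊆ˢ Collapse.YS D irr S R c col) (critW : Crit K (Collapse.Y D irr S R c col) W)
    {i : Fin K} (i∈ : inj₁ i ∈ˢ W) (small : M * ∣ W ∣ ≤ 2 * K * ∣ arcs (Collapse.Y D irr S R c col) W ∣ + C) where

    open Collapse {K = K} D irr S R c col
    open Expand W W⊆

    R′⊆ : R′ ⊆ˢ S
    R′⊆ u (inj₁ m) = R⊆ u m
    R′⊆ u (inj₂ m) = proj₁ (W⊆ (inj₂ u) m)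

    conclude : ∀ {T Q} (L : DSet V) →
      (∀ z → z ∈ˢ L → z ∈ˢ R × inj₁ (c z) ∉ˢ W × ∃ λ u → u ∈ˢ outside × ((z , u) ∈ˢ D ⊎ (u , z) ∈ˢ D)) →
      T ≼ R′ → Q + 2 * K * (∣ classes ∣ * ∣ classes ∣) ≤ M * ∣ classes ∣ + 2 * K * ∣ classes ∣ →
      T + Q + 2 * K * ∣ L ∣ + 2 * K * ∣ arcs D R ∣ ≤ M * ∣ R ∣ + C
    conclude {T} {Q} L lost pT pQ = collapse-arithmetic {2 * K} {M} {C} {T} {Q} {∣ L ∣} (∣ classes ∣) (∣ R ∣) (∣ R′ ∣) (∣ W ∣) (∣ outside ∣)
      (∣ arcs D R ∣) (∣ arcs D R′ ∣) (∣ arcs Y W ∣) ∣W∣ ∣R′∣ (∣arcs∣ L lost) small pT pQ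

    conclude₀ : ∀ {T Q} → T ≼ R′ → Q + 2 * K * (∣ classes ∣ * ∣ classes ∣) ≤ M * ∣ classes ∣ + 2 * K * ∣ classes ∣ →
      T + Q + 2 * K * 0 + 2 * K * ∣ arcs D R ∣ ≤ M * ∣ R ∣ + C
    conclude₀ {T} {Q} pT pQ = subst (λ z → T + Q + 2 * K * z + 2 * K * ∣ arcs D R ∣ ≤ M * ∣ R ∣ + C)
      (∣∅ˢ∣ {V}) (conclude {T} {Q} ∅ˢ (λ _ ()) pT pQ)

    1≤classes : 1 ≤ ∣ classes ∣
    1≤classes = 1≤size classes i∈

    two-classes : S ⊆ˢ R′ → 2 ≤ ∣ classes ∣ → suc N ≼ R
    two-classes all two = subst (λ n → suc n ≼ R) (trans (cong (N +_) (*-zeroʳ (2 * K))) (+-identityʳ N))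
      (whole-arithmetic {N} {2 * K} {0} {∣ arcs D R ∣} {∣ R ∣} (conclude₀ {suc C} {N} (whole-potential R′⊆ all)
        (clique-potential₂ κ two (∣classes∣≤K classes))))

    in-outside : S ⊆ˢ R′ → ∀ {u} → u ∈ˢ S → u ∉ˢ R → u ∈ˢ outside
    in-outside S⊆R′ {u} m n = [ (λ r → ⊥-elim (n r)) , id ]′ (S⊆R′ u m)

    -- If `R′` is proper, it and the classes contribute M each, and 2M - C > N. If it is all of `S`,
    -- two surviving classes contribute N on top of C + 1. Only a lone surviving class remains.
    unless-one-class : {X : Set} → (S ⊆ˢ R′ → (∀ i′ → inj₁ i′ ∈ˢ W → i′ ≡ i) → X) → X ⊎ (suc N ≼ R)
    unless-one-class one = [ (λ w → inj₂ (proper-arithmetic {∣ arcs D R ∣} {∣ R ∣}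
        (conclude₀ {M} {M} (gap (∣ S ∖ R′ ∣) R′ ≤-refl R′⊆ (a , inj₁ a∈R) w)
          (clique-potential₁ κ 1≤classes (∣classes∣≤K classes)))))
      , (λ all → case ∃? (λ i′ → mem? W (inj₁ i′) ×-dec ¬? (i′ ≟ i)) of λ
        { (yes (i′ , i′∈ , n)) → inj₂ (two-classes all (≤-trans (s≤s (1≤size (classes - i) (i′∈ , n))) (≤-reflexive (∣-∣ classes i∈))))
        ; (no none) → inj₁ (one all λ i′ i′∈ → decidable-stable (i′ ≟ i) λ n → none (i′ , i′∈ , n)) }) ]′ (covers? R′)

  -- Sets left by an arc to a vertex of indegree K

  module Star {a p : V} (a∈S : a ∈ˢ S) (p∈S : p ∈ˢ S) (a→p : (a , p) ∈ˢ D) (in-p : ∣ in′ D S p ∣ ≤ K) where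

    Family : DSet V → Set
    Family R = R ⊆ˢ S × a ∈ˢ R × p ∉ˢ R × 2 ≤ ∣ R ∣

    -- The alternative N absorbs sets of at most K vertices and collapses where more than one class
    -- survives.
    Bounded : ℕ → DSet V → Set
    Bounded j R = (M + 2 * K * j ≼ R) ⊎ (N ≼ R)

    -- One round: digons from `a` to boundary vertices of `R` make every colouring separate these
    -- from `a`. If the class of `a` is the only survivor of the collapse, each of them loses an
    -- arc, which adds 2K to the bound.
    module Step (j : ℕ) (2j<κ : 2 * j < κ) (bounded : ∀ R → Family R → Bounded j R)
      (R : DSet V) (family : Family R) (large : suc K ≤ ∣ R ∣) where

      R⊆ = proj₁ family
      a∈R = proj₁ (proj₂ family)
      p∉R = proj₁ (proj₂ (proj₂ family))

      Z : DSet V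
      Z = dset (λ z → z ∈ˢ R × z ≢ a × ∃ λ u → (u ∈ˢ S × u ∉ˢ R) × ((z , u) ∈ˢ D ⊎ (u , z) ∈ˢ D))
        (λ z → mem? R z ×-dec ¬? (z ≟ a) ×-dec ∃? λ u → (mem? S u ×-dec ¬? (mem? R u)) ×-dec (mem? D (z , u) ⊎-dec mem? D (u , z)))

      module Chosen (zs : List V) (zs-unique : Unique zs) (zs⊆ : ∀ z → z ∈ zs → z ∈ˢ Z) (zs≤ : length zs ≤ suc j)
        (zs-all : length zs ≡ suc j ⊎ (∀ z → z ∈ˢ Z → z ∈ zs)) where

        Zs : DSet V
        Zs = fromList zs

        a∉Zs : ∀ {z} → z ∈ zs → z ≢ a
        a∉Zs m = proj₁ (proj₂ (zs⊆ _ m))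

        D★ : Dig V
        D★ = dset (λ (u , v) → (u , v) ∈ˢ D ⊎ ((u ≡ a × v ∈ zs) ⊎ (v ≡ a × u ∈ zs)))
          (λ (u , v) → mem? D (u , v) ⊎-dec (((u ≟ a) ×-dec mem? Zs v) ⊎-dec ((v ≟ a) ×-dec mem? Zs u)))

        D★-irreflexive : Irreflexive D★
        D★-irreflexive v (inj₁ d) = irr v d
        D★-irreflexive v (inj₂ (inj₁ (e , m))) = a∉Zs m e
        D★-irreflexive v (inj₂ (inj₂ (e , m))) = a∉Zs m e

        arcs★ : ∀ W → ∣ arcs D★ W ∣ ≤ ∣ arcs D W ∣ + (suc j + suc j)
        arcs★ W = ≤-trans (∣∣-mono {P = arcs D★ W} {arcs D W ⊕ (Zs ⊕ Zs)} (inject f inj))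
          (≤-trans (≤-reflexive (trans (∣⊕∣ (arcs D W) (Zs ⊕ Zs)) (cong (∣ arcs D W ∣ +_) (∣⊕∣ Zs Zs))))
            (+-monoʳ-≤ (∣ arcs D W ∣) (+-mono-≤ Zs≤ Zs≤)))
          where
          Zs≤ : ∣ Zs ∣ ≤ suc j
          Zs≤ = ≤-trans (≤-reflexive (∣fromList∣ zs-unique)) zs≤
          f : ∀ x → x ∈ˢ arcs D★ W → Σ ((V × V) ⊎ (V ⊎ V)) (mem (arcs D W ⊕ (Zs ⊕ Zs)))
          f (u , v) (m , n , inj₁ d) = inj₁ (u , v) , m , n , d
          f (u , v) (m , n , inj₂ (inj₁ (_ , z))) = inj₂ (inj₁ v) , z
          f (u , v) (m , n , inj₂ (inj₂ (_ , z))) = inj₂ (inj₂ u) , z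
          inj : ∀ x y m n → proj₁ (f x m) ≡ proj₁ (f y n) → x ≡ y
          inj _ _ (_ , _ , inj₁ _) (_ , _ , inj₁ _) refl = refl
          inj _ _ (_ , _ , inj₁ _) (_ , _ , inj₂ (inj₁ _)) ()
          inj _ _ (_ , _ , inj₁ _) (_ , _ , inj₂ (inj₂ _)) ()
          inj _ _ (_ , _ , inj₂ (inj₁ _)) (_ , _ , inj₁ _) ()
          inj _ _ (_ , _ , inj₂ (inj₂ _)) (_ , _ , inj₁ _) ()
          inj _ _ (_ , _ , inj₂ (inj₁ (refl , _))) (_ , _ , inj₂ (inj₁ (refl , _))) refl = refl
          inj _ _ (_ , _ , inj₂ (inj₂ (refl , _))) (_ , _ , inj₂ (inj₂ (refl , _))) refl = refl
          inj _ _ (_ , _ , inj₂ (inj₁ _)) (_ , _ , inj₂ (inj₂ _)) ()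
          inj _ _ (_ , _ , inj₂ (inj₂ _)) (_ , _ , inj₂ (inj₁ _)) ()

        -- A critical piece within `R` contains `a`, as otherwise it would already live in `D`
        -- without `p`. It then belongs to the family, and the bound of the previous round is too
        -- large for a smaller critical digraph, even after the new digons.
        star-colourable : ¬ ¬ Col K D★ R
        star-colourable ¬col = extract (∣ R ∣) R ≤-refl ¬col λ W W⊆R critW → case mem? W a of λ
          { (no a∉W) → removable crit p p∈S λ col → uncolourable critW
              (Col-mono {S′ = W} (λ x m → R⊆ x (W⊆R x m) , λ { refl → p∉R (W⊆R x m) })
                (λ { _ (_ , _ , inj₁ d) → d
                   ; _ (m , _ , inj₂ (inj₁ (refl , _))) → ⊥-elim (a∉W m)
                   ; _ (_ , m , inj₂ (inj₂ (refl , _))) → ⊥-elim (a∉W m) }) col)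
          ; (yes a∈W) →
              let small = ≤-trans (ih D★-irreflexive W (∣∣-strict {P = W} {S} (λ x m → R⊆ x (W⊆R x m)) p∈S (λ m → p∉R (W⊆R p m))) critW)
                            (+-monoˡ-≤ C (*-monoʳ-≤ (2 * K) (arcs★ W)))
                  size = ≤-trans (s≤s (s≤s z≤n)) (Crit-size D★-irreflexive critW Fin.zero)
              in case bounded W ((λ x m → R⊆ x (W⊆R x m)) , a∈W , (λ m → p∉R (W⊆R p m)) , size) of λ
                { (inj₁ b) → star-arithmetic₁ j (∣ arcs D W ∣) 2j<κ (≤-trans b small)
                ; (inj₂ b) → star-arithmetic₂ j (∣ arcs D W ∣) 2j<κ (≤-trans b small) } }

        Goal : Set
        Goal = (suc (M + 2 * K * suc j) ≼ R) ⊎ (suc N ≼ R)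

        module Coloured (c : V → Fin K) (col★ : IsCol D★ R c) where

          open IsCol col★ renaming (rank to r; ranks to ok)

          col : IsCol D R c
          col = ranked r λ u v m n d → ok u v m n (inj₁ d)

          a-separated : ∀ {z} → z ∈ zs → c z ≢ c a
          a-separated {z} m e = <-asym (ok z a z∈R a∈R (inj₂ (inj₂ (refl , m))) e) (ok a z a∈R z∈R (inj₂ (inj₁ (refl , m))) (sym e))
            where z∈R = proj₁ (zs⊆ z m)

          open Collapse {K = K} D irr S R c col

          module Outcome (W : DSet (Fin K ⊎ V)) (W⊆ : W ⊆ˢ YS) (critW : Crit K Y W) {i : Fin K} (i∈ : inj₁ i ∈ˢ W)
            (small : M * ∣ W ∣ ≤ 2 * K * ∣ arcs Y W ∣ + C) where

            open Expand W W⊆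
            open Collapsed R⊆ a∈R col W W⊆ critW i∈ small

            module OneClass (S⊆R′ : S ⊆ˢ R′) (only : ∀ i′ → inj₁ i′ ∈ˢ W → i′ ≡ i) where

              -- The vertex p keeps its K in-neighbours in W, so a must belong to the surviving class.
              class-a : c a ≡ i
              class-a with c a ≟ i
              ... | yes e = e
              ... | no n = ⊥-elim (<⇒≱ (≤-trans (≤-reflexive (∣-∣ (in′ D S p) (a∈S , a→p))) in-p)
                (≤-trans (indegree Y-irreflexive critW (in-outside S⊆R′ p∈S p∉R))
                  (∣∣-mono {P = in′ Y W (inj₂ p)} {in′ D S p - a} (inject f inj))))
                where
                f : ∀ x → x ∈ˢ in′ Y W (inj₂ p) → Σ V (mem (in′ D S p - a))
                f (inj₁ _) (_ , inj₁ ())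
                f (inj₂ _) (_ , inj₁ ())
                f (inj₁ i′) (x∈ , inj₂ (_ , z , w , (z∈R , refl) , (refl , _) , d)) = z , (R⊆ z z∈R , d) , λ { refl → n (only (c a) x∈) }
                f (inj₂ u) (x∈ , inj₂ (_ , z , w , (refl , u∈S , u∉R) , (refl , _) , d)) = z , (u∈S , d) , λ { refl → u∉R a∈R }
                inj : ∀ x y m m′ → proj₁ (f x m) ≡ proj₁ (f y m′) → x ≡ y
                inj (inj₁ _) _ (_ , inj₁ ())
                inj (inj₂ _) _ (_ , inj₁ ())
                inj _ (inj₁ _) _ (_ , inj₁ ())
                inj _ (inj₂ _) _ (_ , inj₁ ())
                inj (inj₁ _) (inj₁ _) (_ , inj₂ (_ , _ , _ , (_ , refl) , (refl , _) , _)) (_ , inj₂ (_ , _ , _ , (_ , refl) , (refl , _) , _)) refl = refl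
                inj (inj₁ _) (inj₂ _) (_ , inj₂ (_ , _ , _ , (m , refl) , (refl , _) , _)) (_ , inj₂ (_ , _ , _ , (refl , _ , n) , (refl , _) , _)) refl = ⊥-elim (n m)
                inj (inj₂ _) (inj₁ _) (_ , inj₂ (_ , _ , _ , (refl , _ , n) , (refl , _) , _)) (_ , inj₂ (_ , _ , _ , (m , refl) , (refl , _) , _)) refl = ⊥-elim (n m)
                inj (inj₂ _) (inj₂ _) (_ , inj₂ (_ , _ , _ , (refl , _) , (refl , _) , _)) (_ , inj₂ (_ , _ , _ , (refl , _) , (refl , _) , _)) refl = refl

              lost : ∀ z → z ∈ˢ Zs → z ∈ˢ R × inj₁ (c z) ∉ˢ W × ∃ λ u → u ∈ˢ outside × ((z , u) ∈ˢ D ⊎ (u , z) ∈ˢ D)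
              lost z m = let (z∈R , _ , u , (u∈S , u∉R) , d) = zs⊆ z m in
                z∈R , (λ z∈W → a-separated m (trans (only (c z) z∈W) (sym class-a))) , u , in-outside S⊆R′ u∈S u∉R , d

              -- If a is the only boundary vertex in its class, then W is a subdigraph of D on (S ∖ R) ∪ {a}.
              embedded : (∀ z → z ∈ˢ Z → z ∈ zs) → ⊥
              embedded all =
                let (x , x∈R , x≢a) = nonempty (R - a) (≤-pred (≤-trans (proj₂ (proj₂ (proj₂ family))) (≤-reflexive (sym (∣-∣ R a∈R))))) in
                removable crit x (R⊆ x x∈R) λ (c′ , ranked r′ ok′) →
                  uncolourable critW ([ (λ _ → c′ a) , c′ ]′ , ranked [ (λ _ → r′ a) , r′ ]′ (go x∈R x≢a c′ r′ ok′))
                where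
                boundary : ∀ {z u} → z ∈ˢ R → c z ≡ i → u ∈ˢ S → u ∉ˢ R → (z , u) ∈ˢ D ⊎ (u , z) ∈ˢ D → z ≡ a
                boundary {z} {u} z∈R cz u∈S u∉R d = decidable-stable (z ≟ a) λ n →
                  a-separated (all z (z∈R , n , u , (u∈S , u∉R) , d)) (trans cz (sym class-a))
                go : ∀ {x} → x ∈ˢ R → x ≢ a → ∀ c′ r′ → Ranks D (S - x) c′ r′ → Ranks Y W [ (λ _ → c′ a) , c′ ]′ [ (λ _ → r′ a) , r′ ]′
                go x∈R x≢a c′ r′ ok′ (inj₁ k) (inj₁ l) k∈ l∈ (inj₁ n) e = ⊥-elim (n (trans (only k k∈) (sym (only l l∈))))
                go x∈R x≢a c′ r′ ok′ (inj₁ k) (inj₂ u) k∈ _ (inj₂ (_ , z , _ , (z∈R , cz) , (refl , u∈S , u∉R) , d)) e =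
                  ok′ a u (a∈S , x≢a ∘ sym) (u∈S , λ { refl → u∉R x∈R })
                    (subst (λ z → (z , u) ∈ˢ D) (boundary z∈R (trans cz (only k k∈)) u∈S u∉R (inj₁ d)) d) e
                go x∈R x≢a c′ r′ ok′ (inj₂ u) (inj₁ k) _ k∈ (inj₂ (_ , _ , z , (refl , u∈S , u∉R) , (z∈R , cz) , d)) e =
                  ok′ u a (u∈S , λ { refl → u∉R x∈R }) (a∈S , x≢a ∘ sym)
                    (subst (λ z → (u , z) ∈ˢ D) (boundary z∈R (trans cz (only k k∈)) u∈S u∉R (inj₂ d)) d) e
                go x∈R x≢a c′ r′ ok′ (inj₂ u) (inj₂ v) _ _ (inj₂ (_ , _ , _ , (refl , u∈S , u∉R) , (refl , v∈S , v∉R) , d)) e =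
                  ok′ u v (u∈S , λ { refl → u∉R x∈R }) (v∈S , λ { refl → v∉R x∈R }) d e

              one-class : suc (M + 2 * K * suc j) ≼ R
              one-class = case zs-all of λ
                { (inj₂ all) → ⊥-elim (embedded all)
                ; (inj₁ e) → subst (λ h → suc (M + 2 * K * h) ≼ R) (trans (∣fromList∣ zs-unique) e)
                    (whole-arithmetic {M} {2 * K} {∣ Zs ∣} {∣ arcs D R ∣} {∣ R ∣} (conclude {suc C} {M} Zs lost (whole-potential R′⊆ S⊆R′)
                      (clique-potential₁ κ 1≤classes (∣classes∣≤K classes)))) }

            goal : Goal
            goal = unless-one-class OneClass.one-class

        step : Goal
        step = decidable-stable ((_ ≤? _) ⊎-dec (_ ≤? _)) λ ¬goal → star-colourable λ (c , col★) →
          collapse R⊆ a∈R large (Coloured.col c col★) λ W W⊆ critW (i , i∈) small →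
            ¬goal (Coloured.Outcome.goal c col★ W W⊆ critW i∈ small)

      step : (suc (M + 2 * K * suc j) ≼ R) ⊎ (suc N ≼ R)
      step = let (zs , u , s , l , all) = subset-of-size Z (suc j) in Chosen.step zs u s l all

    bounded : ∀ j → 2 * j < 2 + κ → ∀ R → Family R → Bounded j R
    bounded zero _ R (R⊆ , a∈R , p∉R , _) = inj₁ (subst (_≼ R) (sym (trans (cong (M +_) (*-zeroʳ (2 * K))) (+-identityʳ M)))
      (gap (∣ S ∖ R ∣) R ≤-refl R⊆ (a , a∈R) (p , p∈S , p∉R)))
    bounded (suc j) l R family@(_ , _ , _ , two) = case ∣ R ∣ ≤? K of λ
      { (yes small) → inj₂ (small-potential {N} R (clique-potential₂ κ two small))
      ; (no large) → [ inj₁ ∘ ≼-weaken {suc (M + 2 * K * suc j)} {M + 2 * K * suc j} {R} (n≤1+n (M + 2 * K * suc j))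
                     , inj₂ ∘ ≼-weaken {suc N} {N} {R} (n≤1+n N) ]′
          (Step.step j 2j<κ (bounded j (≤-trans 2j<κ (m≤n+m κ 2))) R family (≰⇒> large)) }
      where
      2j<κ : 2 * j < κ
      2j<κ = ≤-pred (≤-pred (subst (_< 2 + κ) (*-suc 2 j) l))

    -- The rounds stop at 2j < κ ≤ 2(j + 1), when M + 2K(j + 1) ≥ 2K² + Kκ = N.
    large-potential : 1 ≤ κ → ∀ R → R ⊆ˢ S → a ∈ˢ R → p ∉ˢ R → suc K ≤ ∣ R ∣ → suc N ≼ R
    large-potential 1≤κ R R⊆ a∈R p∉R large =
      let (j , 2j<κ , κ≤) = half κ 1≤κ in
      [ ≼-weaken {suc (M + 2 * K * suc j)} {suc N} {R} (s≤s (N≤ j κ≤)) , id ]′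
        (Step.step j 2j<κ (bounded j (≤-trans 2j<κ (m≤n+m κ 2))) R (R⊆ , a∈R , p∉R , ≤-trans (s≤s (s≤s z≤n)) large) large)
      where
      half : ∀ n → 1 ≤ n → ∃ λ j → 2 * j < n × n ≤ 2 * suc j
      half 1 _ = 0 , ≤-refl , s≤s z≤n
      half 2 _ = 0 , s≤s z≤n , ≤-refl
      half (suc (suc (suc n))) _ = let (j , l , l′) = half (suc n) (s≤s z≤n) in
        suc j , subst (_< 3 + n) (sym (*-suc 2 j)) (s≤s (s≤s l)) , subst (3 + n ≤_) (sym (*-suc 2 (suc j))) (s≤s (s≤s l′))
      N≤ : ∀ j → κ ≤ 2 * suc j → N ≤ M + 2 * K * suc j
      N≤ j κ≤ = ≤-trans (+-mono-≤ (m≤m+n (2 * K * K) κ) (*-monoʳ-≤ K κ≤)) (≤-reflexive (identity K κ j))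
        where
        identity : ∀ K κ j → 2 * K * K + κ + K * (2 * suc j) ≡ 2 * K * K + κ + 2 * K * suc j
        identity = solve-∀

-- Extremal counterexamples

rev : {V : Set} → Dig V → Dig V
rev D = dset (λ (u , v) → (v , u) ∈ˢ D) (λ (u , v) → mem? D (v , u))

module _ {V : Set} {{_ : Finite V}} where

  digons : Dig V → DSet V → DSet (V × V)
  digons D S = dset (λ (u , v) → u ∈ˢ S × v ∈ˢ S × (u , v) ∈ˢ D × (v , u) ∈ˢ D)
    (λ (u , v) → mem? S u ×-dec mem? S v ×-dec mem? D (u , v) ×-dec mem? D (v , u))

  triangles : Dig V → DSet V → DSet (V × V × V)
  triangles D S = dset (λ (u , v , w) → (u , v) ∈ˢ digons D S × (v , w) ∈ˢ digons D S × (w , u) ∈ˢ digons D S)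
    (λ (u , v , w) → mem? (digons D S) (u , v) ×-dec mem? (digons D S) (v , w) ×-dec mem? (digons D S) (w , u))

  -- Tie-break among counterexamples with equally many vertices: the copy operation below preserves |S|, so it has to improve on this order.
  Better : DSet V → Dig V → Dig V → Set
  Better S D′ D = (∣ arcs D′ S ∣ < ∣ arcs D S ∣) ⊎ ((∣ arcs D′ S ∣ ≤ ∣ arcs D S ∣) ×
    ((∣ digons D S ∣ < ∣ digons D′ S ∣) ⊎ ((∣ digons D S ∣ ≤ ∣ digons D′ S ∣) × (∣ triangles D S ∣ < ∣ triangles D′ S ∣))))

  rev-Col : ∀ {K} (D : Dig V) (S : DSet V) → Col K D S → Col K (rev D) S
  rev-Col D S (c , ranked r ok) = c , ranked (λ v → maximum r ∸ r v) λ u v p q a e →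
    ∸-monoʳ-< (ok v u q p a (sym e)) (≤maximum r u)

  rev-Crit : ∀ {K} (D : Dig V) (S : DSet V) → Crit K D S → Crit K (rev D) S
  rev-Crit D S crit = critical (λ col → uncolourable crit (rev-Col (rev D) S col))
    λ v v∈ ¬col → removable crit v v∈ λ col → ¬col (rev-Col D (S - v) col)

  ∣rev-arcs∣ : ∀ (D : Dig V) (S : DSet V) → ∣ arcs (rev D) S ∣ ≤ ∣ arcs D S ∣
  ∣rev-arcs∣ D S = ∣∣-mono {P = arcs (rev D) S} {arcs D S}
    (inject (λ (u , v) (p , q , a) → (v , u) , q , p , a) λ { _ _ _ _ refl → refl })

  ∣rev-digons∣ : ∀ (D : Dig V) (S : DSet V) → ∣ digons (rev D) S ∣ ≤ ∣ digons D S ∣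
  ∣rev-digons∣ D S = ∣∣-⊆ {P = digons (rev D) S} {digons D S} λ (u , v) (p , q , a , b) → p , q , b , a

  ∣rev-triangles∣ : ∀ (D : Dig V) (S : DSet V) → ∣ triangles (rev D) S ∣ ≤ ∣ triangles D S ∣
  ∣rev-triangles∣ D S = ∣∣-⊆ {P = triangles (rev D) S} {triangles D S} λ (u , v , w) (x , y , z) → flip u v x , flip v w y , flip w u z
    where
    flip : ∀ u v → (u , v) ∈ˢ digons (rev D) S → (u , v) ∈ˢ digons D S
    flip _ _ (p , q , a , b) = p , q , b , a

  rev-Better : ∀ (S : DSet V) (D′ D : Dig V) → Better S D′ (rev D) → Better S (rev D′) D
  rev-Better S D′ D (inj₁ l) = inj₁ (≤-trans (s≤s (∣rev-arcs∣ D′ S)) (≤-trans l (∣rev-arcs∣ D S)))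
  rev-Better S D′ D (inj₂ (l , m)) = inj₂ (≤-trans (∣rev-arcs∣ D′ S) (≤-trans l (∣rev-arcs∣ D S)) , [ inj₁ ∘ d , inj₂ ∘ t ]′ m)
    where
    d : ∣ digons (rev D) S ∣ < ∣ digons D′ S ∣ → ∣ digons D S ∣ < ∣ digons (rev D′) S ∣
    d l = ≤-trans (s≤s (∣rev-digons∣ (rev D) S)) (≤-trans l (∣rev-digons∣ (rev D′) S))
    t : (∣ digons (rev D) S ∣ ≤ ∣ digons D′ S ∣) × (∣ triangles (rev D) S ∣ < ∣ triangles D′ S ∣) →
      (∣ digons D S ∣ ≤ ∣ digons (rev D′) S ∣) × (∣ triangles D S ∣ < ∣ triangles (rev D′) S ∣)
    t (l , m) = ≤-trans (∣rev-digons∣ (rev D) S) (≤-trans l (∣rev-digons∣ (rev D′) S)) ,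
      ≤-trans (s≤s (∣rev-triangles∣ (rev D) S)) (≤-trans m (∣rev-triangles∣ (rev D′) S))

-- `best` speaks of all critical digraphs on `S`, counterexamples or not: a better one has no more
-- arcs and hence violates the bound too.
record Extremal (κ : ℕ) {V : Set} {{_ : Finite V}} (D : Dig V) (S : DSet V) : Set₁ where
  field
    irr : Irreflexive D
    crit : Crit (2 + κ) D S
    ih : InductionHypothesis κ ∣ S ∣
    counter : 2 * (2 + κ) * ∣ arcs D S ∣ + bound (2 + κ) κ < weight (2 + κ) κ * ∣ S ∣
    best : ∀ D′ → Irreflexive D′ → Crit (2 + κ) D′ S → Better S D′ D → ⊥
    1≤κ : 1 ≤ κ

rev-Extremal : ∀ {κ} {V : Set} {{_ : Finite V}} {D : Dig V} {S : DSet V} → Extremal κ D S → Extremal κ (rev D) S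
rev-Extremal {κ} {D = D} {S} G = record
  { irr = irr
  ; crit = rev-Crit D S crit
  ; ih = ih
  ; counter = ≤-trans (s≤s (+-monoˡ-≤ (bound (2 + κ) κ) (*-monoʳ-≤ (2 * (2 + κ)) (∣rev-arcs∣ D S)))) counter
  ; best = λ D′ i c b → best (rev D′) i (rev-Crit D′ S c) (rev-Better S D′ D b)
  ; 1≤κ = 1≤κ
  }
  where open Extremal G

-- Numerical inequalities for extremal counterexamples

near-complete-arithmetic : ∀ {κ} → 1 ≤ κ → ∀ {a} → (3 + κ) * (3 + κ) ≤ a + (3 + κ + 2) →
  ¬ (weight (2 + κ) κ + 2 * (2 + κ) * a ≤ weight (2 + κ) κ * (3 + κ))
near-complete-arithmetic {suc k} _ {a} p q =
  n≮0 (linear {x = 1} {0} (k * k + 4 * k + 2) (+-mono-≤ q (*-monoʳ-≤ (2 * (3 + k)) p)) (identity k a))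
  where
  identity : ∀ k a → let κ = suc k ; K = 2 + κ ; M = 2 * K * K + κ in
    1 + (M * suc K + 2 * K * (a + (suc K + 2))) + (k * k + 4 * k + 2) ≡ M + 2 * K * a + 2 * K * (suc K * suc K)
  identity = solve-∀

-- Let f(r) be the potential of the complete digraph on r vertices. Completing r vertices to a
-- complete digraph on K changes the potential by at most N - f(r), and the piece W has at most C +
-- 4Kr; the contradiction is f(r) ≥ C + 4Kr for 1 ≤ r ≤ κ.
special-arithmetic : ∀ {κ} r t w aR aW e → let K = 2 + κ in 1 ≤ r → r ≤ κ → r + t ≡ K →
  suc (cliqueBound K κ) + 2 * K * aR ≤ weight K κ * (w + t) → weight K κ * w ≤ 2 * K * (aW + (r + r)) + bound K κ →
  aW + e ≤ aR → K * K + r ≤ e + K + r * r → ⊥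
special-arithmetic (suc x) t w aR aW e _ r≤κ r+t p q l m with m≤n⇒∃[o]m+o≡n r≤κ
... | y , refl with +-cancelˡ-≡ (suc x) t (2 + y) (trans r+t (sym (trans (+-suc (suc x) (suc y)) (cong suc (+-suc (suc x) y)))))
... | refl = n≮0 (linear {x = 1} {0} ((2 + (suc x + y)) * (1 + x + y + 2 * x * y) + x * (suc x + y))
  (+-mono-≤ p (+-mono-≤ q (+-mono-≤ (*-monoʳ-≤ (2 * (2 + (suc x + y))) l) (*-monoʳ-≤ (2 * (2 + (suc x + y))) m))))
  (identity x y w aR aW e))
  where
  identity : ∀ x y w aR aW e → let r = suc x ; κ = r + y ; K = 2 + κ ; M = 2 * K * K + κ in
    1 + (M * (w + (2 + y)) + (2 * K * (aW + (r + r)) + (1 + K) * κ + (2 * K * aR + 2 * K * (e + K + r * r))))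
      + (K * (1 + x + y + 2 * x * y) + x * κ)
    ≡ suc (2 * K * K + K * κ) + 2 * K * aR + (M * w + (2 * K * (aW + e) + 2 * K * (K * K + r)))
  identity = solve-∀

count-below : ∀ {m n} → m ≤ n → m ≤ ∣ dset (λ (i : Fin n) → Fin.toℕ i < m) (λ i → Fin.toℕ i <? m) ∣
count-below {m} {n} l = ≤-trans (≤-reflexive (sym (∣fullˢ∣ m)))
  (∣∣-mono {P = fullˢ {Fin m}} {dset (λ (i : Fin n) → Fin.toℕ i < m) (λ i → Fin.toℕ i <? m)} (inject
    (λ i _ → Fin.inject≤ i l , subst (_< m) (sym (toℕ-inject≤ i l)) (toℕ<n i))
    λ i j _ _ e → inject≤-injective l l i j e))

module _ {A : Set} {{_ : Finite A}} where

  ∣∣≤1 : (P : DSet A) → (∀ {x y} → x ∈ˢ P → y ∈ˢ P → x ≡ y) → ∣ P ∣ ≤ 1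
  ∣∣≤1 P same = case ∃? (mem? P) of λ
    { (yes (x , m)) → ≤-trans (∣∣-⊆ {P = P} {⟨ x ⟩} λ y n → same n m) (≤-reflexive (∣⟨⟩∣ x))
    ; (no none) → ≤-trans (∣∣-⊆ {P = P} {∅ˢ} λ y n → none (y , n)) (≤-trans (≤-reflexive (∣∅ˢ∣ {A})) z≤n) }

  at-most-one : (P : DSet A) → ∣ P ∣ ≤ 1 → ∀ {x y} → x ∈ˢ P → y ∈ˢ P → x ≡ y
  at-most-one P l {x} {y} m n = decidable-stable (x ≟ y) λ x≢y →
    <⇒≱ (≤-trans (s≤s (1≤size (P - x) (n , x≢y ∘ sym))) (≤-reflexive (∣-∣ P m))) l

-- (K - t)(t - 1) is concave in t and equals κ at both ends, t = 2 and t = K - 1.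
cluster-arithmetic : ∀ {κ z t} → 2 ≤ t → t ≤ 1 + κ → 2 + κ ≤ t + z → κ ≤ z * (t ∸ 1)
cluster-arithmetic {κ} {z} {suc (suc x)} (s≤s (s≤s _)) t≤ l with m≤n⇒∃[o]m+o≡n (≤-pred t≤)
... | y , refl = ≤-trans (m+n≤o⇒m≤o _ (≤-reflexive (identity x y))) (*-monoˡ-≤ (suc x) 1+y≤z)
  where
  1+y≤z : suc y ≤ z
  1+y≤z = +-cancelˡ-≤ (2 + x) _ _ (≤-trans (≤-reflexive (+-suc (2 + x) y)) l)
  identity : ∀ x y → suc (x + y) + x * y ≡ suc y * suc x
  identity = solve-∀

-- With s = d - K the worst case for 1 ≤ s ≤ κ is (s - 1)(κ - s) ≥ 0; the factor 2K - 1 = 3 + 2κ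
-- makes both s = 1 and s = κ tight. Beyond κ the left side grows by at most κ per unit of s, the
-- right side by 2K - 1.
weight-arithmetic : ∀ κ {d m q} → 2 + κ ≤ d → m ≤ d ∸ (2 + κ) → m ≤ κ → q ≤ κ → (d ≤ 2 + κ → q ≤ 0) →
  d * m + (q + (3 + 2 * κ) * (2 + κ)) ≤ (3 + 2 * κ) * d
weight-arithmetic κ {d} {m} {q} K≤d m≤s m≤κ q≤κ q≡0 with m≤n⇒∃[o]m+o≡n K≤d
... | zero , refl = begin
    (2 + κ + 0) * m + (q + (3 + 2 * κ) * (2 + κ))  ≤⟨ +-mono-≤ (*-monoʳ-≤ (2 + κ + 0) (≤-trans m≤s (≤-reflexive (m+n∸m≡n (2 + κ) 0))))
                                                      (+-monoˡ-≤ _ (q≡0 (≤-reflexive (+-identityʳ (2 + κ))))) ⟩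
    (2 + κ + 0) * 0 + (0 + (3 + 2 * κ) * (2 + κ))  ≡⟨ identity κ ⟩
    (3 + 2 * κ) * (2 + κ + 0)                      ∎
  where
  open ≤-Reasoning
  identity : ∀ κ → (2 + κ + 0) * 0 + (0 + (3 + 2 * κ) * (2 + κ)) ≡ (3 + 2 * κ) * (2 + κ + 0)
  identity = solve-∀
... | suc s , refl = ≤-trans (+-mono-≤ (≤-refl {(2 + κ + suc s) * m}) (+-monoˡ-≤ ((3 + 2 * κ) * (2 + κ)) q≤κ))
    ([ below , above ]′ (≤-total (suc s) κ))
  where
  m≤ : m ≤ suc s
  m≤ = ≤-trans m≤s (≤-reflexive (m+n∸m≡n (2 + κ) (suc s)))
  below : suc s ≤ κ → (2 + κ + suc s) * m + (κ + (3 + 2 * κ) * (2 + κ)) ≤ (3 + 2 * κ) * (2 + κ + suc s)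
  below l with m≤n⇒∃[o]m+o≡n l
  ... | y , refl = ≤-trans (+-monoˡ-≤ _ (*-monoʳ-≤ (2 + (suc s + y) + suc s) m≤)) (m+n≤o⇒m≤o _ (≤-reflexive (identity s y)))
    where
    identity : ∀ s y → let κ = suc s + y in
      (2 + κ + suc s) * suc s + (κ + (3 + 2 * κ) * (2 + κ)) + y * s ≡ (3 + 2 * κ) * (2 + κ + suc s)
    identity = solve-∀
  above : κ ≤ suc s → (2 + κ + suc s) * m + (κ + (3 + 2 * κ) * (2 + κ)) ≤ (3 + 2 * κ) * (2 + κ + suc s)
  above l with m≤n⇒∃[o]m+o≡n l
  ... | y , e = subst (λ x → (2 + κ + x) * m + (κ + (3 + 2 * κ) * (2 + κ)) ≤ (3 + 2 * κ) * (2 + κ + x)) e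
      (≤-trans (+-monoˡ-≤ _ (*-monoʳ-≤ (2 + κ + (κ + y)) m≤κ)) (m+n≤o⇒m≤o _ (≤-reflexive (identity κ y))))
    where
    identity : ∀ κ y → (2 + κ + (κ + y)) * κ + (κ + (3 + 2 * κ) * (2 + κ)) + (3 + κ) * y ≡ (3 + 2 * κ) * (2 + κ + (κ + y))
    identity = solve-∀

-- Earnings on either side are covered by payments on the other and cancel. What remains is a
-- density of at least K + κ/(2K - 1), more than the K + κ/(2K) that a counterexample stays below.
final-arithmetic : ∀ κ {n o ι h⁺ h⁻ a w⁺ w⁻ p e p′ e′} → let K = 2 + κ ; L = 3 + 2 * κ in
  o * κ + p ≤ w⁺ + e → ι * κ + p′ ≤ w⁻ + e′ → e ≤ p′ → e′ ≤ p → w⁺ + (h⁻ * κ + n * (L * K)) ≤ L * a → w⁻ + (h⁺ * κ + n * (L * K)) ≤ L * a →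
  n ≤ o + h⁺ → n ≤ ι + h⁻ → ¬ (2 * K * a + bound K κ < weight K κ * n)
final-arithmetic κ {n} {o} {ι} {h⁺} {h⁻} {a} {w⁺} {w⁻} {p} {e} {p′} {e′} r₁ r₂ t₁ t₂ s₁ s₂ c₁ c₂ counter =
  n≮0 (linear {x = 1} {0} (κ * n + 2 + 2 * κ + (3 + 2 * κ) * ((3 + κ) * κ))
    (+-mono-≤ (*-monoʳ-≤ (2 + κ) (+-mono-≤ (+-mono-≤ r₁ r₂) (+-mono-≤ (+-mono-≤ t₁ t₂) (+-mono-≤ (+-mono-≤ s₁ s₂)
      (+-mono-≤ (*-monoʳ-≤ κ c₁) (*-monoʳ-≤ κ c₂)))))) (*-monoʳ-≤ (3 + 2 * κ) counter))
    (identity κ n o ι h⁺ h⁻ a w⁺ w⁻ p e p′ e′))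
  where
  identity : ∀ κ n o ι h⁺ h⁻ a w⁺ w⁻ p e p′ e′ → let K = 2 + κ ; L = 3 + 2 * κ in
    1 + (K * ((w⁺ + e + (w⁻ + e′)) + ((p′ + p) + ((L * a + L * a) + (κ * (o + h⁺) + κ * (ι + h⁻))))) + L * ((2 * K * K + κ) * n))
      + (κ * n + 2 + 2 * κ + L * ((3 + κ) * κ))
    ≡ K * ((o * κ + p + (ι * κ + p′)) + ((e + e′) + ((w⁺ + (h⁻ * κ + n * (L * K)) + (w⁻ + (h⁺ * κ + n * (L * K)))) + (κ * n + κ * n))))
      + L * suc (2 * K * a + (1 + K) * κ)
  identity = solve-∀

-- Near-complete sets and the copy operation

module OneSided {κ : ℕ} {V : Set} {{_ : Finite V}} {D : Dig V} {S : DSet V} (G : Extremal κ D S) where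

  open Extremal G public
  open Counterexample irr crit ih counter public

  Complete : DSet V → Set
  Complete X = ∀ u → u ∈ˢ X → ∀ v → v ∈ˢ X → u ≢ v → (u , v) ∈ˢ D

  -- A complete digraph on K + 1 vertices has potential C, and one missing digon adds 4K, which is
  -- still less than M = C + K(κ + 4). If `X` is all of `S`, minimum outdegree K already gives the
  -- bound. Taking `c` equal to `d` covers complete sets.
  near-complete : ∀ X → X ⊆ˢ S → ∣ X ∣ ≡ suc K → ∀ c d →
    (∀ u → u ∈ˢ X → ∀ v → v ∈ˢ X → u ≢ v → ¬ ((u ≡ c × v ≡ d) ⊎ (u ≡ d × v ≡ c)) → (u , v) ∈ˢ D) → ⊥
  near-complete X X⊆ size c d all = [ (λ w → near-complete-arithmetic 1≤κ {∣ arcs D X ∣} many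
      (subst (λ n → M + 2 * K * ∣ arcs D X ∣ ≤ M * n) size (gap (∣ S ∖ X ∣) X ≤-refl X⊆ X-nonempty w)))
    , (λ S⊆ → whole (≤-trans (∣∣-⊆ {P = S} {X} S⊆) (≤-reflexive size))) ]′ (covers? X)
    where
    X-nonempty : ∃ λ x → x ∈ˢ X
    X-nonempty = nonempty X (≤-trans (s≤s z≤n) (≤-reflexive (sym size)))
    diagonal : DSet (V × V)
    diagonal = dset (λ (u , v) → u ∈ˢ X × u ≡ v) (λ (u , v) → mem? X u ×-dec (u ≟ v))
    ∣diagonal∣ : ∣ diagonal ∣ ≤ suc K
    ∣diagonal∣ = ≤-trans (∣∣-mono {P = diagonal} {X} (inject (λ (u , _) (p , _) → u , p) λ { _ _ (_ , refl) (_ , refl) refl → refl }))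
      (≤-reflexive size)
    split : ∀ e → e ∈ˢ X ⊗ X → e ∈ˢ arcs D X ⊎ e ∈ˢ diagonal ∪ (⟨ c , d ⟩ ∪ ⟨ d , c ⟩)
    split (u , v) (p , q) = case u ≟ v of λ
      { (yes e) → inj₂ (inj₁ (p , e))
      ; (no n) → case mem? (⟨ c , d ⟩ ∪ ⟨ d , c ⟩) (u , v) of λ
        { (yes m) → inj₂ (inj₂ m)
        ; (no m) → inj₁ (p , q , all u p v q n λ
          { (inj₁ (refl , refl)) → m (inj₁ refl) ; (inj₂ (refl , refl)) → m (inj₂ refl) }) } }
    many : suc K * suc K ≤ ∣ arcs D X ∣ + (suc K + 2)
    many = ≤-trans (≤-reflexive (sym (trans (∣⊗∣ X X) (cong₂ _*_ size size))))
      (≤-trans (∣∣-cover {P = arcs D X} {diagonal ∪ (⟨ c , d ⟩ ∪ ⟨ d , c ⟩)} {X ⊗ X} split)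
        (+-monoʳ-≤ (∣ arcs D X ∣) (≤-trans (∣∣-cover {P = diagonal} {⟨ c , d ⟩ ∪ ⟨ d , c ⟩} {diagonal ∪ (⟨ c , d ⟩ ∪ ⟨ d , c ⟩)} (λ _ → id))
          (+-mono-≤ ∣diagonal∣ (≤-trans (∣∣-cover {P = ⟨ c , d ⟩} {⟨ d , c ⟩} {⟨ c , d ⟩ ∪ ⟨ d , c ⟩} (λ _ → id))
            (≤-reflexive (cong₂ _+_ (∣⟨⟩∣ (c , d)) (∣⟨⟩∣ (d , c)))))))))
    whole : ∣ S ∣ ≤ suc K → ⊥
    whole l = <⇒≱ counter (≤-trans (*-monoʳ-≤ M l) (≤-trans (≤-reflexive (identity κ))
      (+-monoˡ-≤ C (*-monoʳ-≤ (2 * K) (≤-trans (*-monoˡ-≤ K (Crit-size irr crit Fin.zero)) (Crit-arcs irr crit))))))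
      where
      identity : ∀ κ → let K = 2 + κ in (2 * K * K + κ) * suc K ≡ 2 * K * (suc K * K) + (1 + K) * κ
      identity = solve-∀

  Clique : DSet V → Set
  Clique T = ∀ x → x ∈ˢ T → ∀ y → y ∈ˢ T → x ≢ y → (x , y) ∈ˢ D × (y , x) ∈ˢ D

  rainbow : ∀ {c : V → Fin K} {R T} → IsCol D R c → T ⊆ˢ R → Clique T → ∀ {x y} → x ∈ˢ T → y ∈ˢ T → c x ≡ c y → x ≡ y
  rainbow (ranked r ok) T⊆ clique {x} {y} p q e = decidable-stable (x ≟ y) λ n →
    let (a , b) = clique x p y q n in <-asym (ok x y (T⊆ x p) (T⊆ y q) a e) (ok y x (T⊆ y q) (T⊆ x p) b (sym e))

  -- If only one class of R survived in the collapse, then z would lose all but one of its in-arcs from T.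
  cluster-potential : ∀ {z R T a} → z ∈ˢ S → z ∉ˢ R → R ⊆ˢ S → suc K ≤ ∣ R ∣ → T ⊆ˢ R → Clique T →
    (∀ y → y ∈ˢ T → (y , z) ∈ˢ D) → a ∈ˢ T → 2 + ∣ in′ D S z ∣ ≤ K + ∣ T ∣ → suc N ≼ R
  cluster-potential {z} {R} {T} {a} z∈S z∉R R⊆ large T⊆ clique T→z a∈T few = decidable-stable (_ ≤? _) λ ¬goal →
    removable crit z z∈S λ (c , ranked r ok) →
      let col = ranked r (λ u v p q → ok u v (R⊆ u p , λ { refl → z∉R p }) (R⊆ v q , λ { refl → z∉R q })) in
      collapse R⊆ (T⊆ a a∈T) large col λ W W⊆ critW (i , i∈) small →
        ¬goal ([ (λ ()) , id ]′ (Collapsed.unless-one-class R⊆ (T⊆ a a∈T) col W W⊆ critW i∈ small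
          λ S⊆R′ only → one-class c col W W⊆ critW i∈ small S⊆R′ only))
    where
    one-class : ∀ c (col : IsCol D R c) → let open Collapse {K = K} D irr S R c col in
      ∀ W (W⊆ : W ⊆ˢ YS) → Crit K Y W → ∀ {i} → inj₁ i ∈ˢ W → M * ∣ W ∣ ≤ 2 * K * ∣ arcs Y W ∣ + C →
      S ⊆ˢ Expand.R′ W W⊆ → (∀ i′ → inj₁ i′ ∈ˢ W → i′ ≡ i) → ⊥
    one-class c col W W⊆ critW {i} i∈ small S⊆R′ only =
      <⇒≱ (≤-trans (s≤s (≤-reflexive (trans (cong (K +_) (sym (∣-∣ T (proj₁ (proj₂ y₀))))) (+-suc K (∣ T - y ∣))))) (s≤s (s≤s total))) few
      where
      open Collapse {K = K} D irr S R c col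
      y₀ : ∃ λ y → y ∈ˢ T × (∀ x → x ∈ˢ T → c x ≡ i → x ≡ y)
      y₀ = case ∃? (λ y → mem? T y ×-dec (c y ≟ i)) of λ
        { (yes (y , m , e)) → y , m , λ x m′ e′ → rainbow {T = T} col T⊆ clique m′ m (trans e′ (sym e))
        ; (no n) → a , a∈T , λ x m′ e′ → ⊥-elim (n (x , m′ , e′)) }
      y = proj₁ y₀
      lifted : ∀ x → x ∈ˢ in′ Y W (inj₂ z) → ∃ (Lift x)
      lifted (inj₁ _) (_ , inj₁ ())
      lifted (inj₂ _) (_ , inj₁ ())
      lifted x (_ , inj₂ (_ , v , _ , l , _)) = v , l
      f : ∀ x (m : x ∈ˢ in′ Y W (inj₂ z)) → proj₁ (lifted x m) ∈ˢ in′ D S z ∖ (T - y)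
      f (inj₁ _) (_ , inj₁ ())
      f (inj₂ _) (_ , inj₁ ())
      f (inj₁ k) (x∈ , inj₂ (_ , v , _ , (v∈R , e) , (refl , _) , d)) =
        (R⊆ v v∈R , d) , λ (m , n) → n (proj₂ (proj₂ y₀) v m (trans e (only k x∈)))
      f (inj₂ u) (x∈ , inj₂ (_ , v , _ , (refl , u∈S , u∉R) , (refl , _) , d)) =
        (u∈S , d) , λ (m , _) → u∉R (T⊆ v m)
      kept : K ≤ ∣ in′ D S z ∖ (T - y) ∣
      kept = ≤-trans (indegree Y-irreflexive critW (Collapsed.in-outside R⊆ (T⊆ a a∈T) col W W⊆ critW i∈ small S⊆R′ z∈S z∉R))
        (∣∣-mono {P = in′ Y W (inj₂ z)} {in′ D S z ∖ (T - y)} (inject (λ x m → proj₁ (lifted x m) , f x m)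
          λ x x′ m m′ e → lift-unique x x′ (subst (Lift x) e (proj₂ (lifted x m))) (proj₂ (lifted x′ m′))))
      total : K + ∣ T - y ∣ ≤ ∣ in′ D S z ∣
      total = ≤-trans (+-monoˡ-≤ (∣ T - y ∣) kept) (≤-trans (≤-reflexive (+-comm (∣ in′ D S z ∖ (T - y) ∣) (∣ T - y ∣)))
        (∣∣-disjoint {P = T - y} {in′ D S z ∖ (T - y)} {in′ D S z}
          (λ x (m , _) → R⊆ x (T⊆ x m) , T→z x m) (λ _ → proj₁) (λ _ m (_ , n) → n m)))

  -- K vertices if `a` has outdegree K and `z` is an out-neighbour; their completeness is the
  -- exceptional case of every copy argument.
  A′ : V → V → DSet V
  A′ a z = (out D S a - z) ∪ ⟨ a ⟩

  Complete? : ∀ X → Dec (Complete X)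
  Complete? X = map′ (λ none u p v q n → decidable-stable (mem? D (u , v)) λ m → none (u , v , p , q , n , m))
    (λ all (u , v , p , q , n , m) → m (all u p v q n))
    (¬? (∃? λ u → ∃? λ v → mem? X u ×-dec mem? X v ×-dec ¬? (u ≟ v) ×-dec ¬? (mem? D (u , v))))

  -- Replace z by a new vertex joined by digons to A′ a z.
  module Copy {a z : V} (a∈S : a ∈ˢ S) (out-a : ∣ out D S a ∣ ≤ K) (z∈ : z ∈ˢ out D S a) where

    A : DSet V
    A = A′ a z

    z∈S = proj₁ z∈

    A⊆S : A ⊆ˢ S
    A⊆S x (inj₁ ((p , _) , _)) = p
    A⊆S x (inj₂ refl) = a∈S

    z∉A : z ∉ˢ A
    z∉A (inj₁ (_ , n)) = n refl
    z∉A (inj₂ refl) = irr a (proj₂ z∈)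

    ∣A∣≤ : ∣ A ∣ ≤ ∣ out D S a ∣
    ∣A∣≤ = ≤-trans (∣∣-cover {P = out D S a - z} {⟨ a ⟩} {A} λ _ → id) (≤-trans (≤-reflexive
      (trans (cong (∣ out D S a - z ∣ +_) (∣⟨⟩∣ a)) (+-comm (∣ out D S a - z ∣) 1))) (≤-reflexive (∣-∣ (out D S a) z∈)))

    ≤∣A∣ : ∣ out D S a ∣ ≤ ∣ A ∣
    ≤∣A∣ = ≤-trans (≤-reflexive (trans (sym (∣-∣ (out D S a) z∈)) (sym (trans (cong (∣ out D S a - z ∣ +_) (∣⟨⟩∣ a)) (+-comm (∣ out D S a - z ∣) 1)))))
      (∣∣-disjoint {P = out D S a - z} {⟨ a ⟩} {A} (λ _ → inj₁) (λ _ → inj₂) λ { x ((_ , d) , _) refl → irr x d })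

    D′ : Dig V
    D′ = dset (λ (u , v) → (u ≢ z × v ≢ z × (u , v) ∈ˢ D) ⊎ ((u ≡ z × v ∈ˢ A) ⊎ (v ≡ z × u ∈ˢ A)))
      (λ (u , v) → (¬? (u ≟ z) ×-dec ¬? (v ≟ z) ×-dec mem? D (u , v)) ⊎-dec (((u ≟ z) ×-dec mem? A v) ⊎-dec ((v ≟ z) ×-dec mem? A u)))

    D′-irreflexive : Irreflexive D′
    D′-irreflexive v (inj₁ (_ , _ , d)) = irr v d
    D′-irreflexive v (inj₂ (inj₁ (refl , m))) = z∉A m
    D′-irreflexive v (inj₂ (inj₂ (refl , m))) = z∉A m

    D′-away : ∀ {u v} → u ≢ z → v ≢ z → (u , v) ∈ˢ D′ → (u , v) ∈ˢ D
    D′-away m n (inj₁ (_ , _ , d)) = d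
    D′-away m n (inj₂ (inj₁ (e , _))) = ⊥-elim (m e)
    D′-away m n (inj₂ (inj₂ (e , _))) = ⊥-elim (n e)

    arcs-copy : ∀ W → ∣ arcs D′ W ∣ ≤ ∣ arcs D (W - z) ∣ + (∣ A ∣ + ∣ A ∣)
    arcs-copy W = ≤-trans (∣∣-mono {P = arcs D′ W} {arcs D (W - z) ⊕ (A ⊕ A)} (inject f inj))
      (≤-reflexive (trans (∣⊕∣ (arcs D (W - z)) (A ⊕ A)) (cong (∣ arcs D (W - z) ∣ +_) (∣⊕∣ A A))))
      where
      f : ∀ x → x ∈ˢ arcs D′ W → Σ ((V × V) ⊎ (V ⊎ V)) (mem (arcs D (W - z) ⊕ (A ⊕ A)))
      f (u , v) (p , q , inj₁ (m , n , d)) = inj₁ (u , v) , (p , m) , (q , n) , d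
      f (u , v) (p , q , inj₂ (inj₁ (_ , m))) = inj₂ (inj₁ v) , m
      f (u , v) (p , q , inj₂ (inj₂ (_ , m))) = inj₂ (inj₂ u) , m
      inj : ∀ x y m n → proj₁ (f x m) ≡ proj₁ (f y n) → x ≡ y
      inj _ _ (_ , _ , inj₁ _) (_ , _ , inj₁ _) refl = refl
      inj _ _ (_ , _ , inj₁ _) (_ , _ , inj₂ (inj₁ _)) ()
      inj _ _ (_ , _ , inj₁ _) (_ , _ , inj₂ (inj₂ _)) ()
      inj _ _ (_ , _ , inj₂ (inj₁ _)) (_ , _ , inj₁ _) ()
      inj _ _ (_ , _ , inj₂ (inj₂ _)) (_ , _ , inj₁ _) ()
      inj _ _ (_ , _ , inj₂ (inj₁ (refl , _))) (_ , _ , inj₂ (inj₁ (refl , _))) refl = refl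
      inj _ _ (_ , _ , inj₂ (inj₂ (refl , _))) (_ , _ , inj₂ (inj₂ (refl , _))) refl = refl
      inj _ _ (_ , _ , inj₂ (inj₁ _)) (_ , _ , inj₂ (inj₂ _)) ()
      inj _ _ (_ , _ , inj₂ (inj₂ _)) (_ , _ , inj₂ (inj₁ _)) ()

    ∣A∣≤K : ∣ A ∣ ≤ K
    ∣A∣≤K = ≤-trans ∣A∣≤ out-a

    module Piece (W : DSet V) (W⊆ : W ⊆ˢ S) (critW : Crit K D′ W) where

      z∈W : z ∈ˢ W
      z∈W = decidable-stable (mem? W z) λ z∉W → removable crit z z∈S λ col → uncolourable critW
        (Col-mono (λ x m → W⊆ x m , λ { refl → z∉W m })
          (λ { (u , v) (p , q , d) → D′-away (λ { refl → z∉W p }) (λ { refl → z∉W q }) d }) col)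

      out-z⊆A : out D′ W z ⊆ˢ A
      out-z⊆A w (_ , inj₁ (n , _)) = ⊥-elim (n refl)
      out-z⊆A w (_ , inj₂ (inj₁ (_ , m))) = m
      out-z⊆A w (_ , inj₂ (inj₂ (refl , m))) = m

      -- In `D′` all out-neighbours of `z` lie in `A`, which has at most K elements, and a critical
      -- piece needs K of them.
      A⊆W : A ⊆ˢ W
      A⊆W x m = decidable-stable (mem? W x) λ x∉W →
        <⇒≱ (∣∣-strict {P = out D′ W z} {A} out-z⊆A m (x∉W ∘ proj₁)) (≤-trans ∣A∣≤K (outdegree D′-irreflexive critW z∈W))

      R : DSet V
      R = W - z

      -- Outdegree at least K on only K + 1 vertices forces all arcs.
      small-complete : ∣ R ∣ ≤ K → Complete A
      small-complete l u p v q n = D′-away (λ { refl → z∉A p }) (λ { refl → z∉A q }) (decidable-stable (mem? D′ (u , v)) λ no-arc →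
        <⇒≱ (≤-trans (s≤s (≤-trans (s≤s (∣∣-⊆ {P = out D′ W u} {W - u - v}
            λ w (m , d) → (m , λ { refl → D′-irreflexive w d }) , λ { refl → no-arc d }))
            (≤-reflexive (∣-∣ (W - u) {v} (A⊆W v q , n ∘ sym))))) (≤-trans (≤-reflexive (∣-∣ W (A⊆W u p))) (≤-trans (≤-reflexive (sym (∣-∣ W z∈W))) (s≤s l))))
          (s≤s (outdegree D′-irreflexive critW (A⊆W u p))))

      -- As N + M - 4K² = C, restoring `z` would leave W with potential above C; there is no slack.
      too-small : ∣ W ∣ < ∣ S ∣ → ¬ (suc N ≼ R)
      too-small l p = n≮0 (linear {x = 1} {0} 0 (+-mono-≤ p (≤-trans (ih D′-irreflexive W l critW)
          (+-monoˡ-≤ C (*-monoʳ-≤ (2 * K) (≤-trans (arcs-copy W) (+-monoʳ-≤ (∣ arcs D R ∣) (+-mono-≤ ∣A∣≤K ∣A∣≤K)))))))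
        (trans (identity κ (∣ arcs D R ∣) (∣ R ∣)) (cong (λ w → suc N + 2 * K * ∣ arcs D R ∣ + M * w) (∣-∣ W z∈W))))
        where
        identity : ∀ κ a r → let K = 2 + κ ; M = 2 * K * K + κ in
          1 + (M * r + (2 * K * (a + (K + K)) + (1 + K) * κ)) + 0 ≡ suc (2 * K * K + K * κ) + 2 * K * a + M * suc r
        identity = solve-∀

    module Recolour (T : DSet V) (T⊆A : T ⊆ˢ A) (clique : Clique T)
      (T-out : ∀ y → y ∈ˢ T → ∀ w → w ∈ˢ out D S y → w ≢ z → w ∈ˢ A) (few : ∣ in′ D S z ∖ T ∣ < K) where

      -- Some colour j is missing on the in-neighbours of z outside T. If y ∈ T has colour j, then y can take the colour of z instead.
      D′-uncolourable : ¬ Col K D′ S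
      D′-uncolourable (c , ranked r ok) with missing-colour c (in′ D S z ∖ T) few
      ... | j , missing = case ∃? (λ y → mem? T y ×-dec (c y ≟ j)) of λ
          { (no none) → uncolourable crit (_ , insert-source irr j base λ w m e → case mem? T w of λ
              { (yes t) → none (w , t , e) ; (no t) → missing w (m , t) e })
          ; (yes (y , y∈T , cy)) → uncolourable crit (_ , insert-source irr j (moved y∈T) λ w m e → case w ≟ y of λ
              { (yes refl) → apart y (T⊆A y y∈T) (trans cy (sym (trans (sym (≔-same c y (c z))) e)))
              ; (no n) → let e′ = trans (sym (≔-other c y (c z) n)) e in case mem? T w of λ
                { (yes t) → n (rainbow {T = T} base (λ x m → A⊆S x (T⊆A x m) , λ { refl → z∉A (T⊆A x m) }) clique t y∈T (trans e′ (sym cy)))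
                ; (no t) → missing w (m , t) e′ } }) }
        where
        apart : ∀ x → x ∈ˢ A → c x ≢ c z
        apart x m e = <-asym (ok x z (A⊆S x m) z∈S (inj₂ (inj₂ (refl , m))) e) (ok z x z∈S (A⊆S x m) (inj₂ (inj₁ (refl , m))) (sym e))
        base : IsCol D (S - z) c
        base = ranked r λ u v (p , m) (q , n) d → ok u v p q (inj₁ (m , n , d))
        moved : ∀ {y} → y ∈ˢ T → IsCol D (S - z) (c [ y ≔ c z ])
        moved {y} t = insert-sink {S = S - z} irr (c z) (ranked r λ u v ((p , m) , _) ((q , n) , _) d → ok u v p q (inj₁ (m , n , d)))
          λ w ((w∈S , n) , d) e → apart w (T-out y t w (w∈S , d) n) e

      -- The critical piece of `D′` spans `S`, unless it has K + 1 vertices and makes `A` complete.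
      -- The potential bound is a parameter since it comes from `Star` for a single tail and from
      -- `cluster-potential` for several.
      copy : (∀ R → R ⊆ˢ S → A ⊆ˢ R → z ∉ˢ R → suc K ≤ ∣ R ∣ → suc N ≼ R) → ¬ Complete A → (Crit K D′ S → ⊥) → ⊥
      copy potential ¬complete spanning = extract (∣ S ∣) S ≤-refl D′-uncolourable λ W W⊆ critW →
        let open Piece W W⊆ critW in
        [ (λ (x , x∈S , x∉W) → case ∣ R ∣ ≤? K of λ
            { (yes l) → ¬complete (small-complete l)
            ; (no g) → too-small (∣∣-strict {P = W} {S} W⊆ x∈S x∉W)
                (potential R (λ y (m , _) → W⊆ y m) (λ y m → A⊆W y m , λ { refl → z∉A m }) (λ (_ , n) → n refl) (≰⇒> g)) })
        , (λ S⊆W → spanning (critical (λ col → uncolourable critW (Col-mono {S′ = W} W⊆ (λ _ (_ , _ , d) → d) col))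
            λ v v∈S ¬col → removable critW v (S⊆W v v∈S) λ col → ¬col
              (Col-mono {S′ = S - v} (λ x (m , n) → S⊆W x m , n) (λ _ (_ , _ , d) → d) col))) ]′ (covers? W)

  -- Counting arcs, digons and triangles in a copy

  digonal : V → DSet V
  digonal v = out D S v ∩ in′ D S v

  ⊆? : ∀ (P Q : DSet V) → Dec (P ⊆ˢ Q)
  ⊆? P Q = map′ (λ none x p → decidable-stable (mem? Q x) λ q → none (x , p , q)) (λ s (x , p , q) → q (s x p))
    (¬? (∃? λ x → mem? P x ×-dec ¬? (mem? Q x)))

  -- Both degrees are at least K in a critical set, so such a vertex has exactly K neighbours, all
  -- joined to it by digons.
  Low : V → Set
  Low v = ∣ out D S v ∣ ≤ K × ∣ in′ D S v ∣ ≤ K × out D S v ⊆ˢ in′ D S v × in′ D S v ⊆ˢ out D S v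

  Low? : ∀ v → Dec (Low v)
  Low? v = (_ ≤? _) ×-dec (_ ≤? _) ×-dec ⊆? (out D S v) (in′ D S v) ×-dec ⊆? (in′ D S v) (out D S v)

  ∣digonal∣≤ : ∀ {v} → ∣ out D S v ∣ ≤ K → ∣ digonal v ∣ ≤ K
  ∣digonal∣≤ {v} l = ≤-trans (∣∣-⊆ {P = digonal v} {out D S v} λ _ → proj₁) l

  not-low : ∀ {v} → ∣ out D S v ∣ ≤ K → ∣ in′ D S v ∣ ≤ K → ¬ Low v → ∣ digonal v ∣ < K
  not-low {v} l m ¬low = case ∃? (λ w → mem? (out D S v) w ×-dec ¬? (mem? (in′ D S v) w)) of λ
    { (yes (w , p , q)) → ≤-trans (∣∣-strict {P = digonal v} {out D S v} (λ _ → proj₁) p (q ∘ proj₂)) l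
    ; (no none) → case ∃? (λ w → mem? (in′ D S v) w ×-dec ¬? (mem? (out D S v) w)) of λ
      { (yes (w , p , q)) → ≤-trans (∣∣-strict {P = digonal v} {in′ D S v} (λ _ → proj₂) p (q ∘ proj₁)) m
      ; (no none′) → ⊥-elim (¬low (l , m , (λ x p → decidable-stable (mem? (in′ D S v) x) λ q → none (x , p , q)) ,
          λ x p → decidable-stable (mem? (out D S v) x) λ q → none′ (x , p , q))) } }

  clique-upper : ∀ Y {a} (X : DSet V) → (∀ v → v ∈ˢ Y → v ∈ˢ digonal a → v ∈ˢ X) → Y ⊆ˢ S →
    ∣ digons D Y ∣ ≤ ∣ digons D (Y - a) ∣ + (∣ X ∣ + ∣ X ∣)
  clique-upper Y {a} X near Y⊆ = ≤-trans (∣∣-cover {P = digons D (Y - a)} {left ∪ right} {digons D Y} split)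
      (+-monoʳ-≤ (∣ digons D (Y - a) ∣) (≤-trans (∣∣-cover {P = left} {right} {left ∪ right} (λ _ → id)) (+-mono-≤
        (∣∣-mono {P = left} {X} (inject (λ (u , v) (_ , m) → v , m) λ { _ _ (refl , _) (refl , _) refl → refl }))
        (∣∣-mono {P = right} {X} (inject (λ (u , v) (_ , m) → u , m) λ { _ _ (refl , _) (refl , _) refl → refl })))))
    where
    left right : DSet (V × V)
    left = dset (λ (u , v) → u ≡ a × v ∈ˢ X) (λ (u , v) → (u ≟ a) ×-dec mem? X v)
    right = dset (λ (u , v) → v ≡ a × u ∈ˢ X) (λ (u , v) → (v ≟ a) ×-dec mem? X u)
    split : ∀ e → e ∈ˢ digons D Y → e ∈ˢ digons D (Y - a) ⊎ e ∈ˢ left ∪ right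
    split (u , v) (p , q , d , d′) = case u ≟ a of λ
      { (yes refl) → inj₂ (inj₁ (refl , near v q ((Y⊆ v q , d) , Y⊆ v q , d′)))
      ; (no n) → case v ≟ a of λ
        { (yes refl) → inj₂ (inj₂ (refl , near u p ((Y⊆ u p , d′) , Y⊆ u p , d)))
        ; (no m) → inj₁ ((p , n) , (q , m) , d , d′) } }

  clique-lower : ∀ X {a} → X ⊆ˢ digonal a → ∣ digons D X ∣ + (∣ X ∣ + ∣ X ∣) ≤ ∣ digons D (X ∪ ⟨ a ⟩) ∣
  clique-lower X {a} X⊆ = subst (_≤ ∣ digons D (X ∪ ⟨ a ⟩) ∣)
      (trans (∣⊕∣ (digons D X) (X ⊕ X)) (cong (∣ digons D X ∣ +_) (∣⊕∣ X X)))
      (∣∣-mono {P = digons D X ⊕ (X ⊕ X)} {digons D (X ∪ ⟨ a ⟩)} (⊕↪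
        (⊆↪ λ (u , v) (p , q , d) → inj₁ p , inj₁ q , d)
        (⊕↪ (inject (λ v m → (a , v) , inj₂ refl , inj₁ m , proj₂ (proj₁ (X⊆ v m)) , proj₂ (proj₂ (X⊆ v m))) λ { _ _ _ _ refl → refl })
            (inject (λ v m → (v , a) , inj₁ m , inj₂ refl , proj₂ (proj₂ (X⊆ v m)) , proj₂ (proj₁ (X⊆ v m))) λ { _ _ _ _ refl → refl })
            λ { x .a p q refl → a∉X p })
        λ { (u , v) (inj₁ w) (p , _) q refl → a∉X p ; (u , v) (inj₂ w) (_ , p , _) q refl → a∉X p }))
    where
    a∉X : a ∉ˢ X
    a∉X m = irr a (proj₂ (proj₁ (X⊆ a m)))

  -- A triple through `z` has `z` in one of three places, and its other two vertices form a digon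
  -- within the digon neighbourhood of `z`.
  triangles-upper : ∀ z → ∣ triangles D S ∣ ≤ ∣ triangles D (S - z) ∣ +
    (∣ digons D (digonal z) ∣ + (∣ digons D (digonal z) ∣ + ∣ digons D (digonal z) ∣))
  triangles-upper z = ≤-trans (∣∣-cover {P = triangles D (S - z)} {T₁ ∪ (T₂ ∪ T₃)} {triangles D S} split)
      (+-monoʳ-≤ (∣ triangles D (S - z) ∣) (≤-trans (∣∣-cover {P = T₁} {T₂ ∪ T₃} {T₁ ∪ (T₂ ∪ T₃)} (λ _ → id)) (+-mono-≤
        (∣∣-mono {P = T₁} {P} (inject (λ (u , v , w) (_ , m) → (v , w) , m) λ { _ _ (refl , _) (refl , _) refl → refl }))
        (≤-trans (∣∣-cover {P = T₂} {T₃} {T₂ ∪ T₃} (λ _ → id)) (+-mono-≤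
          (∣∣-mono {P = T₂} {P} (inject (λ (u , v , w) (_ , m) → (w , u) , m) λ { _ _ (refl , _) (refl , _) refl → refl }))
          (∣∣-mono {P = T₃} {P} (inject (λ (u , v , w) (_ , m) → (u , v) , m) λ { _ _ (refl , _) (refl , _) refl → refl })))))))
    where
    P : DSet (V × V)
    P = digons D (digonal z)
    T₁ T₂ T₃ : DSet (V × V × V)
    T₁ = dset (λ (u , v , w) → u ≡ z × (v , w) ∈ˢ P) (λ (u , v , w) → (u ≟ z) ×-dec mem? P (v , w))
    T₂ = dset (λ (u , v , w) → v ≡ z × (w , u) ∈ˢ P) (λ (u , v , w) → (v ≟ z) ×-dec mem? P (w , u))
    T₃ = dset (λ (u , v , w) → w ≡ z × (u , v) ∈ˢ P) (λ (u , v , w) → (w ≟ z) ×-dec mem? P (u , v))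
    near : ∀ v w → (z , v) ∈ˢ digons D S → (v , w) ∈ˢ digons D S → (w , z) ∈ˢ digons D S → (v , w) ∈ˢ P
    near v w (_ , p , a , b) (_ , _ , e) (q , _ , c , d) = ((p , a) , p , b) , ((q , d) , q , c) , e
    split : ∀ e → e ∈ˢ triangles D S → e ∈ˢ triangles D (S - z) ⊎ e ∈ˢ T₁ ∪ (T₂ ∪ T₃)
    split (u , v , w) (x , y , t) = case u ≟ z of λ
      { (yes refl) → inj₂ (inj₁ (refl , near v w x y t))
      ; (no l) → case v ≟ z of λ
        { (yes refl) → inj₂ (inj₂ (inj₁ (refl , near w u y t x)))
        ; (no m) → case w ≟ z of λ
          { (yes refl) → inj₂ (inj₂ (inj₂ (refl , near u v t x y)))
          ; (no n) → inj₁ (away u v l m x , away v w m n y , away w u n l t) } } }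
      where
      away : ∀ u v → u ≢ z → v ≢ z → (u , v) ∈ˢ digons D S → (u , v) ∈ˢ digons D (S - z)
      away u v l m (p , q , d) = (p , l) , (q , m) , d

  degrees : ∀ z → z ∈ˢ S → ∣ arcs D (S - z) ∣ + (∣ out D S z ∣ + ∣ in′ D S z ∣) ≤ ∣ arcs D S ∣
  degrees z z∈S = subst (_≤ ∣ arcs D S ∣) (trans (∣⊕∣ (arcs D (S - z)) (out D S z ⊕ in′ D S z))
      (cong (∣ arcs D (S - z) ∣ +_) (∣⊕∣ (out D S z) (in′ D S z))))
    (∣∣-mono {P = arcs D (S - z) ⊕ (out D S z ⊕ in′ D S z)} {arcs D S} (⊕↪
      (⊆↪ λ (u , v) ((p , _) , (q , _) , d) → p , q , d)
      (⊕↪ (inject (λ v (m , d) → (z , v) , z∈S , m , d) λ { _ _ _ _ refl → refl })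
          (inject (λ v (m , d) → (v , z) , m , z∈S , d) λ { _ _ _ _ refl → refl })
          λ { x .z (_ , d) _ refl → irr z d })
      λ { (u , v) (inj₁ w) ((_ , n) , _) q refl → n refl ; (u , v) (inj₂ w) (_ , (_ , n) , _) q refl → n refl }))

  digons-upper : ∀ z → ∣ digons D S ∣ ≤ ∣ digons D (S - z) ∣ + (∣ digonal z ∣ + ∣ digonal z ∣)
  digons-upper z = clique-upper S (digonal z) (λ _ _ m → m) (λ _ m → m)

  module Spanning {a z : V} (a∈S : a ∈ˢ S) (out-a : ∣ out D S a ∣ ≤ K) (z∈ : z ∈ˢ out D S a) where

    open Copy a∈S out-a z∈

    arcs-bound : ∣ arcs D′ S ∣ + (∣ out D S z ∣ + ∣ in′ D S z ∣) ≤ ∣ arcs D S ∣ + (K + K)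
    arcs-bound = ≤-trans (+-monoˡ-≤ _ (≤-trans (arcs-copy S) (+-monoʳ-≤ (∣ arcs D (S - z) ∣) (+-mono-≤ ∣A∣≤K ∣A∣≤K))))
      (≤-trans (≤-reflexive (swap-sum (∣ arcs D (S - z) ∣) (K + K) _)) (+-monoˡ-≤ (K + K) (degrees z z∈S)))
      where
      swap-sum : ∀ x y z → x + y + z ≡ x + z + y
      swap-sum = solve-∀

    arcs≤ : ∣ arcs D′ S ∣ ≤ ∣ arcs D S ∣
    arcs≤ = +-cancelʳ-≤ (K + K) _ _ (≤-trans (+-monoʳ-≤ (∣ arcs D′ S ∣) (+-mono-≤ (outdegree irr crit z∈S) (indegree irr crit z∈S))) arcs-bound)

    arcs< : K + K < ∣ out D S z ∣ + ∣ in′ D S z ∣ → ∣ arcs D′ S ∣ < ∣ arcs D S ∣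
    arcs< l = +-cancelʳ-≤ (K + K) _ _ (≤-trans (≤-reflexive (sym (+-suc (∣ arcs D′ S ∣) (K + K)))) (≤-trans (+-monoʳ-≤ (∣ arcs D′ S ∣) l) arcs-bound))

    K≤A : K ≤ ∣ A ∣
    K≤A = ≤-trans (outdegree irr crit a∈S) ≤∣A∣

    digons-lower : ∣ digons D (S - z) ∣ + (∣ A ∣ + ∣ A ∣) ≤ ∣ digons D′ S ∣
    digons-lower = subst (_≤ ∣ digons D′ S ∣)
      (trans (∣⊕∣ (digons D (S - z)) (A ⊕ A)) (cong (∣ digons D (S - z) ∣ +_) (∣⊕∣ A A)))
      (∣∣-mono {P = digons D (S - z) ⊕ (A ⊕ A)} {digons D′ S} (⊕↪
        (⊆↪ λ (u , v) ((p , m) , (q , n) , d , d′) → p , q , inj₁ (m , n , d) , inj₁ (n , m , d′))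
        (⊕↪ (inject (λ v m → (z , v) , z∈S , A⊆S v m , inj₂ (inj₁ (refl , m)) , inj₂ (inj₂ (refl , m))) λ { _ _ _ _ refl → refl })
            (inject (λ v m → (v , z) , A⊆S v m , z∈S , inj₂ (inj₂ (refl , m)) , inj₂ (inj₁ (refl , m))) λ { _ _ _ _ refl → refl })
            λ { x .z p q refl → z∉A p })
        λ { (u , v) (inj₁ w) ((_ , n) , _) q refl → n refl ; (u , v) (inj₂ w) (_ , (_ , n) , _) q refl → n refl }))

    digons≤ : ∣ digonal z ∣ ≤ K → ∣ digons D S ∣ ≤ ∣ digons D′ S ∣
    digons≤ l = ≤-trans (≤-trans (digons-upper z) (+-monoʳ-≤ (∣ digons D (S - z) ∣) (+-mono-≤ (≤-trans l K≤A) (≤-trans l K≤A)))) digons-lower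

    digons< : ∣ digonal z ∣ < K → ∣ digons D S ∣ < ∣ digons D′ S ∣
    digons< l = ≤-trans (≤-<-trans (digons-upper z) (+-monoʳ-< (∣ digons D (S - z) ∣) (+-mono-< (≤-trans l K≤A) (≤-trans l K≤A)))) digons-lower

    triangles-lower : ∣ triangles D (S - z) ∣ + (∣ digons D A ∣ + (∣ digons D A ∣ + ∣ digons D A ∣)) ≤ ∣ triangles D′ S ∣
    triangles-lower = subst (_≤ ∣ triangles D′ S ∣)
      (trans (∣⊕∣ (triangles D (S - z)) (P ⊕ (P ⊕ P))) (cong (∣ triangles D (S - z) ∣ +_)
        (trans (∣⊕∣ P (P ⊕ P)) (cong (∣ P ∣ +_) (∣⊕∣ P P)))))
      (∣∣-mono {P = triangles D (S - z) ⊕ (P ⊕ (P ⊕ P))} {triangles D′ S} (⊕↪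
        (⊆↪ λ (u , v , w) (x , y , t) → old u v x , old v w y , old w u t)
        (⊕↪ (inject (λ (v , w) m → (z , v , w) , spoke v (proj₁ m) , inner v w m , ekops w (proj₁ (proj₂ m))) λ { _ _ _ _ refl → refl })
          (⊕↪ (inject (λ (v , w) m → (w , z , v) , ekops w (proj₁ (proj₂ m)) , spoke v (proj₁ m) , inner v w m) λ { _ _ _ _ refl → refl })
              (inject (λ (v , w) m → (v , w , z) , inner v w m , ekops w (proj₁ (proj₂ m)) , spoke v (proj₁ m)) λ { _ _ _ _ refl → refl })
              λ { _ _ (p , _) _ refl → z∉A p })
          λ { _ (inj₁ _) (_ , p , _) (_ , q , _) refl → z∉A q ; _ (inj₂ _) (p , _) (q , _) refl → z∉A q })
        λ { (u , v , w) (inj₁ _) (((_ , n) , _) , _) _ refl → n refl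
          ; (u , v , w) (inj₂ (inj₁ _)) ((_ , (_ , n) , _) , _) _ refl → n refl
          ; (u , v , w) (inj₂ (inj₂ _)) (_ , (_ , (_ , n) , _) , _) _ refl → n refl }))
      where
      P : DSet (V × V)
      P = digons D A
      old : ∀ u v → (u , v) ∈ˢ digons D (S - z) → (u , v) ∈ˢ digons D′ S
      old u v ((p , m) , (q , n) , d , d′) = p , q , inj₁ (m , n , d) , inj₁ (n , m , d′)
      spoke : ∀ v → v ∈ˢ A → (z , v) ∈ˢ digons D′ S
      spoke v m = z∈S , A⊆S v m , inj₂ (inj₁ (refl , m)) , inj₂ (inj₂ (refl , m))
      ekops : ∀ v → v ∈ˢ A → (v , z) ∈ˢ digons D′ S
      ekops v m = A⊆S v m , z∈S , inj₂ (inj₂ (refl , m)) , inj₂ (inj₁ (refl , m))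
      inner : ∀ v w → (v , w) ∈ˢ P → (v , w) ∈ˢ digons D′ S
      inner v w (p , q , d , d′) = A⊆S v p , A⊆S w q , inj₁ ((λ { refl → z∉A p }) , (λ { refl → z∉A q }) , d) ,
        inj₁ ((λ { refl → z∉A q }) , (λ { refl → z∉A p }) , d′)

    triangles< : ∣ digons D (digonal z) ∣ < ∣ digons D A ∣ → ∣ triangles D S ∣ < ∣ triangles D′ S ∣
    triangles< l = ≤-trans (≤-<-trans (triangles-upper z) (+-monoʳ-< (∣ triangles D (S - z) ∣) (+-mono-< l (+-mono-< l l)))) triangles-lower

  module Tight {a z : V} (a∈S : a ∈ˢ S) (out-a : ∣ out D S a ∣ ≤ K) (z∈ : z ∈ˢ out D S a) (in-z : ∣ in′ D S z ∣ ≤ K) where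

    open Copy a∈S out-a z∈ public
    open Spanning a∈S out-a z∈ public

    tight-copy : ¬ Complete A → (Crit K D′ S → ⊥) → ⊥
    tight-copy = Recolour.copy ⟨ a ⟩ (λ _ → inj₂) (λ { _ refl _ refl n → ⊥-elim (n refl) }) (λ { _ refl w m n → inj₁ (m , n) })
      (≤-trans (∣∣-strict {P = in′ D S z ∖ ⟨ a ⟩} {in′ D S z} (λ _ → proj₁) (a∈S , proj₂ z∈) λ (_ , n) → n refl) in-z)
      λ R R⊆ A⊆R z∉R → Star.large-potential a∈S z∈S (proj₂ z∈) in-z 1≤κ R R⊆ (A⊆R a (inj₂ refl)) z∉R

    -- Otherwise the copy saves an arc, if `z` has outdegree above K, or else gains a digon.
    low-head : ¬ Complete A → Low z
    low-head ¬complete = decidable-stable (Low? z) λ ¬low → tight-copy ¬complete λ c →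
      best D′ D′-irreflexive c (case ∣ out D S z ∣ ≤? K of λ
        { (no g) → inj₁ (arcs< (+-mono-<-≤ (≰⇒> g) (indegree irr crit z∈S)))
        ; (yes l) → inj₂ (arcs≤ , inj₁ (digons< (not-low l in-z ¬low))) })

    no-gain : ¬ Complete A → ∣ out D S z ∣ ≤ K → ∣ digons D (digonal z) ∣ < ∣ digons D A ∣ → ⊥
    no-gain ¬complete l g = tight-copy ¬complete λ c →
      best D′ D′-irreflexive c (inj₂ (arcs≤ , inj₂ (digons≤ (∣digonal∣≤ l) , triangles< g)))

  -- The copy would save an arc because the indegree of `z` exceeds K. The upper bound on that
  -- indegree leaves fewer than K in-neighbours outside `T`, as recolouring and `cluster-potential`
  -- need.
  cluster-head : ∀ {a z} {T : DSet V} → a ∈ˢ S → ∣ out D S a ∣ ≤ K → z ∈ˢ out D S a → T ⊆ˢ A′ a z → Clique T →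
    (∀ y → y ∈ˢ T → ∀ w → w ∈ˢ out D S y → w ≢ z → w ∈ˢ A′ a z) → a ∈ˢ T → (∀ y → y ∈ˢ T → (y , z) ∈ˢ D) →
    K < ∣ in′ D S z ∣ → 2 + ∣ in′ D S z ∣ ≤ K + ∣ T ∣ → Complete (A′ a z)
  cluster-head {a} {z} {T} a∈S out-a z∈ T⊆ clique T-out a∈T T→z in-z few = decidable-stable (Complete? (A′ a z)) λ ¬complete →
    Recolour.copy T T⊆ clique T-out small
      (λ R R⊆ A⊆R z∉R large → cluster-potential {T = T} (proj₁ z∈) z∉R R⊆ large (λ y m → A⊆R y (T⊆ y m)) clique T→z a∈T few)
      ¬complete λ c → best D′ D′-irreflexive c (inj₁ (arcs< (+-mono-≤-< (outdegree irr crit z∈S) in-z)))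
    where
    open Copy a∈S out-a z∈
    open Spanning a∈S out-a z∈
    small : ∣ in′ D S z ∖ T ∣ < K
    small = ≤-trans (n≤1+n _) (+-cancelˡ-≤ (∣ T ∣) _ _ (≤-trans (≤-reflexive (trans (+-suc (∣ T ∣) _) (cong suc (+-suc (∣ T ∣) _))))
      (≤-trans (s≤s (s≤s (∣∣-disjoint {P = T} {in′ D S z ∖ T} {in′ D S z} (λ y m → A⊆S y (T⊆ y m) , T→z y m) (λ _ → proj₁) λ _ m (_ , n) → n m)))
        (≤-trans few (≤-reflexive (+-comm K (∣ T ∣)))))))

  -- Twins

  closed : V → DSet V
  closed a = out D S a ∪ ⟨ a ⟩

  Twin : V → V → Set
  Twin a y = Low a × Low y × closed a ⊆ˢ closed y × closed y ⊆ˢ closed a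

  Twin? : ∀ a y → Dec (Twin a y)
  Twin? a y = Low? a ×-dec Low? y ×-dec ⊆? (closed a) (closed y) ×-dec ⊆? (closed y) (closed a)

  low-in : ∀ {v w} → Low v → w ∈ˢ S → (w , v) ∈ˢ D → (v , w) ∈ˢ D
  low-in (_ , _ , _ , s) w∈S d = proj₂ (s _ (w∈S , d))

  low-out : ∀ {v w} → Low v → w ∈ˢ S → (v , w) ∈ˢ D → (w , v) ∈ˢ D
  low-out (_ , _ , s , _) w∈S d = proj₂ (s _ (w∈S , d))

  ∣out∣≡K : ∀ {v} → v ∈ˢ S → ∣ out D S v ∣ ≤ K → ∣ out D S v ∣ ≡ K
  ∣out∣≡K v∈S l = ≤-antisym l (outdegree irr crit v∈S)

  ∣closed∣ : ∀ {v} → v ∈ˢ S → ∣ out D S v ∣ ≤ K → ∣ closed v ∣ ≡ suc K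
  ∣closed∣ {v} v∈S l = trans (trans (sym (∣-∣ (closed v) (inj₂ refl))) (cong suc (≤-antisym
      (∣∣-⊆ {P = closed v - v} {out D S v} λ { _ (inj₁ m , _) → m ; _ (inj₂ e , n) → ⊥-elim (n e) })
      (∣∣-⊆ {P = out D S v} {closed v - v} λ { x m → inj₁ m , λ { refl → irr x (proj₂ m) } }))))
    (cong suc (∣out∣≡K v∈S l))

  closed⊆S : ∀ {v} → v ∈ˢ S → closed v ⊆ˢ S
  closed⊆S v∈S _ (inj₁ (m , _)) = m
  closed⊆S v∈S _ (inj₂ refl) = v∈S

  private
    -- With X and Y as below, the digons within the neighbourhood of `z` number at most those in Y
    -- plus 2|X ∩ Y|, and `A′ a z` has at least those in X plus 2|X|; copying would increase the
    -- triangles.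
    no-better-twin : ∀ {a z} → a ∈ˢ S → Low a → Low z → z ∈ˢ out D S a → ¬ Complete (A′ a z) →
      ∣ (out D S a - z) ∩ (out D S z - a) ∣ < ∣ out D S a - z ∣ → ∣ digons D (out D S z - a) ∣ ≤ ∣ digons D (out D S a - z) ∣ → ⊥
    no-better-twin {a} {z} a∈S low-a low-z z∈ ¬complete shared l =
      Tight.no-gain a∈S (proj₁ low-a) z∈ (proj₁ (proj₂ low-z)) ¬complete (proj₁ low-z)
        (≤-trans (≤-<-trans (≤-trans (clique-upper (digonal z) {a} (X ∩ Y) near (λ _ m → proj₁ (proj₁ m)))
            (+-monoˡ-≤ _ (≤-trans (∣∣-⊆ {P = digons D (digonal z - a)} {digons D Y}
              λ (u , v) (((p , _) , m) , ((q , _) , n) , d) → (p , m) , (q , n) , d) l)))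
          (+-monoʳ-< (∣ digons D X ∣) (+-mono-< shared shared)))
          (clique-lower X λ v ((m , d) , _) → (m , d) , m , low-out low-a m d))
      where
      X Y : DSet V
      X = out D S a - z
      Y = out D S z - a
      near : ∀ v → v ∈ˢ digonal z → v ∈ˢ digonal a → v ∈ˢ X ∩ Y
      near v (m , _) (n , _) = (n , λ { refl → irr v (proj₂ m) }) , (m , λ { refl → irr v (proj₂ n) })

  -- If the neighbourhoods differ, the vertex whose remaining neighbours span fewer digons is
  -- replaced by a twin of the other. Either direction may occur, so both completeness exceptions
  -- have to be excluded.
  low-neighbours-twin : ∀ {a z} → a ∈ˢ S → Low a → Low z → z ∈ˢ out D S a → ¬ Complete (A′ a z) → ¬ Complete (A′ z a) →
    closed a ⊆ˢ closed z
  low-neighbours-twin {a} {z} a∈S low-a low-z z∈@(z∈S , a→z) ¬α ¬β x x∈ = decidable-stable (mem? (closed z) x) λ x∉ →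
    let X = out D S a - z
        Y = out D S z - a
        a∈ = a∈S , low-in low-z a∈S a→z
        x∈X = x-in-X x x∈ x∉ a∈
        shared = ∣∣-strict {P = X ∩ Y} {X} (λ _ → proj₁) x∈X (λ (_ , m , _) → x∉ (inj₁ m))
        same : ∣ X ∣ ≡ ∣ Y ∣
        same = suc-injective (trans (∣-∣ (out D S a) z∈) (trans (∣out∣≡K a∈S (proj₁ low-a))
          (sym (trans (∣-∣ (out D S z) a∈) (∣out∣≡K z∈S (proj₁ low-z))))))
    in [ no-better-twin z∈S low-z low-a a∈ ¬β (≤-trans (s≤s (∣∣-⊆ {P = Y ∩ X} {X ∩ Y} λ _ (p , q) → q , p)) (subst (∣ X ∩ Y ∣ <_) same shared))
       , no-better-twin a∈S low-a low-z z∈ ¬α shared ]′ (≤-total (∣ digons D X ∣) (∣ digons D Y ∣))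
    where
    x-in-X : ∀ x → x ∈ˢ closed a → x ∉ˢ closed z → a ∈ˢ out D S z → x ∈ˢ out D S a - z
    x-in-X x (inj₁ m) x∉ _ = m , λ e → x∉ (inj₂ e)
    x-in-X x (inj₂ refl) x∉ a∈ = ⊥-elim (x∉ (inj₁ a∈))

-- Combining a digraph with its reversal

module TwoSided {κ : ℕ} {V : Set} {{_ : Finite V}} {D : Dig V} {S : DSet V} (G : Extremal κ D S) where

  open OneSided G public
  private module Rev = OneSided (rev-Extremal G)

  closed-A′ : ∀ {a z x} → x ∈ˢ closed a → x ≢ z → x ∈ˢ A′ a z
  closed-A′ (inj₁ m) n = inj₁ (m , n)
  closed-A′ (inj₂ e) _ = inj₂ e

  -- Two different choices would leave the K + 1 vertices of `closed a` complete up to the digon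
  -- between `y` and `z`.
  complete-A′-unique : ∀ {a y z} → a ∈ˢ S → ∣ out D S a ∣ ≤ K → Complete (A′ a y) → Complete (A′ a z) → y ≡ z
  complete-A′-unique {a} {y} {z} a∈S out-a cy cz = decidable-stable (y ≟ z) λ y≢z →
    near-complete (closed a) (closed⊆S a∈S) (∣closed∣ a∈S out-a) y z λ u p v q n o → case (u ≟ y) of λ
      { (no l) → case (v ≟ y) of λ
        { (no m) → cy u (closed-A′ p l) v (closed-A′ q m) n
        ; (yes refl) → cz u (closed-A′ p λ { refl → o (inj₂ (refl , refl)) }) v (closed-A′ q y≢z) n }
      ; (yes refl) → cz u (closed-A′ p y≢z) v (closed-A′ q λ { refl → o (inj₁ (refl , refl)) }) n }

  -- This is A′ p a of the reversed digraph.
  B′ : V → V → DSet V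
  B′ a p = (in′ D S p - a) ∪ ⟨ p ⟩

  low-closed-B′ : ∀ {a p x} → Low p → x ∈ˢ closed p → x ≢ a → x ∈ˢ B′ a p
  low-closed-B′ low (inj₁ (m , d)) n = inj₁ ((m , low-out low m d) , n)
  low-closed-B′ low (inj₂ e) _ = inj₂ e

  low-A′-B′ : ∀ {a p} → Low p → A′ p a ⊆ˢ B′ a p
  low-A′-B′ low _ (inj₁ ((m , d) , n)) = inj₁ ((m , low-out low m d) , n)
  low-A′-B′ low _ (inj₂ e) = inj₂ e

  low-B′-A′ : ∀ {a p} → Low p → B′ a p ⊆ˢ A′ p a
  low-B′-A′ low _ (inj₁ ((m , d) , n)) = inj₁ ((m , low-in low m d) , n)
  low-B′-A′ low _ (inj₂ e) = inj₂ e

  Complete-⊆ : ∀ {P Q} → P ⊆ˢ Q → Complete Q → Complete P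
  Complete-⊆ s complete u p v q = complete u (s u p) v (s v q)

  low-tail : ∀ {a p} → a ∈ˢ S → ∣ out D S a ∣ ≤ K → p ∈ˢ out D S a → ∣ in′ D S p ∣ ≤ K → ¬ Complete (B′ a p) → Low a
  low-tail {a} {p} a∈S out-a (p∈S , d) in-p ¬complete =
    let (x , y , s , t) = Rev.Tight.low-head p∈S in-p (a∈S , d) out-a (λ c → ¬complete λ u m v n l → c v n u m (l ∘ sym)) in
    y , x , t , s

  -- The head is low by copying in `D`, the tail by copying in the reversal; low neighbours are
  -- twins.
  bad-arc-twin : ∀ {a p} → a ∈ˢ S → ∣ out D S a ∣ ≤ K → p ∈ˢ out D S a → ∣ in′ D S p ∣ ≤ K →
    ¬ Complete (A′ a p) → ¬ Complete (B′ a p) → Twin a p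
  bad-arc-twin {a} {p} a∈S out-a p∈ in-p ¬α ¬β =
    low-a , low-p , low-neighbours-twin a∈S low-a low-p p∈ ¬α ¬β′ ,
      low-neighbours-twin (proj₁ p∈) low-p low-a (a∈S , low-in low-p a∈S (proj₂ p∈)) ¬β′ ¬α
    where
    low-p = Tight.low-head a∈S out-a p∈ in-p ¬α
    low-a = low-tail a∈S out-a p∈ in-p ¬β
    ¬β′ : ¬ Complete (A′ p a)
    ¬β′ c = ¬β (Complete-⊆ {B′ a p} {A′ p a} (low-B′-A′ low-p) c)

  -- With `a`, `p` and `p′` deleted, digons from `u` to the other κ vertices of the complete set
  -- preserve non-colourability. A critical piece of the result, enlarged by the whole complete set,
  -- avoids `a` but contains `p`, and its potential is too small for that.
  module Special {a p p′ : V} (a∈S : a ∈ˢ S) (out-a : ∣ out D S a ∣ ≤ K) (p∈ : p ∈ˢ out D S a) (twin : Twin p p′)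
    (p≢p′ : p ≢ p′) (a≢p′ : a ≢ p′) (complete : Complete (closed p - a)) {u : V} (u∈ : u ∈ˢ out D S a) (u∉ : u ∉ˢ closed p) where

    low-p : Low p
    low-p = proj₁ twin
    low-p′ : Low p′
    low-p′ = proj₁ (proj₂ twin)
    p∈S = proj₁ p∈
    a≢p : a ≢ p
    a≢p refl = irr a (proj₂ p∈)

    p′∈ : p′ ∈ˢ closed p
    p′∈ = proj₂ (proj₂ (proj₂ twin)) p′ (inj₂ refl)
    p′∈S : p′ ∈ˢ S
    p′∈S = closed⊆S p∈S p′ p′∈
    a∈p : a ∈ˢ out D S p
    a∈p = a∈S , low-in low-p a∈S (proj₂ p∈)
    a∈p′ : a ∈ˢ out D S p′
    a∈p′ = [ id , (λ e → ⊥-elim (a≢p′ e)) ]′ (proj₁ (proj₂ (proj₂ twin)) a (inj₁ a∈p))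
    p′∈a : p′ ∈ˢ out D S a
    p′∈a = p′∈S , low-out low-p′ a∈S (proj₂ a∈p′)

    Q Q₁ : DSet V
    Q = closed p - a
    Q₁ = Q - p - p′

    ∣Q∣ : ∣ Q ∣ ≡ K
    ∣Q∣ = suc-injective (trans (∣-∣ (closed p) (inj₁ a∈p)) (∣closed∣ p∈S (proj₁ low-p)))

    ∣Q₁∣ : ∣ Q₁ ∣ ≡ κ
    ∣Q₁∣ = suc-injective (trans (∣-∣ (Q - p) ((p′∈ , a≢p′ ∘ sym) , p≢p′ ∘ sym))
      (suc-injective (trans (∣-∣ Q (inj₂ refl , a≢p ∘ sym)) ∣Q∣)))

    Q₁-cases : ∀ {x} → x ∈ˢ closed p → x ≡ a ⊎ x ≡ p ⊎ x ≡ p′ ⊎ x ∈ˢ Q₁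
    Q₁-cases {x} m = case x ≟ a of λ
      { (yes e) → inj₁ e
      ; (no l) → case x ≟ p of λ
        { (yes e) → inj₂ (inj₁ e)
        ; (no n) → case x ≟ p′ of λ { (yes e) → inj₂ (inj₂ (inj₁ e)) ; (no o) → inj₂ (inj₂ (inj₂ (((m , l) , n) , o))) } } }

    u∉Q₁ : u ∉ˢ Q₁
    u∉Q₁ (((m , _) , _) , _) = u∉ m

    u≢ : ∀ {x} → x ∈ˢ closed p → u ≢ x
    u≢ m refl = u∉ m

    S₁ S₂ S₃ : DSet V
    S₁ = S - p′
    S₂ = S₁ - p
    S₃ = S₂ - a

    S₃⊆ : S₃ ⊆ˢ S
    S₃⊆ _ (((m , _) , _) , _) = m

    u∈S₃ : u ∈ˢ S₃
    u∈S₃ = ((proj₁ u∈ , u≢ p′∈) , u≢ (inj₂ refl)) , u≢ (inj₁ a∈p)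

    Q₁⊆S₃ : Q₁ ⊆ˢ S₃
    Q₁⊆S₃ x (((m , l) , n) , o) = ((closed⊆S p∈S x m , o) , n) , l

    D★ : Dig V
    D★ = dset (λ (x , y) → (x , y) ∈ˢ D ⊎ ((x ≡ u × y ∈ˢ Q₁) ⊎ (y ≡ u × x ∈ˢ Q₁)))
      (λ (x , y) → mem? D (x , y) ⊎-dec (((x ≟ u) ×-dec mem? Q₁ y) ⊎-dec ((y ≟ u) ×-dec mem? Q₁ x)))

    D★-irreflexive : Irreflexive D★
    D★-irreflexive v (inj₁ d) = irr v d
    D★-irreflexive v (inj₂ (inj₁ (refl , m))) = u∉Q₁ m
    D★-irreflexive v (inj₂ (inj₂ (refl , m))) = u∉Q₁ m

    -- In a colouring, u avoids the colours of Q₁, so some colour of Q₁ is free for a; then p and p′ can be coloured greedily.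
    D★-uncolourable : ¬ Col K D★ S₃
    D★-uncolourable (c , ranked r ok) = case ∃? (λ w → mem? Q₁ w ×-dec ¬? (∃? λ v → mem? rest v ×-dec (c v ≟ c w))) of λ
        { (yes (w , w∈ , free)) → extend w w∈ (λ v m e → free (v , m , e))
        ; (no none) → <⇒≱ rest-small (≤-trans (≤-reflexive (sym ∣Q₁∣)) (∣∣-mono {P = Q₁} {rest} (inject
            (λ w m → proj₁ (match none w m) , proj₁ (proj₂ (match none w m)))
            λ x y m n e → separate m n (trans (sym (proj₂ (proj₂ (match none x m)))) (trans (cong c e) (proj₂ (proj₂ (match none y n)))))))) }
      where
      rest : DSet V
      rest = out D S a - p - p′ - u
      rest-small : ∣ rest ∣ < κ
      rest-small = ≤-pred (≤-pred (≤-trans (≤-reflexive (trans (cong (λ n → suc (suc n)) (∣-∣ (out D S a - p - p′) ((u∈ , u≢ (inj₂ refl)) , u≢ p′∈)))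
        (trans (cong suc (∣-∣ (out D S a - p) (p′∈a , p≢p′ ∘ sym))) (∣-∣ (out D S a) p∈)))) out-a))
      match : ¬ (∃ λ w → w ∈ˢ Q₁ × ¬ (∃ λ v → v ∈ˢ rest × c v ≡ c w)) → ∀ w → w ∈ˢ Q₁ → ∃ λ v → v ∈ˢ rest × c v ≡ c w
      match none w m = decidable-stable (∃? λ v → mem? rest v ×-dec (c v ≟ c w)) λ free → none (w , m , free)
      separate : ∀ {x y} → x ∈ˢ Q₁ → y ∈ˢ Q₁ → c x ≡ c y → x ≡ y
      separate {x} {y} m n e = decidable-stable (x ≟ y) λ x≢y →
        <-asym (ok x y (Q₁⊆S₃ x m) (Q₁⊆S₃ y n) (inj₁ (complete x (proj₁ (proj₁ m)) y (proj₁ (proj₁ n)) x≢y)) e)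
          (ok y x (Q₁⊆S₃ y n) (Q₁⊆S₃ x m) (inj₁ (complete y (proj₁ (proj₁ n)) x (proj₁ (proj₁ m)) (x≢y ∘ sym))) (sym e))
      apart : ∀ {w} → w ∈ˢ Q₁ → c u ≢ c w
      apart {w} m e = <-asym (ok u w u∈S₃ (Q₁⊆S₃ w m) (inj₂ (inj₁ (refl , m))) e)
        (ok w u (Q₁⊆S₃ w m) u∈S₃ (inj₂ (inj₂ (refl , m))) (sym e))
      extend : ∀ w → w ∈ˢ Q₁ → (∀ v → v ∈ˢ rest → c v ≢ c w) → ⊥
      extend w w∈ free = uncolourable crit (_ , insert-sink irr j′ step₂ out-p′)
        where
        c₁ = c [ a ≔ c w ]
        j-missing = missing-colour c Q₁ (≤-trans (s≤s (≤-reflexive ∣Q₁∣)) (n≤1+n _))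
        j = proj₁ j-missing
        c₂ = c₁ [ p ≔ j ]
        j′-missing = missing-colour c₂ (Q₁ ∪ ⟨ p ⟩) (s≤s (≤-trans (∣∣-cover {P = Q₁} {⟨ p ⟩} {Q₁ ∪ ⟨ p ⟩} (λ _ → id))
          (≤-reflexive (trans (cong₂ _+_ ∣Q₁∣ (∣⟨⟩∣ p)) (+-comm κ 1)))))
        j′ = proj₁ j′-missing
        c₁-other : ∀ {x} → x ∈ˢ Q₁ → c₁ x ≡ c x
        c₁-other (((_ , l) , _) , _) = ≔-other c a (c w) l
        c₂-other : ∀ {x} → x ∈ˢ Q₁ → c₂ x ≡ c x
        c₂-other m@((_ , n) , _) = trans (≔-other c₁ p j n) (c₁-other m)
        step₁ : IsCol D S₂ c₁
        step₁ = insert-sink {S = S₂} irr (c w) (ranked r λ x y m n d → ok x y m n (inj₁ d)) λ x (((m , n) , o) , d) → case x ≟ u of λ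
          { (yes refl) → apart w∈ ; (no l) → free x ((((m , d) , o) , n) , l) }
        step₂ : IsCol D S₁ c₂
        step₂ = insert-sink {S = S₁} irr j step₁ λ x ((m , n) , d) e → case Q₁-cases (inj₁ (m , d)) of λ
          { (inj₁ refl) → proj₂ j-missing w w∈ (trans (sym (≔-same c a (c w))) e)
          ; (inj₂ (inj₁ refl)) → irr x d
          ; (inj₂ (inj₂ (inj₁ l))) → n l
          ; (inj₂ (inj₂ (inj₂ q))) → proj₂ j-missing x q (trans (sym (c₁-other q)) e) }
        out-p′ : ∀ x → x ∈ˢ out D S p′ → c₂ x ≢ j′
        out-p′ x m e = case Q₁-cases (proj₂ (proj₂ (proj₂ twin)) x (inj₁ m)) of λ
          { (inj₁ refl) → proj₂ j′-missing w (inj₁ w∈) (trans (c₂-other w∈)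
              (trans (sym (≔-same c a (c w))) (trans (sym (≔-other c₁ p j a≢p)) e)))
          ; (inj₂ (inj₁ refl)) → proj₂ j′-missing x (inj₂ refl) e
          ; (inj₂ (inj₂ (inj₁ refl))) → irr x (proj₂ m)
          ; (inj₂ (inj₂ (inj₂ q))) → proj₂ j′-missing x (inj₁ q) e }

    module Piece (W : DSet V) (W⊆ : W ⊆ˢ S₃) (critW : Crit K D★ W) where

      X : DSet V
      X = Q₁ ∩ W

      a∉W : ∀ {x} → x ∈ˢ W → x ≢ a
      a∉W m refl = proj₂ (W⊆ a m) refl

      not-in-D : ¬ (∀ x y → x ∈ˢ W → y ∈ˢ W → (x , y) ∈ˢ D★ → (x , y) ∈ˢ D)
      not-in-D old = removable crit a a∈S λ col → uncolourable critW
        (Col-mono {S′ = W} (λ x m → S₃⊆ x (W⊆ x m) , a∉W m) (λ (x , y) (m , n , d) → old x y m n d) col)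

      1≤X : 1 ≤ ∣ X ∣
      1≤X = decidable-stable (1 ≤? ∣ X ∣) λ none → not-in-D λ
        { x y m n (inj₁ d) → d
        ; x y m n (inj₂ (inj₁ (_ , q))) → ⊥-elim (none (1≤size X (q , n)))
        ; x y m n (inj₂ (inj₂ (_ , q))) → ⊥-elim (none (1≤size X (q , m))) }

      arcs★ : ∣ arcs D★ W ∣ ≤ ∣ arcs D W ∣ + (∣ X ∣ + ∣ X ∣)
      arcs★ = ≤-trans (∣∣-cover {P = arcs D W} {left ∪ right} {arcs D★ W} split)
          (+-monoʳ-≤ (∣ arcs D W ∣) (≤-trans (∣∣-cover {P = left} {right} {left ∪ right} (λ _ → id)) (+-mono-≤
            (∣∣-mono {P = left} {X} (inject (λ (_ , y) (_ , m) → y , m) λ { _ _ (refl , _) (refl , _) refl → refl }))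
            (∣∣-mono {P = right} {X} (inject (λ (x , _) (_ , m) → x , m) λ { _ _ (refl , _) (refl , _) refl → refl })))))
        where
        left right : DSet (V × V)
        left = dset (λ (x , y) → x ≡ u × y ∈ˢ X) (λ (x , y) → (x ≟ u) ×-dec mem? X y)
        right = dset (λ (x , y) → y ≡ u × x ∈ˢ X) (λ (x , y) → (y ≟ u) ×-dec mem? X x)
        split : ∀ e → e ∈ˢ arcs D★ W → e ∈ˢ arcs D W ⊎ e ∈ˢ left ∪ right
        split _ (m , n , inj₁ d) = inj₁ (m , n , d)
        split _ (m , n , inj₂ (inj₁ (e , q))) = inj₂ (inj₁ (e , q , n))
        split _ (m , n , inj₂ (inj₂ (e , q))) = inj₂ (inj₂ (e , q , m))

      R : DSet V
      R = W ∪ Q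

      R⊆ : R ⊆ˢ S
      R⊆ x (inj₁ m) = S₃⊆ x (W⊆ x m)
      R⊆ x (inj₂ (m , _)) = closed⊆S p∈S x m

      ∣R∣ : ∣ R ∣ ≤ ∣ W ∣ + ∣ Q ∖ X ∣
      ∣R∣ = ∣∣-cover {P = W} {Q ∖ X} {R} λ
        { x (inj₁ m) → inj₁ m
        ; x (inj₂ m) → case mem? W x of λ { (yes w) → inj₁ w ; (no n) → inj₂ (m , n ∘ proj₂) } }

      ∣X∣+ : ∣ X ∣ + ∣ Q ∖ X ∣ ≡ K
      ∣X∣+ = trans (cong (_+ ∣ Q ∖ X ∣) (≤-antisym
          (∣∣-⊆ {P = X} {Q ∩ X} λ { _ m@(((q , _) , _) , _) → q , m }) (∣∣-⊆ {P = Q ∩ X} {X} λ _ → proj₂)))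
        (trans (sym (∣∣-split Q X)) ∣Q∣)

      new off-diagonal diagonal : DSet (V × V)
      new = dset (λ (x , y) → x ∈ˢ Q × y ∈ˢ Q × x ≢ y × ¬ (x ∈ˢ W × y ∈ˢ W))
        (λ (x , y) → mem? Q x ×-dec mem? Q y ×-dec ¬? (x ≟ y) ×-dec ¬? (mem? W x ×-dec mem? W y))
      off-diagonal = dset (λ (x , y) → x ∈ˢ X × y ∈ˢ X × x ≢ y) (λ (x , y) → mem? X x ×-dec mem? X y ×-dec ¬? (x ≟ y))
      diagonal = dset (λ (x , y) → x ∈ˢ Q × x ≡ y) (λ (x , y) → mem? Q x ×-dec (x ≟ y))

      arcs-R : ∣ arcs D W ∣ + ∣ new ∣ ≤ ∣ arcs D R ∣
      arcs-R = ∣∣-disjoint {P = arcs D W} {new} {arcs D R} (λ _ (m , n , d) → inj₁ m , inj₁ n , d)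
        (λ (x , y) (m , n , l , _) → inj₂ m , inj₂ n , complete x m y n l) λ _ (m , n , _) (_ , _ , _ , o) → o (m , n)

      Q∩W⊆X : ∀ {x} → x ∈ˢ Q → x ∈ˢ W → x ∈ˢ X
      Q∩W⊆X {x} (m , _) w = [ (λ { refl → ⊥-elim (a∉W w refl) }) , [ (λ { refl → ⊥-elim (proj₂ (proj₁ (W⊆ p w)) refl) })
        , [ (λ { refl → ⊥-elim (proj₂ (proj₁ (proj₁ (W⊆ p′ w))) refl) }) , (λ q → q , w) ]′ ]′ ]′ (Q₁-cases m)

      ∣new∣ : K * K + ∣ X ∣ ≤ ∣ new ∣ + K + ∣ X ∣ * ∣ X ∣
      ∣new∣ = begin
        K * K + ∣ X ∣                              ≡⟨ cong (_+ ∣ X ∣) (trans (cong₂ _*_ (sym ∣Q∣) (sym ∣Q∣)) (sym (∣⊗∣ Q Q))) ⟩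
        ∣ Q ⊗ Q ∣ + ∣ X ∣                          ≤⟨ +-monoˡ-≤ (∣ X ∣) (≤-trans (∣∣-cover {P = new ∪ diagonal} {off-diagonal} {Q ⊗ Q} split)
                                                       (+-monoˡ-≤ (∣ off-diagonal ∣) (≤-trans (∣∣-cover {P = new} {diagonal} {new ∪ diagonal} (λ _ → id))
                                                         (+-monoʳ-≤ (∣ new ∣) (≤-trans ∣diagonal∣ (≤-reflexive ∣Q∣)))))) ⟩
        ∣ new ∣ + K + ∣ off-diagonal ∣ + ∣ X ∣     ≡⟨ +-assoc (∣ new ∣ + K) (∣ off-diagonal ∣) (∣ X ∣) ⟩
        ∣ new ∣ + K + (∣ off-diagonal ∣ + ∣ X ∣)   ≤⟨ +-monoʳ-≤ (∣ new ∣ + K) (subst₂ _≤_ (∣⊕∣ off-diagonal X) (∣⊗∣ X X)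
                                                       (∣∣-mono {P = off-diagonal ⊕ X} {X ⊗ X} (⊕↪ (⊆↪ λ _ (m , n , _) → m , n)
                                                         (inject (λ x m → (x , x) , m , m) λ { _ _ _ _ refl → refl }) λ { _ _ (_ , _ , l) _ refl → l refl }))) ⟩
        ∣ new ∣ + K + ∣ X ∣ * ∣ X ∣                ∎
        where
        open ≤-Reasoning
        ∣diagonal∣ : ∣ diagonal ∣ ≤ ∣ Q ∣
        ∣diagonal∣ = ∣∣-mono {P = diagonal} {Q} (inject (λ (x , _) (m , _) → x , m) λ { _ _ (_ , refl) (_ , refl) refl → refl })
        split : ∀ e → e ∈ˢ Q ⊗ Q → e ∈ˢ new ∪ diagonal ⊎ e ∈ˢ off-diagonal
        split (x , y) (m , n) = case x ≟ y of λ
          { (yes e) → inj₁ (inj₂ (m , e))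
          ; (no l) → case mem? W x ×-dec mem? W y of λ
            { (yes (v , w)) → inj₂ (Q∩W⊆X m v , Q∩W⊆X n w , l)
            ; (no o) → inj₁ (inj₁ (m , n , l , o)) } }

      -- In the reversal, p → a leaves `R` towards a vertex of indegree K.
      potential-R : suc N ≼ R
      potential-R = ≤-trans (+-monoʳ-≤ (suc N) (*-monoʳ-≤ (2 * K) (∣rev-arcs∣ (rev D) R)))
        (Rev.Star.large-potential p∈S a∈S (proj₂ p∈) out-a 1≤κ R R⊆ (inj₂ (inj₂ refl , a≢p ∘ sym))
          (λ { (inj₁ m) → a∉W m refl ; (inj₂ (_ , n)) → n refl })
          (≤-trans (Crit-size D★-irreflexive critW Fin.zero) (∣∣-⊆ {P = W} {R} λ _ → inj₁)))

      absurd : ⊥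
      absurd = special-arithmetic {κ} (∣ X ∣) (∣ Q ∖ X ∣) (∣ W ∣) (∣ arcs D R ∣) (∣ arcs D W ∣) (∣ new ∣) 1≤X
        (≤-trans (∣∣-⊆ {P = X} {Q₁} λ _ → proj₁) (≤-reflexive ∣Q₁∣)) ∣X∣+
        (≤-trans potential-R (*-monoʳ-≤ M ∣R∣))
        (≤-trans (ih D★-irreflexive W (∣∣-strict {P = W} {S} (λ x m → S₃⊆ x (W⊆ x m)) a∈S (λ m → a∉W m refl)) critW)
          (+-monoˡ-≤ C (*-monoʳ-≤ (2 * K) arcs★))) arcs-R ∣new∣

    special-absurd : ⊥
    special-absurd = extract (∣ S₃ ∣) S₃ ≤-refl D★-uncolourable Piece.absurd

  special : ∀ {a p p′} → a ∈ˢ S → ∣ out D S a ∣ ≤ K → p ∈ˢ out D S a → Twin p p′ → p ≢ p′ → a ≢ p′ →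
    Complete (closed p - a) → out D S a ⊆ˢ closed p
  special {p = p} a∈S out-a p∈ twin p≢p′ a≢p′ complete u u∈ = decidable-stable (mem? (closed p) u) λ u∉ →
    Special.special-absurd a∈S out-a p∈ twin p≢p′ a≢p′ complete u∈ u∉

  -- Clusters of twins and local charges

  Twin-sym : ∀ {a y} → Twin a y → Twin y a
  Twin-sym (l , m , s , t) = m , l , t , s

  Single : V → Set
  Single a = ¬ ∃ λ y → y ≢ a × Twin a y

  Single? : ∀ a → Dec (Single a)
  Single? a = ¬? (∃? λ y → ¬? (y ≟ a) ×-dec Twin? a y)

  -- Each out-neighbour z contributes min(κ, indegree − K) pairs.
  Weight : DSet V → DSet (V × Fin κ)
  Weight Z = dset (λ (z , i) → z ∈ˢ Z × Fin.toℕ i < ∣ in′ D S z ∣ ∸ K)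
    (λ (z , i) → mem? Z z ×-dec (Fin.toℕ i <? ∣ in′ D S z ∣ ∸ K))

  Weight-mono : ∀ {P Q} → P ⊆ˢ Q → ∣ Weight P ∣ ≤ ∣ Weight Q ∣
  Weight-mono {P} {Q} s = ∣∣-⊆ {P = Weight P} {Weight Q} λ (z , _) (m , l) → s z m , l

  ≤Weight : ∀ Z {m} → m ≤ κ → (∀ z → z ∈ˢ Z → m ≤ ∣ in′ D S z ∣ ∸ K) → ∣ Z ∣ * m ≤ ∣ Weight Z ∣
  ≤Weight Z {m} m≤κ big = fibres Z (dset (λ (z , i) → Fin.toℕ i < ∣ in′ D S z ∣ ∸ K) (λ (z , i) → Fin.toℕ i <? ∣ in′ D S z ∣ ∸ K)) m
    λ z z∈ → ≤-trans (count-below m≤κ) (∣∣-⊆ {P = dset (λ (i : Fin κ) → Fin.toℕ i < m) (λ i → Fin.toℕ i <? m)}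
      {dset (λ (i : Fin κ) → Fin.toℕ i < ∣ in′ D S z ∣ ∸ K) (λ i → Fin.toℕ i <? ∣ in′ D S z ∣ ∸ K)} λ i l → ≤-trans l (big z z∈))

  ≤Weight₁ : ∀ Z → (∀ z → z ∈ˢ Z → K < ∣ in′ D S z ∣) → ∣ Z ∣ ≤ ∣ Weight Z ∣
  ≤Weight₁ Z big = ≤-trans (≤-reflexive (sym (*-identityʳ (∣ Z ∣)))) (≤Weight Z 1≤κ λ z z∈ → m<n⇒0<n∸m (big z z∈))

  module Cluster {a y : V} (a∈S : a ∈ˢ S) (y≢a : y ≢ a) (twin : Twin a y) where

    low-a = proj₁ twin
    out-a : ∣ out D S a ∣ ≤ K
    out-a = proj₁ low-a

    T : DSet V
    T = dset (Twin a) (Twin? a)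

    a∈T : a ∈ˢ T
    a∈T = low-a , low-a , (λ _ m → m) , (λ _ m → m)

    T⊆closed : T ⊆ˢ closed a
    T⊆closed x (_ , _ , _ , s) = s x (inj₂ refl)

    T-arc : ∀ {x v} → x ∈ˢ T → v ∈ˢ closed a → x ≢ v → (x , v) ∈ˢ D
    T-arc (_ , _ , s , _) m n = [ proj₂ , (λ e → ⊥-elim (n (sym e))) ]′ (s _ m)

    T-clique : Clique T
    T-clique x p v q n = T-arc p (T⊆closed v q) n , T-arc q (T⊆closed x p) (n ∘ sym)

    2≤T : 2 ≤ ∣ T ∣
    2≤T = ≤-trans (s≤s (1≤size (T - a) (twin , y≢a))) (≤-reflexive (∣-∣ T a∈T))

    -- With K twins at most one vertex of `closed a` lies outside `T`; twins are joined to
    -- everything in it, so it would be complete.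
    T≤ : ∣ T ∣ ≤ suc κ
    T≤ = ≮⇒≥ λ K≤T → near-complete (closed a) (closed⊆S a∈S) (∣closed∣ a∈S out-a) a a λ u m v n u≢v _ →
      case mem? T u of λ
        { (yes t) → T-arc t n u≢v
        ; (no s) → case mem? T v of λ
          { (yes t) → low-out (proj₁ (proj₂ t)) (closed⊆S a∈S u m) (T-arc t m (u≢v ∘ sym))
          ; (no t) → ⊥-elim (u≢v (at-most-one (closed a ∖ T) (+-cancelˡ-≤ K _ _ (≤-trans (+-monoˡ-≤ _ K≤T)
              (≤-trans (∣∣-disjoint {P = T} {closed a ∖ T} {closed a} T⊆closed (λ _ → proj₁) λ { _ q (_ , o) → o q })
                (≤-reflexive (trans (∣closed∣ a∈S out-a) (+-comm 1 K)))))) (m , s) (n , t))) } }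

    Z E : DSet V
    Z = dset (λ z → z ∈ˢ out D S a × z ∉ˢ T × ¬ Complete (A′ a z)) (λ z → mem? (out D S a) z ×-dec ¬? (mem? T z) ×-dec ¬? (Complete? (A′ a z)))
    E = dset (λ z → z ∈ˢ out D S a × Complete (A′ a z)) (λ z → mem? (out D S a) z ×-dec Complete? (A′ a z))

    -- Were the indegree K, `z` would be low and, not being a twin, have `B′ a z` complete. This set
    -- contains `y`, so all of `closed z` is adjacent to `y`, hence to its twin `a`, and `closed z`
    -- is complete.
    Z-indegree : ∀ {z} → z ∈ˢ Z → K < ∣ in′ D S z ∣
    Z-indegree {z} (z∈ , z∉T , ¬α) = ≰⇒> λ in-z →
      let low-z = Tight.low-head a∈S out-a z∈ in-z ¬α
          β = decidable-stable (Complete? (B′ a z)) λ ¬β → z∉T (bad-arc-twin a∈S out-a z∈ in-z ¬α ¬β)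
          y→z = T-arc twin (inj₁ z∈) λ { refl → z∉T twin }
          from-a : ∀ v → v ∈ˢ closed z → v ≢ a → (a , v) ∈ˢ D
          from-a v m n = case v ≟ y of λ
            { (yes refl) → T-arc a∈T (T⊆closed y twin) (n ∘ sym)
            ; (no o) → T-arc a∈T (proj₂ (proj₂ (proj₂ twin)) v (inj₁ (closed⊆S (proj₁ z∈) v m ,
                β y (inj₁ ((closed⊆S a∈S y (T⊆closed y twin) , y→z) , y≢a)) v (low-closed-B′ low-z m n) (o ∘ sym)))) (n ∘ sym) }
      in near-complete (closed z) (closed⊆S (proj₁ z∈)) (∣closed∣ (proj₁ z∈) (proj₁ low-z)) a a λ u m v n u≢v _ →
        case u ≟ a of λ
          { (yes refl) → from-a v n (u≢v ∘ sym)
          ; (no l) → case v ≟ a of λ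
            { (yes refl) → low-out low-a (closed⊆S (proj₁ z∈) u m) (from-a u m l)
            ; (no o) → β u (low-closed-B′ low-z m l) v (low-closed-B′ low-z n o) u≢v } }

    Z-excess : ∀ z → z ∈ˢ Z → ∣ T ∣ ∸ 1 ≤ ∣ in′ D S z ∣ ∸ K
    Z-excess z z∈Z@(z∈ , z∉T , ¬α) = m+n≤o⇒m≤o∸n (∣ T ∣ ∸ 1) (+-cancelˡ-≤ 1 _ _ (≤-trans (≤-reflexive shift) (≤-pred (≰⇒> λ few → ¬α
        (cluster-head {T = T} a∈S out-a z∈ (λ x t → closed-A′ (T⊆closed x t) λ { refl → z∉T t }) T-clique
          (λ x (_ , _ , _ , s) w m n → closed-A′ (s w (inj₁ m)) n) a∈T (λ x t → T-arc t (inj₁ z∈) λ { refl → z∉T t })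
          (Z-indegree z∈Z) few)))))
      where
      shift : 1 + ((∣ T ∣ ∸ 1) + K) ≡ K + ∣ T ∣
      shift = trans (cong (_+ K) (m+[n∸m]≡n (≤-trans (s≤s z≤n) 2≤T))) (+-comm (∣ T ∣) K)

    -- Of the K out-neighbours of `a`, |T| - 1 are twins and at most one lies in `E`. At least K -
    -- |T| remain in `Z`, each weighing at least |T| - 1.
    cluster-weight : κ ≤ ∣ Weight Z ∣
    cluster-weight = ≤-trans (cluster-arithmetic 2≤T T≤ size) (≤Weight Z (∸-monoˡ-≤ 1 T≤) Z-excess)
      where
      size : K ≤ ∣ T ∣ + ∣ Z ∣
      size = ≤-trans (≤-reflexive (sym (∣out∣≡K a∈S out-a))) (≤-trans (∣∣-cover {P = T - a} {Z ∪ E} {out D S a} λ z m →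
          case Complete? (A′ a z) of λ
            { (yes c) → inj₂ (inj₂ (m , c))
            ; (no c) → case mem? T z of λ
              { (yes t) → inj₁ (t , λ { refl → irr z (proj₂ m) }) ; (no t) → inj₂ (inj₁ (m , t , c)) } })
        (≤-trans (+-monoʳ-≤ (∣ T - a ∣) (≤-trans (∣∣-cover {P = Z} {E} {Z ∪ E} λ _ → id) (≤-trans
            (+-monoʳ-≤ (∣ Z ∣) (∣∣≤1 E λ (_ , c) (_ , d) → complete-A′-unique a∈S out-a c d)) (≤-reflexive (+-comm (∣ Z ∣) 1)))))
          (≤-reflexive (trans (+-suc (∣ T - a ∣) (∣ Z ∣)) (cong (_+ ∣ Z ∣) (∣-∣ T a∈T))))))

  -- Arcs from a vertex of outdegree K to a vertex of indegree K whose shortage is charged to one of their ends.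
  pays earns : V → DSet V
  pays a = dset (λ p → p ∈ˢ out D S a × ∣ in′ D S p ∣ ≤ K × Complete (A′ a p) × ¬ Complete (B′ a p) × Single a)
    (λ p → mem? (out D S a) p ×-dec (_ ≤? _) ×-dec Complete? (A′ a p) ×-dec ¬? (Complete? (B′ a p)) ×-dec Single? a)
  earns a = dset (λ p → p ∈ˢ out D S a × ∣ in′ D S p ∣ ≤ K × ¬ Complete (A′ a p) × Complete (B′ a p) × Single p)
    (λ p → mem? (out D S a) p ×-dec (_ ≤? _) ×-dec ¬? (Complete? (A′ a p)) ×-dec Complete? (B′ a p) ×-dec Single? p)

  module SingleTail {a : V} (a∈S : a ∈ˢ S) (out-a : ∣ out D S a ∣ ≤ K) (single : Single a) where

    β : ∀ {p} → p ∈ˢ out D S a → ∣ in′ D S p ∣ ≤ K → ¬ Complete (A′ a p) → Complete (B′ a p)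
    β {p} p∈ in-p ¬α = decidable-stable (Complete? (B′ a p)) λ ¬β →
      single (p , (λ { refl → irr p (proj₂ p∈) }) , bad-arc-twin a∈S out-a p∈ in-p ¬α ¬β)

    -- Were the indegree of `p` equal to K, the K vertices of `A′ a q` would lie in the K + 1 of
    -- `closed p`. As `B′ a p` is complete too, only the digon between `a` and one leftover vertex
    -- could be missing.
    α-alone : ∀ {q p} → q ∈ˢ out D S a → Complete (A′ a q) → p ∈ˢ out D S a → p ≢ q → K < ∣ in′ D S p ∣
    α-alone {q} {p} q∈ α p∈ p≢q = ≰⇒> λ in-p →
      let ¬α = λ α′ → p≢q (complete-A′-unique a∈S out-a α′ α)
          low-p = Tight.low-head a∈S out-a p∈ in-p ¬α
          open Copy a∈S out-a q∈ using (A; A⊆S; ≤∣A∣)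
          A⊆ : A ⊆ˢ closed p
          A⊆ x m = case x ≟ p of λ { (yes e) → inj₂ e ; (no n) → inj₁ (A⊆S x m , α p (inj₁ (p∈ , p≢q)) x m (n ∘ sym)) }
          total : ∣ A ∣ + ∣ closed p ∖ A ∣ ≤ suc K
          total = ≤-trans (∣∣-disjoint {P = A} {closed p ∖ A} {closed p} A⊆ (λ _ → proj₁) λ { _ m (_ , n) → n m })
            (≤-reflexive (∣closed∣ (proj₁ p∈) (proj₁ low-p)))
          rest≤1 : ∣ closed p ∖ A ∣ ≤ 1
          rest≤1 = +-cancelˡ-≤ K _ _ (≤-trans (+-monoˡ-≤ _ (≤-trans (outdegree irr crit a∈S) ≤∣A∣)) (≤-trans total (≤-reflexive (+-comm 1 K))))
      in case ∃? (mem? (closed p ∖ A)) of λ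
        -- Nothing is left over here; `a` is a dummy.
        { (no none) → near a (λ v m n → ⊥-elim (none (v , m , n))) p∈ in-p ¬α low-p α
        ; (yes (e , e∈)) → near e (λ v m n → at-most-one (closed p ∖ A) rest≤1 (m , n) e∈) p∈ in-p ¬α low-p α }
      where
      near : ∀ e → (∀ v → v ∈ˢ closed p → v ∉ˢ A′ a q → v ≡ e) → p ∈ˢ out D S a → ∣ in′ D S p ∣ ≤ K →
        ¬ Complete (A′ a p) → Low p → Complete (A′ a q) → ⊥
      near e only p∈ in-p ¬α low-p α = near-complete (closed p) (closed⊆S (proj₁ p∈)) (∣closed∣ (proj₁ p∈) (proj₁ low-p)) a e
        λ u m v n u≢v o → case u ≟ a of λ
          { (yes refl) → case mem? (A′ a q) v of λ
            { (yes v∈A) → α u (inj₂ refl) v v∈A u≢v ; (no v∉A) → ⊥-elim (o (inj₁ (refl , only v n v∉A))) }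
          ; (no l) → case v ≟ a of λ
            { (yes refl) → case mem? (A′ a q) u of λ
              { (yes u∈A) → α u u∈A v (inj₂ refl) u≢v ; (no u∉A) → ⊥-elim (o (inj₂ (only u m u∉A , refl))) }
            ; (no r) → β p∈ in-p ¬α u (low-closed-B′ low-p m l) v (low-closed-B′ low-p n r) u≢v } }

    good : DSet V
    good = dset (λ p → p ∈ˢ out D S a × K < ∣ in′ D S p ∣) (λ p → mem? (out D S a) p ×-dec (K <? ∣ in′ D S p ∣))

    NoClique : Set
    NoClique = ∀ p → p ∈ˢ out D S a → ∣ in′ D S p ∣ ≤ K → ¬ Complete (A′ a p)

    -- The other κ + 1 out-neighbours weigh at least 1 each: κ for the vertex itself and one unit
    -- for its only possible payment.
    with-clique : ∀ {q} → q ∈ˢ out D S a → Complete (A′ a q) → κ + ∣ pays a ∣ ≤ ∣ Weight (out D S a) ∣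
    with-clique {q} q∈ α = begin
      κ + ∣ pays a ∣              ≤⟨ +-monoʳ-≤ κ (∣∣≤1 (pays a) λ (_ , _ , c , _) (_ , _ , d , _) → complete-A′-unique a∈S out-a c d) ⟩
      κ + 1                       ≡⟨ +-comm κ 1 ⟩
      suc κ                       ≡⟨ suc-injective (trans (sym (∣out∣≡K a∈S out-a)) (sym (∣-∣ (out D S a) q∈))) ⟩
      ∣ out D S a - q ∣           ≤⟨ ≤Weight₁ (out D S a - q) (λ p (p∈ , n) → α-alone q∈ α p∈ n) ⟩
      ∣ Weight (out D S a - q) ∣  ≤⟨ Weight-mono {out D S a - q} {out D S a} (λ _ → proj₁) ⟩
      ∣ Weight (out D S a) ∣      ∎
      where open ≤-Reasoning

    pays-nothing : NoClique → κ + ∣ pays a ∣ ≡ κ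
    pays-nothing none = trans (cong (κ +_) (n≤0⇒n≡0 (≤-trans
      (∣∣-⊆ {P = pays a} {∅ˢ} λ p (m , l , c , _) → none p m l c) (≤-reflexive (∣∅ˢ∣ {V}))))) (+-identityʳ κ)

    all-single : NoClique → (∀ p → p ∈ˢ out D S a → ∣ in′ D S p ∣ ≤ K → Single p) → κ ≤ ∣ Weight (out D S a) ∣ + ∣ earns a ∣
    all-single none singles = begin
      κ                                      ≤⟨ m≤n+m κ 2 ⟩
      K                                      ≡⟨ sym (∣out∣≡K a∈S out-a) ⟩
      ∣ out D S a ∣                          ≤⟨ ∣∣-cover {P = good} {earns a} {out D S a} split ⟩
      ∣ good ∣ + ∣ earns a ∣                 ≤⟨ +-monoˡ-≤ (∣ earns a ∣) (≤Weight₁ good λ _ → proj₂) ⟩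
      ∣ Weight good ∣ + ∣ earns a ∣          ≤⟨ +-monoˡ-≤ (∣ earns a ∣) (Weight-mono {good} {out D S a} λ _ → proj₁) ⟩
      ∣ Weight (out D S a) ∣ + ∣ earns a ∣   ∎
      where
      open ≤-Reasoning
      split : ∀ p → p ∈ˢ out D S a → p ∈ˢ good ⊎ p ∈ˢ earns a
      split p m = case ∣ in′ D S p ∣ ≤? K of λ
        { (no g) → inj₁ (m , ≰⇒> g)
        ; (yes l) → inj₂ (m , l , none p m l , β m l (none p m l) , singles p m l) }

    -- By `special` the out-neighbourhood of `a` is `closed p - a`, so `a` collects the weight found
    -- by the cluster of `p`.
    beside : ∀ {p p′} → p ∈ˢ out D S a → ∣ in′ D S p ∣ ≤ K → ¬ Complete (A′ a p) → p′ ≢ p → Twin p p′ → κ ≤ ∣ Weight (out D S a) ∣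
    beside {p} {p′} p∈ in-p ¬α n twin = ≤-trans cluster-weight (Weight-mono {Z} {out D S a} Z⊆)
      where
      open Cluster (proj₁ p∈) n twin using (Z; cluster-weight) renaming (low-a to low-p)
      a≢p : a ≢ p
      a≢p refl = irr a (proj₂ p∈)
      a∈p : a ∈ˢ out D S p
      a∈p = a∈S , low-in low-p a∈S (proj₂ p∈)
      β-clique : Complete (closed p - a)
      β-clique = Complete-⊆ {closed p - a} {B′ a p} (λ x (m , l) → low-closed-B′ low-p m l) (β p∈ in-p ¬α)
      inside : out D S a ⊆ˢ closed p - a
      inside x m = special a∈S out-a p∈ twin (n ∘ sym) (λ { refl → single (p , a≢p ∘ sym , Twin-sym twin) }) β-clique x m , λ { refl → irr x (proj₂ m) }
      Z⊆ : Z ⊆ˢ out D S a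
      Z⊆ z (z∈ , _ , ¬α′) = decidable-stable (mem? (out D S a) z) λ z∉ →
        <⇒≱ (∣∣-strict {P = out D S a} {closed p - a} inside (inj₁ z∈ , λ { refl → ¬α′ (Complete-⊆ {A′ p z} {B′ z p} (low-A′-B′ low-p) (β p∈ in-p ¬α)) }) z∉)
          (≤-reflexive (trans (suc-injective (trans (∣-∣ (closed p) (inj₁ a∈p)) (∣closed∣ (proj₁ p∈) (proj₁ low-p)))) (sym (∣out∣≡K a∈S out-a))))

    single-role : κ + ∣ pays a ∣ ≤ ∣ Weight (out D S a) ∣ + ∣ earns a ∣
    single-role = case ∃? (λ q → mem? (out D S a) q ×-dec (∣ in′ D S q ∣ ≤? K) ×-dec Complete? (A′ a q)) of λ
      { (yes (q , q∈ , _ , α)) → ≤-trans (with-clique q∈ α) (m≤m+n _ _)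
      ; (no n) → no-clique λ p m l c → n (p , m , l , c) }
      where
      no-clique : NoClique → κ + ∣ pays a ∣ ≤ ∣ Weight (out D S a) ∣ + ∣ earns a ∣
      no-clique none = ≤-trans (≤-reflexive (pays-nothing none))
        (case ∃? (λ p → mem? (out D S a) p ×-dec (∣ in′ D S p ∣ ≤? K) ×-dec ∃? λ p′ → ¬? (p′ ≟ p) ×-dec Twin? p p′) of λ
          { (yes (p , p∈ , in-p , p′ , n , twin)) → ≤-trans (beside p∈ in-p (none p p∈ in-p) n twin) (m≤m+n _ _)
          ; (no n) → all-single none λ p m l (p′ , t) → n (p , m , l , p′ , t) })

  role : ∀ {a} → a ∈ˢ S → ∣ out D S a ∣ ≤ K → κ + ∣ pays a ∣ ≤ ∣ Weight (out D S a) ∣ + ∣ earns a ∣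
  role {a} a∈S out-a = case ∃? (λ y → ¬? (y ≟ a) ×-dec Twin? a y) of λ
    { (no single) → SingleTail.single-role a∈S out-a single
    ; (yes (y , n , twin)) → let open Cluster a∈S n twin in
        ≤-trans (≤-reflexive (trans (cong (κ +_) (n≤0⇒n≡0 (≤-trans (∣∣-⊆ {P = pays a} {∅ˢ} λ p (_ , _ , _ , _ , s) → s (y , n , twin))
          (≤-reflexive (∣∅ˢ∣ {V}))))) (+-identityʳ κ)))
        (≤-trans (≤-trans cluster-weight (Weight-mono {Z} {out D S a} λ _ → proj₁)) (m≤m+n _ _)) }

  O H : DSet V
  O = dset (λ v → v ∈ˢ S × ∣ out D S v ∣ ≤ K) (λ v → mem? S v ×-dec (∣ out D S v ∣ ≤? K))
  H = dset (λ v → v ∈ˢ S × K < ∣ in′ D S v ∣) (λ v → mem? S v ×-dec (K <? ∣ in′ D S v ∣))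

  PayPairs EarnPairs : DSet (V × V)
  PayPairs = pairs O (dset (λ (a , p) → p ∈ˢ pays a) (λ (a , p) → mem? (pays a) p))
  EarnPairs = pairs O (dset (λ (a , p) → p ∈ˢ earns a) (λ (a , p) → mem? (earns a) p))

  WeightPairs : DSet (V × (V × Fin κ))
  WeightPairs = pairs O (dset (λ (a , x) → x ∈ˢ Weight (out D S a)) (λ (a , x) → mem? (Weight (out D S a)) x))

  total-role : ∣ O ∣ * κ + ∣ PayPairs ∣ ≤ ∣ WeightPairs ∣ + ∣ EarnPairs ∣
  total-role = begin
    ∣ O ∣ * κ + ∣ PayPairs ∣                                                   ≡⟨ cong₂ _+_ (sym (Σˢ-const O κ)) (∣pairs∣ O _) ⟩
    Σˢ O (λ _ → κ) + Σˢ O (λ a → ∣ pays a ∣)                                   ≡⟨ sym (Σˢ-+ O (λ _ → κ) (λ a → ∣ pays a ∣)) ⟩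
    Σˢ O (λ a → κ + ∣ pays a ∣)                                                ≤⟨ Σˢ-mono O (λ a (a∈S , l) → role a∈S l) ⟩
    Σˢ O (λ a → ∣ Weight (out D S a) ∣ + ∣ earns a ∣)                          ≡⟨ Σˢ-+ O (λ a → ∣ Weight (out D S a) ∣) (λ a → ∣ earns a ∣) ⟩
    Σˢ O (λ a → ∣ Weight (out D S a) ∣) + Σˢ O (λ a → ∣ earns a ∣)             ≡⟨ cong₂ _+_ (sym (∣pairs∣ O _)) (sym (∣pairs∣ O _)) ⟩
    ∣ WeightPairs ∣ + ∣ EarnPairs ∣                                            ∎
    where open ≤-Reasoning

  below : V → DSet (Fin κ)
  below v = dset (λ i → Fin.toℕ i < ∣ in′ D S v ∣ ∸ K) (λ i → Fin.toℕ i <? ∣ in′ D S v ∣ ∸ K)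

  ∣below∣ : ∀ v → ∣ below v ∣ ≤ ∣ in′ D S v ∣ ∸ K
  ∣below∣ v = ≤-trans (∣∣-mono {P = below v} {fullˢ {Fin (∣ in′ D S v ∣ ∸ K)}} (inject (λ i l → Fin.fromℕ< l , tt)
    λ i j l m e → toℕ-injective (trans (sym (toℕ-fromℕ< l)) (trans (cong Fin.toℕ e) (toℕ-fromℕ< m))))) (≤-reflexive (∣fullˢ∣ _))

  high : DSet (V × Fin κ)
  high = dset (λ (v , _) → K < ∣ in′ D S v ∣) (λ (v , _) → K <? ∣ in′ D S v ∣)

  ∣Fin∣ : (P : DSet (Fin κ)) → ∣ P ∣ ≤ κ
  ∣Fin∣ P = ≤-trans (∣∣-⊆ {P = P} {fullˢ} λ _ _ → tt) (≤-reflexive (∣fullˢ∣ κ))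

  Received : DSet (V × (V × Fin κ))
  Received = dset (λ (v , x) → x ∈ˢ in′ D S v ⊗ below v) (λ (v , x) → mem? (in′ D S v ⊗ below v) x)

  -- Regrouped by heads: a vertex of indegree d is charged at most min(κ, d - K) by each of d tails,
  -- plus κ for membership in `H`, and can afford (2K - 1)(d - K).
  total-weight : ∣ WeightPairs ∣ + (∣ H ∣ * κ + ∣ S ∣ * ((3 + 2 * κ) * K)) ≤ (3 + 2 * κ) * ∣ arcs D S ∣
  total-weight = begin
    ∣ WeightPairs ∣ + (∣ H ∣ * κ + ∣ S ∣ * (L * K))
      ≤⟨ +-mono-≤ weights (+-mono-≤ highs (≤-reflexive (sym (Σˢ-const S (L * K))))) ⟩
    Σˢ S (λ v → ∣ in′ D S v ⊗ below v ∣) + (Σˢ S (λ v → ∣ fibre high v ∣) + Σˢ S (λ _ → L * K))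
      ≡⟨ trans (cong (Σˢ S (λ v → ∣ in′ D S v ⊗ below v ∣) +_) (sym (Σˢ-+ S (λ v → ∣ fibre high v ∣) (λ _ → L * K))))
           (sym (Σˢ-+ S (λ v → ∣ in′ D S v ⊗ below v ∣) (λ v → ∣ fibre high v ∣ + L * K))) ⟩
    Σˢ S (λ v → ∣ in′ D S v ⊗ below v ∣ + (∣ fibre high v ∣ + L * K))
      ≤⟨ Σˢ-mono S (λ v v∈S → ≤-trans (≤-reflexive (cong (_+ (∣ fibre high v ∣ + L * K)) (∣⊗∣ (in′ D S v) (below v))))
           (weight-arithmetic κ (indegree irr crit v∈S) (∣below∣ v) (∣Fin∣ (below v)) (∣Fin∣ (fibre high v))
             λ l → ≤-trans (∣∣-⊆ {P = fibre high v} {∅ˢ} λ _ g → <⇒≱ g l) (≤-reflexive (∣∅ˢ∣ {Fin κ})))) ⟩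
    Σˢ S (λ v → L * ∣ in′ D S v ∣)
      ≡⟨ Σˢ-* S L (λ v → ∣ in′ D S v ∣) ⟩
    L * Σˢ S (λ v → ∣ in′ D S v ∣)
      ≤⟨ *-monoʳ-≤ L (≤-trans (≤-reflexive (sym (∣pairs∣ S indegrees)))
           (∣∣-mono {P = pairs S indegrees} {arcs D S} (inject (λ (v , u) (q , p , d) → (u , v) , p , q , d) λ { _ _ _ _ refl → refl }))) ⟩
    L * ∣ arcs D S ∣ ∎
    where
    open ≤-Reasoning
    L : ℕ
    L = 3 + 2 * κ
    indegrees : DSet (V × V)
    indegrees = dset (λ (v , u) → u ∈ˢ in′ D S v) (λ (v , u) → mem? (in′ D S v) u)
    weights : ∣ WeightPairs ∣ ≤ Σˢ S (λ v → ∣ in′ D S v ⊗ below v ∣)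
    weights = ≤-trans (∣∣-mono {P = WeightPairs} {pairs S Received} (inject
      (λ (a , v , i) ((a∈S , _) , (v∈S , d) , l) → (v , a , i) , v∈S , (a∈S , d) , l) λ { _ _ _ _ refl → refl }))
      (≤-reflexive (∣pairs∣ S Received))
    highs : ∣ H ∣ * κ ≤ Σˢ S (λ v → ∣ fibre high v ∣)
    highs = ≤-trans (≤-reflexive (trans (cong (∣ H ∣ *_) (sym (∣fullˢ∣ κ))) (sym (∣⊗∣ H (fullˢ {Fin κ})))))
      (≤-trans (∣∣-⊆ {P = H ⊗ fullˢ} {pairs S high} λ _ ((v∈S , g) , _) → v∈S , g) (≤-reflexive (∣pairs∣ S high)))

-- The contradiction and the induction

module _ {κ : ℕ} {V : Set} {{_ : Finite V}} {D : Dig V} {S : DSet V} (G : Extremal κ D S) where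

  private
    module A = TwoSided G
    module B = TwoSided (rev-Extremal G)

  rev-Twin : ∀ {p y} → B.Twin p y → A.Twin p y
  rev-Twin {p} {y} ((i , o , s , t) , (i′ , o′ , s′ , t′) , c , c′) = (o , i , t , s) , (o′ , i′ , t′ , s′) ,
    (λ { x (inj₁ m) → forth x (c x (inj₁ (t x m))) ; x (inj₂ e) → forth x (c x (inj₂ e)) }) ,
    (λ { x (inj₁ m) → back x (c′ x (inj₁ (t′ x m))) ; x (inj₂ e) → back x (c′ x (inj₂ e)) })
    where
    forth : ∀ x → x ∈ˢ B.closed y → x ∈ˢ A.closed y
    forth x (inj₁ m) = inj₁ (s′ x m)
    forth x (inj₂ e) = inj₂ e
    back : ∀ x → x ∈ˢ B.closed p → x ∈ˢ A.closed p
    back x (inj₁ m) = inj₁ (s x m)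
    back x (inj₂ e) = inj₂ e

  -- Reversal exchanges `A′` with `B′` and tail with head, so what `a` earns along an arc is paid by
  -- `p` in the reversal.
  earn-pay : ∀ {a p} → a ∈ˢ S → ∣ out D S a ∣ ≤ A.K → p ∈ˢ A.earns a → a ∈ˢ B.pays p
  earn-pay a∈S out-a ((p∈S , d) , in-p , ¬α , β , single) = (a∈S , d) , out-a , (λ u m v n l → β v n u m (l ∘ sym)) ,
    (λ c → ¬α λ u m v n l → c v n u m (l ∘ sym)) , λ (y , n , t) → single (y , n , rev-Twin t)

  ∣EarnPairs∣ : ∣ A.EarnPairs ∣ ≤ ∣ B.PayPairs ∣
  ∣EarnPairs∣ = ∣∣-mono {P = A.EarnPairs} {B.PayPairs} (inject
    (λ (a , p) ((a∈S , l) , e) → (p , a) , (proj₁ (proj₁ e) , proj₁ (proj₂ e)) , earn-pay a∈S l e) λ { _ _ _ _ refl → refl })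

no-extremal : ∀ {κ} {V : Set} {{_ : Finite V}} {D : Dig V} {S : DSet V} → Extremal κ D S → ⊥
no-extremal {κ} {D = D} {S} G = final-arithmetic κ {∣ S ∣} {∣ A.O ∣} {∣ B.O ∣} {∣ B.H ∣} {∣ A.H ∣} {∣ arcs D S ∣} {∣ A.WeightPairs ∣} {∣ B.WeightPairs ∣}
    {∣ A.PayPairs ∣} {∣ A.EarnPairs ∣} {∣ B.PayPairs ∣} {∣ B.EarnPairs ∣} A.total-role B.total-role (∣EarnPairs∣ G) (∣EarnPairs∣ (rev-Extremal G))
    A.total-weight (≤-trans B.total-weight (*-monoʳ-≤ (3 + 2 * κ) (∣rev-arcs∣ D S)))
    (∣∣-cover {P = A.O} {B.H} {S} λ v m → case ∣ out D S v ∣ ≤? A.K of λ { (yes l) → inj₁ (m , l) ; (no g) → inj₂ (m , ≰⇒> g) })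
    (∣∣-cover {P = B.O} {A.H} {S} λ v m → case ∣ in′ D S v ∣ ≤? A.K of λ { (yes l) → inj₁ (m , l) ; (no g) → inj₂ (m , ≰⇒> g) })
    A.counter
  where
  module A = TwoSided G
  module B = TwoSided (rev-Extremal G)

-- `n` bounds |S|. For fixed `S` a lexicographic descent on arcs, missing digons and missing
-- triangles supplies `best`; `full²` and `full³` reset the later counters when an earlier one
-- drops.
critical-bound : ∀ {κ} → 1 ≤ κ → ∀ n → InductionHypothesis κ n
critical-bound _ zero _ S ()
critical-bound {κ} 1≤κ (suc n) {V} {D₀} irr₀ S l crit₀ = inner (∣ arcs D₀ S ∣) full² full³ D₀ irr₀ crit₀ ≤-refl (m≤n+m _ _) (m≤n+m _ _)
  where
  full² full³ : ℕ
  full² = ∣ fullˢ {V × V} ∣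
  full³ = ∣ fullˢ {V × V × V} ∣
  Bound : Dig V → Set
  Bound D = weight (2 + κ) κ * ∣ S ∣ ≤ 2 * (2 + κ) * ∣ arcs D S ∣ + bound (2 + κ) κ
  inner : ∀ x y z D → Irreflexive D → Crit (2 + κ) D S → ∣ arcs D S ∣ ≤ x → full² ≤ ∣ digons D S ∣ + y → full³ ≤ ∣ triangles D S ∣ + z → Bound D
  improve : ∀ x y z D → ∣ arcs D S ∣ ≤ x → full² ≤ ∣ digons D S ∣ + y → full³ ≤ ∣ triangles D S ∣ + z →
    ∀ D′ → Irreflexive D′ → Crit (2 + κ) D′ S → Better S D′ D → Bound D′
  inner x y z D irr crit hx hy hz = decidable-stable (_ ≤? _) λ ¬bound → no-extremal record
    { irr = irr
    ; crit = crit
    ; ih = λ irr′ T small → critical-bound 1≤κ n irr′ T (≤-trans small (≤-pred l))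
    ; counter = ≰⇒> ¬bound
    ; best = λ D′ irr′ crit′ better → ¬bound (≤-trans (improve x y z D hx hy hz D′ irr′ crit′ better)
        (+-monoˡ-≤ (bound (2 + κ) κ) (*-monoʳ-≤ (2 * (2 + κ)) ([ <⇒≤ , proj₁ ]′ better))))
    ; 1≤κ = 1≤κ
    }
  improve zero y z D hx hy hz D′ irr crit (inj₁ b) = ⊥-elim (n≮0 (≤-trans b hx))
  improve (suc x) y z D hx hy hz D′ irr crit (inj₁ b) =
    inner x full² full³ D′ irr crit (≤-pred (≤-trans b hx)) (m≤n+m _ _) (m≤n+m _ _)
  improve x zero z D hx hy hz D′ irr crit (inj₂ (_ , inj₁ b)) = ⊥-elim (<⇒≱ b
    (≤-trans (∣∣-⊆ {P = digons D′ S} {fullˢ} λ _ _ → tt) (≤-trans hy (≤-reflexive (+-identityʳ _)))))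
  improve x (suc y) z D hx hy hz D′ irr crit (inj₂ (c , inj₁ b)) =
    inner x y full³ D′ irr crit (≤-trans c hx) (≤-trans hy (≤-trans (≤-reflexive (+-suc _ y)) (+-monoˡ-≤ y b))) (m≤n+m _ _)
  improve x y zero D hx hy hz D′ irr crit (inj₂ (_ , inj₂ (_ , b))) = ⊥-elim (<⇒≱ b
    (≤-trans (∣∣-⊆ {P = triangles D′ S} {fullˢ} λ _ _ → tt) (≤-trans hz (≤-reflexive (+-identityʳ _)))))
  improve x y (suc z) D hx hy hz D′ irr crit (inj₂ (c , inj₂ (e , b))) =
    inner x y z D′ irr crit (≤-trans c hx) (≤-trans hy (+-monoˡ-≤ y e)) (≤-trans hz (≤-trans (≤-reflexive (+-suc _ z)) (+-monoˡ-≤ z b)))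

-- Directed cycles and ranks

module _ {n : ℕ} where

  digraph : Rel n → Dig (Fin n)
  digraph A = dset (λ (u , v) → A u v ≡ true) (λ (u , v) → A u v Bool.≟ true)

  Chain-mono : ∀ {B B′ : Rel n} → (∀ u v → B u v ≡ true → B′ u v ≡ true) → ∀ xs → Chain B xs → Chain B′ xs
  Chain-mono s [] _ = tt
  Chain-mono s (x ∷ []) _ = tt
  Chain-mono s (x ∷ y ∷ xs) (b , c) = s x y b , Chain-mono s (y ∷ xs) c

  -- With z = y this isolates the cycle closed by a backward walk.
  cut : ∀ {E : Rel n} {y} z xs → y ∈ xs → Unique xs → Chain E (z ∷ xs) →
    ∃ λ ps → Unique ps × y ∉ ps × (∀ {w} → w ∈ ps → w ∈ xs) × Chain E (z ∷ ps ++ [ y ])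
  cut z (y ∷ xs) (here refl) _ (b , _) = [] , [] , (λ ()) , (λ ()) , b , tt
  cut z (x ∷ xs) (there m) (x∉ ∷ u) (b , c) = let (ps , u′ , y∉ , s , c′) = cut x xs m u c in
    x ∷ ps , All.tabulate (λ w → All.lookup x∉ (s w)) ∷ u′ ,
    (λ { (here refl) → All.lookup x∉ m refl ; (there w) → y∉ w }) ,
    (λ { (here e) → here e ; (there w) → there (s w) }) , b , c′

  module Acyclic (E : Rel n) (acyclic : ∀ x xs → Unique (x ∷ xs) → ¬ Chain E ((x ∷ xs) ++ [ x ])) where

    Source : DSet (Fin n) → Fin n → Set
    Source X s = s ∈ˢ X × (∀ u → u ∈ˢ X → E u s ≢ true)

    -- Walking backwards inside X must either stop at a source or close a cycle.
    walk : ∀ X m x xs → Unique (x ∷ xs) → Chain E (x ∷ xs) → (∀ y → y ∈ x ∷ xs → y ∈ˢ X) → ∣ X ∣ < m + length (x ∷ xs) → ∃ (Source X)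
    walk X m x xs u c s l with ∃? (λ y → mem? X y ×-dec (E y x Bool.≟ true))
    ... | no none = x , s x (here refl) , λ y m e → none (y , m , e)
    ... | yes (y , y∈X , e) with any? (y ≟_) (x ∷ xs)
    ... | yes y∈ = let (ps , u′ , y∉ , _ , c′) = cut y (x ∷ xs) y∈ u (e , c) in
      ⊥-elim (acyclic y ps (All.tabulate (λ { w refl → y∉ w }) ∷ u′) c′)
    ... | no y∉ = continue m l
      where
      u′ : Unique (y ∷ x ∷ xs)
      u′ = All.tabulate (λ { w refl → y∉ w }) ∷ u
      s′ : ∀ z → z ∈ y ∷ x ∷ xs → z ∈ˢ X
      s′ z (here refl) = y∈X
      s′ z (there m) = s z m
      continue : ∀ m → ∣ X ∣ < m + length (x ∷ xs) → ∃ (Source X)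
      continue zero l = ⊥-elim (<⇒≱ l (unique-⊆-length u (λ m → ∈-elements X (s _ m))))
      continue (suc m) l = walk X m y (x ∷ xs) u′ (e , c) s′ (≤-trans l (≤-reflexive (sym (+-suc m _))))

    -- A source gets rank 0 and the ranks of the remaining vertices are shifted up.
    ranking : ∀ m X → ∣ X ∣ ≤ m → ∃ λ (r : Fin n → ℕ) → ∀ u v → u ∈ˢ X → v ∈ˢ X → E u v ≡ true → r u < r v
    ranking zero X l = (λ _ → 0) , λ u v p → ⊥-elim (<⇒≱ (1≤size X p) l)
    ranking (suc m) X l with ∃? (mem? X)
    ... | no none = (λ _ → 0) , λ u v p → ⊥-elim (none (u , p))
    ... | yes (x , x∈X) with walk X (∣ X ∣) x [] (All.[] ∷ []) tt (λ { _ (here refl) → x∈X }) (≤-reflexive (+-comm 1 (∣ X ∣)))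
    ... | s , s∈X , source with ranking m (X - s) (≤-pred (≤-trans (≤-reflexive (∣-∣ X s∈X)) l))
    ... | r , ok = (λ v → suc (r v)) [ s ≔ 0 ] , go
      where
      go : ∀ u v → u ∈ˢ X → v ∈ˢ X → E u v ≡ true → ((λ v → suc (r v)) [ s ≔ 0 ]) u < ((λ v → suc (r v)) [ s ≔ 0 ]) v
      go u v p q e with u ≟ s | v ≟ s
      ... | _ | yes refl = ⊥-elim (source u p e)
      ... | yes refl | no _ = s≤s z≤n
      ... | no a | no b = s≤s (ok u v (p , a) (q , b) e)

  -- The monochromatic arcs of all classes together form one acyclic digraph, so a single ranking
  -- serves every class.
  colouring⇒Col : ∀ {k} {T : Fin n → Bool} (B : Rel n) → DiColourable k T B → Col k (digraph B) fullˢ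
  colouring⇒Col {k} B (c , proper) = c , ranked (proj₁ ranks) λ u v _ _ b e → proj₂ ranks u v tt tt (arc u v b e)
    where
    E : Rel n
    E u v = B u v ∧ ⌊ c u ≟ c v ⌋
    arc : ∀ u v → B u v ≡ true → c u ≡ c v → E u v ≡ true
    arc u v b e with B u v | c u ≟ c v
    ... | true | yes _ = refl
    ... | true | no m = ⊥-elim (m e)
    ... | false | _ = b
    E⇒B : ∀ u v → E u v ≡ true → B u v ≡ true
    E⇒B u v e with B u v
    ... | true = refl
    ... | false = e
    E⇒≡ : ∀ u v → E u v ≡ true → c u ≡ c v
    E⇒≡ u v e with B u v | c u ≟ c v
    ... | true | yes m = m
    same : ∀ x xs {y} → Chain E (x ∷ xs ++ [ y ]) → ∀ z → z ∈ x ∷ xs → c z ≡ c x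
    same x xs _ z (here refl) = refl
    same x (w ∷ xs) (e , ch) z (there m) = trans (same w xs ch z m) (sym (E⇒≡ x w e))
    ranks = Acyclic.ranking E (λ x xs u ch → proper (x ∷ xs) (cyc x xs u (Chain-mono E⇒B (x ∷ xs ++ [ x ]) ch))
      (c x , All.tabulate λ {z} m → same x xs ch z m)) (∣ fullˢ {Fin n} ∣) fullˢ ≤-refl

  Col⇒colouring : ∀ {k} {T : Fin n → Bool} (B : Rel n) → Col k (digraph B) fullˢ → DiColourable k T B
  Col⇒colouring B (c , ranked r ok) = c , λ { .(x ∷ xs) (cyc x xs _ ch) (i , same) →
      <-irrefl refl (climb x xs x ch (All.lookup same (here refl)) (λ z m → All.lookup same m) (All.lookup same (here refl))) }
    where
    climb : ∀ {i} x xs y → Chain B (x ∷ xs ++ [ y ]) → c x ≡ i → (∀ z → z ∈ x ∷ xs → c z ≡ i) → c y ≡ i → r x < r y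
    climb x [] y (b , _) cx same cy = ok x y tt tt b (trans cx (sym cy))
    climb x (w ∷ xs) y (b , ch) cx same cy = let cw = same w (there (here refl)) in
      <-trans (ok x w tt tt b (trans cx (sym cw))) (climb w xs y ch cw (λ z m → same z (there m)) cy)

  ∣arcs∣≤arcCount : (A : Rel n) → ∣ arcs (digraph A) fullˢ ∣ ≤ arcCount A
  ∣arcs∣≤arcCount A = ≤-trans (∣∣-⊆ {P = arcs (digraph A) fullˢ} {pairs fullˢ (digraph A)} λ _ (_ , _ , a) → tt , a)
    (≤-reflexive (trans (∣pairs∣ fullˢ (digraph A)) (trans (cong (λ xs → sum (map (λ u → ∣ fibre (digraph A) u ∣) xs))
      (filter-all (mem? fullˢ) (All.tabulate {xs = allFin n} λ _ → tt))) (outer (allFin n)))))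
    where
    row : ∀ u xs → length (filter (λ v → A u v Bool.≟ true) xs) ≡ sum (map (λ v → if A u v then 1 else 0) xs)
    row u [] = refl
    row u (v ∷ xs) with A u v
    ... | true = cong suc (row u xs)
    ... | false = row u xs
    outer : ∀ xs → sum (map (λ u → ∣ fibre (digraph A) u ∣) xs) ≡ sum (map (λ u → sum (map (λ v → if A u v then 1 else 0) (allFin n))) xs)
    outer [] = refl
    outer (u ∷ xs) = cong₂ _+_ (row u (allFin n)) (outer xs)

  dicritical⇒Crit : ∀ {k} (A : Rel n) → Dicritical (suc k) A → Crit k (digraph A) fullˢ
  dicritical⇒Crit {k} A ((_ , ¬colourable) , proper) = critical (¬colourable ∘ Col⇒colouring {T = λ _ → true} A) λ v _ ¬col →
      ¬col (Col-mono (λ _ _ → tt) (λ { (x , y) ((_ , p) , (_ , q) , a) → kept v x y p q a })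
        (colouring⇒Col {T = stays v} (B v) (proper (without v) (inj₁ (v , removed v)))))
    where
    stays : Fin n → Fin n → Bool
    stays v x = not ⌊ x ≟ v ⌋
    B : Fin n → Rel n
    B v x y = A x y ∧ (stays v x ∧ stays v y)
    removed : ∀ v → stays v v ≡ false
    removed v with v ≟ v
    ... | yes _ = refl
    ... | no m = ⊥-elim (m refl)
    stays-≢ : ∀ {v x} → x ≢ v → stays v x ≡ true
    stays-≢ {v} {x} m with x ≟ v
    ... | yes e = ⊥-elim (m e)
    ... | no _ = refl
    kept : ∀ v x y → x ≢ v → y ≢ v → A x y ≡ true → B v x y ≡ true
    kept v x y p q a = cong₂ _∧_ a (cong₂ _∧_ (stays-≢ p) (stays-≢ q))
    ∧-true : ∀ a b → a ∧ b ≡ true → a ≡ true × b ≡ true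
    ∧-true true b e = refl , e
    without : Fin n → Subdigraph A
    without v = record { S = stays v ; B = B v ; B⊆A = λ x y e → proj₁ (∧-true (A x y) (stays v x ∧ stays v y) e)
      ; B-ends = λ x y e → ∧-true (stays v x) (stays v y) (proj₂ (∧-true (A x y) (stays v x ∧ stays v y) e)) }

-- Multiplication by 2(k - 1) clears the fractions: (k - 1/2 - 1/(k - 1)) becomes 2k² - 3k - 1, and
-- k(1/2 - 1/(k - 1)) becomes k(k - 3), moved to the other side. With k = κ + 3 these are `weight`
-- and `bound`.
theorem1p10 : (k : ℕ) → 5 ≤ k → (n : ℕ) → (A : Rel n) → Loopless A →
    Dicritical k A →
    (2 * k * k ∸ 3 * k ∸ 1) * n ≤ 2 * (k ∸ 1) * arcCount A + k * (k ∸ 3)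
theorem1p10 (suc (suc (suc κ))) (s≤s (s≤s (s≤s 2≤κ))) n A loopless crit = begin
    (2 * k * k ∸ 3 * k ∸ 1) * n                                              ≡⟨ cong₂ _*_ coefficient (sym (∣fullˢ∣ n)) ⟩
    weight K κ * ∣ fullˢ {Fin n} ∣                                           ≤⟨ critical-bound (≤-trans (s≤s z≤n) 2≤κ) (suc (∣ fullˢ {Fin n} ∣))
                                                                                  {D = digraph A} (λ v e → case trans (sym (loopless v)) e of λ ())
                                                                                  fullˢ ≤-refl (dicritical⇒Crit A crit) ⟩
    2 * K * ∣ arcs (digraph A) fullˢ ∣ + bound K κ                           ≤⟨ +-monoˡ-≤ (bound K κ) (*-monoʳ-≤ (2 * K) (∣arcs∣≤arcCount A)) ⟩
    2 * K * arcCount A + k * κ                                               ∎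
  where
  open ≤-Reasoning
  K k : ℕ
  K = 2 + κ
  k = 3 + κ
  coefficient : 2 * k * k ∸ 3 * k ∸ 1 ≡ weight K κ
  coefficient = trans (cong (λ x → x ∸ 3 * k ∸ 1) (identity κ)) (trans (∸-+-assoc (weight K κ + (3 * k + 1)) (3 * k) 1) (m+n∸n≡m (weight K κ) (3 * k + 1)))
    where
    identity : ∀ κ → 2 * (3 + κ) * (3 + κ) ≡ 2 * (2 + κ) * (2 + κ) + κ + (3 * (3 + κ) + 1)
    identity = solve-∀
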